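{- Let $\mathcal{A}$ be a primitive integral Apollonian circle packing. Depending on its type, $\chi_2(\mathcal{A})$ and (for types $(6,1)$ and $(6,17)$ with $\chi_2(\mathcal{A})=1$) $\chi_4(\mathcal{A})\in\{\pm1\}$, the following sets $S_{d,u}$ form reciprocity obstructions for $\mathcal{A}$, and for each listed residue class $r \bmod 24$ (all of which lie in $R(\mathcal{A})$) infinitely many positive integers $\equiv r \pmod{24}$ are not curvatures of circles of $\mathcal{A}$: - type $(6,1)$, $\chi_2=1$, $\chi_4=1$: no obstructions listed, no classes listed; - type $(6,1)$, $\chi_2=1$, $\chi_4=-1$: quartic $S_{4,1},S_{4,4},S_{4,9},S_{4,36}$; classes $0,1,4,9,12,16$; - type $(6,1)$, $\chi_2=-1$: quadratic $S_{2,1},S_{2,2},S_{2,3},S_{2,6}$; classes $0,1,4,9,12,16$; - type $(6,5)$, $\chi_2=1$: quadratic $S_{2,2},S_{2,3}$; classes $0,8,12$; - type $(6,5)$, $\chi_2=-1$: quadratic $S_{2,1},S_{2,6}$; classes $0,12$; - type $(6,13)$, $\chi_2=1$: quadratic $S_{2,2},S_{2,6}$; class $0$; - type $(6,13)$, $\chi_2=-1$: quadratic $S_{2,1},S_{2,3}$; classes $0,4,12,16$; - type $(6,17)$, $\chi_2=1$, $\chi_4=1$: quadratic $S_{2,3},S_{2,6}$, quartic $S_{4,9},S_{4,36}$; classes $0,9,12$; - type $(6,17)$, $\chi_2=1$, $\chi_4=-1$: quadratic $S_{2,3},S_{2,6}$, quartic $S_{4,1},S_{4,4}$; classes $0,9,12$;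 - type $(6,17)$, $\chi_2=-1$: quadratic $S_{2,1},S_{2,2}$; classes $0,8,9,12$; - type $(8,7)$, $\chi_2=1$: quadratic $S_{2,3},S_{2,6}$; classes $3,6$; - type $(8,7)$, $\chi_2=-1$: quadratic $S_{2,2}$; class $18$; - type $(8,11)$, $\chi_2=1$: no obstructions listed, no classes listed; - type $(8,11)$, $\chi_2=-1$: quadratic $S_{2,2},S_{2,3},S_{2,6}$; classes $2,3,6,18$.
   Context: Apollonian packings: start from four mutually tangent circles in the plane (lines allowed) and repeatedly add, for every triple of mutually tangent circles present, the two circles tangent to all three. Curvatures are signed: $1/\text{radius}$, lines have curvature $0$, a circle containing the others in its interior has negative curvature. Curvatures $(a,b,c,d)$ of four mutually tangent circles of the packing (a Descartes quadruple of it) satisfy $(a+b+c+d)^2=2(a^2+b^2+c^2+d^2)$. The packing is primitive integral if all curvatures are integers with overall gcd $1$. Type: $R(\mathcal{A})$ is the set of residues mod $24$ of curvatures of $\mathcal{A}$; it is one of: type $(6,1)$: $\{0,1,4,9,12,16\}$; type $(6,5)$: $\{0,5,8,12,20,21\}$; type $(6,13)$: $\{0,4,12,13,16,21\}$; type $(6,17)$: $\{0,8,9,12,17,20\}$; type $(8,7)$: $\{3,6,7,10,15,18,19,22\}$; type $(8,11)$: $\{2,3,6,11,14,15,18,23\}$. Reciprocity obstruction: for $u,d>0$ let $S_{d,u}=\{un^d:n\in\mathbb{Z}\}$. It forms a reciprocity obstruction for $\mathcal{A}$ if infinitely many elements of $S_{d,u}$ have residue mod $24$ in $R(\mathcal{A})$,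 yet no element of $S_{d,u}$ is the curvature of a circle of $\mathcal{A}$. $\chi_2$: for a circle $\mathcal{C}$ of $\mathcal{A}$ of nonzero curvature $n$, pick circles of $\mathcal{A}$ with curvatures $b,c,d$ such that these and $\mathcal{C}$ are mutually tangent, and let $f_{\mathcal{C}}(x,y)=(n+b)x^2+(n+b+c-d)xy+(n+c)y^2$ (a primitive positive definite form of discriminant $-4n^2$; other choices give $\mathrm{GL}(2,\mathbb{Z})$-equivalent forms). The residues mod $n$ of values $f_{\mathcal{C}}(x,y)$ with $\gcd(x,y)=1$ that are coprime to $n$ lie in a single coset of the squares in $(\mathbb{Z}/n\mathbb{Z})^\times$; let $\rho$ be any positive integer in that coset. With $(\tfrac{\cdot}{\cdot})$ the Kronecker symbol, $\chi_2(\mathcal{C})=(\tfrac{\rho}{n})$ if $n\equiv 0,1\pmod 4$, $(\tfrac{ -\rho}{n/2})$ if $n\equiv 2\pmod 4$, $(\tfrac{2\rho}{n})$ if $n\equiv 3\pmod 4$. This is well defined and independent of $\mathcal{C}$ (over circles of nonzero curvature); the common value is $\chi_2(\mathcal{A})\in\{\pm1\}$. $\chi_4$ (types $(6,1)$, $(6,17)$ only): In $\mathbb{Z}[i]$, $N(a+bi)=a^2+b^2$; $\alpha$ is odd if $N(\alpha)$ is odd; odd $a+bi$ is primary if $(a,b)\equiv(1,0)$ or $(3,2)\pmod 4$. For coprime $\alpha,\beta\in\mathbb{Z}[i]$, $\beta$ odd, the quartic residue symbol $[\alpha/\beta]_4$ is defined by: for an odd Gaussian prime $\pi\nmid\alpha$,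 $[\alpha/\pi]_4$ is the unique element of $\{1,i,-1,-i\}$ congruent to $\alpha^{(N(\pi)-1)/4}$ mod $\pi$, and for $\beta=u\pi_1\cdots\pi_k$ ($u$ a unit) $[\alpha/\beta]_4=\prod_j[\alpha/\pi_j]_4$. For $M=\begin{pmatrix}\alpha&\gamma\\ \beta&\delta\end{pmatrix}\in \mathrm{SL}(2,\mathbb{Z}[i])$ let $C_M$ be the image of $\mathbb{R}\cup\{\infty\}$ under $z\mapsto 2(\alpha z+\gamma)/(\beta z+\delta)$. Every primitive integral Apollonian packing is congruent by a Euclidean motion to one all of whose circles are of the form $C_M$; fix such a placement of $\mathcal{A}$. For a circle $\mathcal{C}=C_M$ of $\mathcal{A}$ put $\Lambda_{\mathcal{C}}=\beta\mathbb{Z}+\delta\mathbb{Z}\subseteq\mathbb{Z}[i]$ (well defined up to multiplication by a unit). For $\mathcal{C}$ of nonzero curvature $n$ (necessarily $n\equiv0,1,4\pmod 8$), choose $\beta=a+bi\in\Lambda_{\mathcal{C}}\cup i\Lambda_{\mathcal{C}}$ coprime to $n$ in $\mathbb{Z}[i]$, primary if $n$ is even; write $n=2^en'$, $n'$ odd; set $\chi_4(\mathcal{C})=(-1)^{be/4}[\beta/n']_4$ if $n\equiv0\pmod 8$, $[\beta/n]_4$ if $n\equiv1\pmod 8$, $(\tfrac{ -1}{n'})[\beta/n']_4$ if $n\equiv4\pmod 8$. This is well defined and constant over circles of nonzero curvature of $\mathcal{A}$; the common value is $\chi_4(\mathcal{A})\in\{1,i,-1,-i\}$, and $\chi_4(\mathcal{A})^2=\chi_2(\mathcal{A})$.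 -}

module Defs where

open import Data.Nat as ℕ using (ℕ; zero; suc)
open import Data.Nat.Primality using (Prime)
open import Data.Integer as ℤ
  using (ℤ; +_; -_; _+_; _*_; _-_; _<_; _^_; ∣_∣; 0ℤ; 1ℤ; _%ℕ_)
open import Data.Integer.Divisibility using (_∣_)
open import Data.Fin using (Fin; _≟_)
open import Data.List using (List; []; _∷_; foldr)
open import Data.List.Relation.Unary.All using (All)
open import Data.List.Membership.Propositional using (_∈_)
open import Data.Product using (Σ; ∃; ∃-syntax; _×_; _,_; uncurry)
open import Data.Sum using (_⊎_)
open import Relation.Nullary using (¬_; yes; no)
open import Relation.Binary.PropositionalEquality using (_≡_; _≢_)
open import Function.Bundles using (_⇔_)

-- Oriented circles in augmented curvature-center (ACC) coordinates
-- (Lagarias–Mallows–Wilks): an oriented circle of signed curvature b,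
-- center c, is the vector (b̄ , b , w) with w = b·c ∈ ℂ and co-curvature
-- b̄ = b|c|² − 1/b (for a line: b = 0, w = unit normal, b̄ = twice the
-- signed distance to the origin).  For packings placed as in the paper
-- (all circles of the form C_M) these coordinates are integers.

record Circle : Set where
  constructor circ
  field
    cobar : ℤ
    curv  : ℤ
    wx    : ℤ
    wy    : ℤ
open Circle public

_⊕_ : Circle → Circle → Circle
circ a b c d ⊕ circ a' b' c' d' = circ (a + a') (b + b') (c + c') (d + d')

_⊙_ : ℤ → Circle → Circle
k ⊙ circ a b c d = circ (k * a) (k * b) (k * c) (k * d)

negC : Circle → Circle
negC v = (- 1ℤ) ⊙ v

-- twice the Lorentz bilinear form  ⟨v,v'⟩ = −(b̄b'+bb̄')/2 + w·w'
form2 : Circle → Circle → ℤ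
form2 (circ a b x y) (circ a' b' x' y') =
  - (a * b' + b * a') + (+ 2) * (x * x' + y * y')

IsCircle : Circle → Set
IsCircle v = form2 v v ≡ + 2

Config : Set
Config = Fin 4 → Circle

curvSum : Config → ℤ
curvSum D = curv (D Fin.zero) + curv (D (Fin.suc Fin.zero))
          + curv (D (Fin.suc (Fin.suc Fin.zero)))
          + curv (D (Fin.suc (Fin.suc (Fin.suc Fin.zero))))
  where import Data.Fin as Fin

-- four mutually tangent oriented circles with disjoint interiors:
-- pairwise ⟨v_i,v_j⟩ = −1, and positively oriented (total curvature > 0)
IsDescartes : Config → Set
IsDescartes D =
  (∀ i → IsCircle (D i)) ×
  (∀ i j → i ≢ j → form2 (D i) (D j) ≡ - (+ 2)) ×
  (0ℤ < curvSum D)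

total : Config → Circle
total D = D Fin.zero ⊕ (D (Fin.suc Fin.zero) ⊕ (D (Fin.suc (Fin.suc Fin.zero))
          ⊕ D (Fin.suc (Fin.suc (Fin.suc Fin.zero)))))
  where import Data.Fin as Fin

-- replace the i-th circle by the other circle tangent to the remaining
-- three:  v_i ↦ 2(Σ_{j≠i} v_j) − v_i = 2·(Σ_j v_j) − 3·v_i
swap : Fin 4 → Config → Config
swap i D j with j ≟ i
... | yes _ = ((+ 2) ⊙ total D) ⊕ ((- (+ 3)) ⊙ D i)
... | no  _ = D j

data Reach (root : Config) : Config → Set where
  base : Reach root root
  step : ∀ {D} (i : Fin 4) → Reach root D → Reach root (swap i D)

InPacking : Config → Circle → Set
InPacking root v = ∃[ D ] (Reach root D × ∃[ i ] (D i ≡ v))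

IsCurv : Config → ℤ → Set
IsCurv root m = ∃[ v ] (InPacking root v × curv v ≡ m)

Primitive : Config → Set
Primitive root = ∀ g → (∀ v → InPacking root v → g ∣ curv v) → g ∣ 1ℤ

InR : Config → ℕ → Set
InR root r = ∃[ v ] (InPacking root v × curv v %ℕ 24 ≡ r)

TypeIs : Config → List ℕ → Set
TypeIs root S = ∀ r → (InR root r ⇔ r ∈ S)

type6-1 type6-5 type6-13 type6-17 type8-7 type8-11 : List ℕ
type6-1  = 0 ∷ 1 ∷ 4 ∷ 9 ∷ 12 ∷ 16 ∷ []
type6-5  = 0 ∷ 5 ∷ 8 ∷ 12 ∷ 20 ∷ 21 ∷ []
type6-13 = 0 ∷ 4 ∷ 12 ∷ 13 ∷ 16 ∷ 21 ∷ []
type6-17 = 0 ∷ 8 ∷ 9 ∷ 12 ∷ 17 ∷ 20 ∷ []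
type8-7  = 3 ∷ 6 ∷ 7 ∷ 10 ∷ 15 ∷ 18 ∷ 19 ∷ 22 ∷ []
type8-11 = 2 ∷ 3 ∷ 6 ∷ 11 ∷ 14 ∷ 15 ∷ 18 ∷ 23 ∷ []

LegendreIs : ℤ → ℕ → ℤ → Set
LegendreIs a p v =
  ((+ p) ∣ a × v ≡ 0ℤ)
  ⊎ (¬ ((+ p) ∣ a) × (∃[ x ] ((+ p) ∣ (x * x - a))) × v ≡ 1ℤ)
  ⊎ (¬ ((+ p) ∣ a) × ¬ (∃[ x ] ((+ p) ∣ (x * x - a))) × v ≡ - 1ℤ)

KronPrimeIs : ℤ → ℕ → ℤ → Set
KronPrimeIs a p v =
  (p ≡ 2 × ((a %ℕ 2 ≡ 0 × v ≡ 0ℤ)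
           ⊎ ((a %ℕ 8 ≡ 1 ⊎ a %ℕ 8 ≡ 7) × v ≡ 1ℤ)
           ⊎ ((a %ℕ 8 ≡ 3 ⊎ a %ℕ 8 ≡ 5) × v ≡ - 1ℤ)))
  ⊎ (p ≢ 2 × LegendreIs a p v)

KronList : ℤ → List ℕ → ℤ → Set
KronList a []       v = v ≡ 1ℤ
KronList a (p ∷ ps) v = ∃[ x ] ∃[ y ] (KronPrimeIs a p x × KronList a ps y × v ≡ x * y)

productℕ : List ℕ → ℕ
productℕ = foldr ℕ._*_ 1

KronSignIs : ℤ → ℤ → ℤ → Set
KronSignIs a n s = (n < 0ℤ × a < 0ℤ × s ≡ - 1ℤ) ⊎ (¬ (n < 0ℤ × a < 0ℤ) × s ≡ 1ℤ)

KronIs : ℤ → ℤ → ℤ → Set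
KronIs a n v = n ≢ 0ℤ × ∃[ ps ] (All Prime ps × productℕ ps ≡ ∣ n ∣ ×
               ∃[ s ] ∃[ t ] (KronSignIs a n s × KronList a ps t × v ≡ s * t))

CoprimeZ : ℤ → ℤ → Set
CoprimeZ a b = ∀ g → g ∣ a → g ∣ b → g ∣ 1ℤ

fC : ℤ → ℤ → ℤ → ℤ → ℤ → ℤ → ℤ
fC n b c d x y = (n + b) * (x * x) + (n + b + c - d) * (x * y) + (n + c) * (y * y)

-- ρ > 0 lies in the coset of squares in (ℤ/n)^× containing the values
-- f(x,y), gcd(x,y)=1, coprime to n
ValidRho : ℤ → ℤ → ℤ → ℤ → ℤ → Set
ValidRho n b c d ρ = 0ℤ < ρ × ∃[ x ] ∃[ y ] ∃[ t ]
  (CoprimeZ x y × CoprimeZ (fC n b c d x y) n × CoprimeZ t n ×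
   n ∣ (ρ - fC n b c d x y * (t * t)))

Chi2At : ℤ → ℤ → ℤ → Set
Chi2At n ρ v =
  ((n %ℕ 4 ≡ 0 ⊎ n %ℕ 4 ≡ 1) × KronIs ρ n v)
  ⊎ (n %ℕ 4 ≡ 2 × ∃[ m ] (n ≡ (+ 2) * m × KronIs (- ρ) m v))
  ⊎ (n %ℕ 4 ≡ 3 × KronIs ((+ 2) * ρ) n v)

Distinct4 : Fin 4 → Fin 4 → Fin 4 → Fin 4 → Set
Distinct4 i j k l = i ≢ j × i ≢ k × i ≢ l × j ≢ k × j ≢ l × k ≢ l

Chi2Is : Config → ℤ → Set
Chi2Is root ε = ∀ D → Reach root D → ∀ i j k l → Distinct4 i j k l →
  curv (D i) ≢ 0ℤ → ∀ ρ →
  ValidRho (curv (D i)) (curv (D j)) (curv (D k)) (curv (D l)) ρ →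
  ∀ v → Chi2At (curv (D i)) ρ v → v ≡ ε

record 𝔾 : Set where
  constructor _+i_
  field
    re im : ℤ
open 𝔾 public

infixl 6 _+ᵍ_ _-ᵍ_
infixl 7 _*ᵍ_

_+ᵍ_ : 𝔾 → 𝔾 → 𝔾
(a +i b) +ᵍ (c +i d) = (a + c) +i (b + d)

_*ᵍ_ : 𝔾 → 𝔾 → 𝔾
(a +i b) *ᵍ (c +i d) = (a * c - b * d) +i (a * d + b * c)

-ᵍ_ : 𝔾 → 𝔾
-ᵍ (a +i b) = (- a) +i (- b)

_-ᵍ_ : 𝔾 → 𝔾 → 𝔾
x -ᵍ y = x +ᵍ (-ᵍ y)

conj : 𝔾 → 𝔾
conj (a +i b) = a +i (- b)

fromℤ : ℤ → 𝔾
fromℤ a = a +i 0ℤ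

iᵍ 1ᵍ 0ᵍ : 𝔾
iᵍ = 0ℤ +i 1ℤ
1ᵍ = 1ℤ +i 0ℤ
0ᵍ = 0ℤ +i 0ℤ

Nᵍ : 𝔾 → ℤ
Nᵍ (a +i b) = a * a + b * b

_^ᵍ_ : 𝔾 → ℕ → 𝔾
x ^ᵍ zero  = 1ᵍ
x ^ᵍ suc k = x *ᵍ (x ^ᵍ k)

_∣ᵍ_ : 𝔾 → 𝔾 → Set
a ∣ᵍ b = ∃[ k ] (b ≡ a *ᵍ k)

Unitᵍ : 𝔾 → Set
Unitᵍ u = Nᵍ u ≡ 1ℤ

Coprimeᵍ : 𝔾 → 𝔾 → Set
Coprimeᵍ a b = ∀ g → g ∣ᵍ a → g ∣ᵍ b → Unitᵍ g

GPrime : 𝔾 → Set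
GPrime π = π ≢ 0ᵍ × ¬ Unitᵍ π × (∀ x y → π ≡ x *ᵍ y → Unitᵍ x ⊎ Unitᵍ y)

Oddᵍ : 𝔾 → Set
Oddᵍ α = Nᵍ α %ℕ 2 ≡ 1

Primary : 𝔾 → Set
Primary (a +i b) = Oddᵍ (a +i b) ×
  ((a %ℕ 4 ≡ 1 × b %ℕ 4 ≡ 0) ⊎ (a %ℕ 4 ≡ 3 × b %ℕ 4 ≡ 2))

QuarticPrimeIs : 𝔾 → 𝔾 → 𝔾 → Set
QuarticPrimeIs α π v = ¬ (π ∣ᵍ α) × Unitᵍ v ×
  π ∣ᵍ ((α ^ᵍ ((∣ Nᵍ π ∣ ℕ.∸ 1) ℕ./ 4)) -ᵍ v)

QuarticList : 𝔾 → List 𝔾 → 𝔾 → Set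
QuarticList α []       v = v ≡ 1ᵍ
QuarticList α (π ∷ πs) v =
  ∃[ x ] ∃[ y ] (QuarticPrimeIs α π x × QuarticList α πs y × v ≡ x *ᵍ y)

productᵍ : List 𝔾 → 𝔾
productᵍ = foldr _*ᵍ_ 1ᵍ

QuarticIs : 𝔾 → 𝔾 → 𝔾 → Set
QuarticIs α β v = ∃[ u ] ∃[ πs ] (Unitᵍ u × All (λ π → GPrime π × Oddᵍ π) πs ×
  β ≡ u *ᵍ productᵍ πs × QuarticList α πs v)

-- M = (α γ ; β δ) ∈ SL(2,ℤ[i])
record SL2 : Set where
  field
    α β γ δ : 𝔾
    det1 : α *ᵍ δ -ᵍ γ *ᵍ β ≡ 1ᵍ
open SL2 public

-- ACC coordinates (up to orientation) of C_M, the image of ℝ ∪ {∞}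
-- under z ↦ 2(αz+γ)/(βz+δ):
--   b = Im(β δ̄),  b̄ = 4 Im(α γ̄),  w = i(γ β̄ − α δ̄)
accOf : SL2 → Circle
accOf M = circ ((+ 4) * im (α M *ᵍ conj (γ M)))
               (im (β M *ᵍ conj (δ M)))
               (re w) (im w)
  where w = iᵍ *ᵍ (γ M *ᵍ conj (β M) -ᵍ α M *ᵍ conj (δ M))

-- C_M is the circle v (as a point set, ignoring orientation)
Represents : SL2 → Circle → Set
Represents M v = accOf M ≡ v ⊎ accOf M ≡ negC v

Placed : Config → Set
Placed root = ∀ v → InPacking root v → ∃[ M ] Represents M v

InLam : SL2 → 𝔾 → Set
InLam M b = ∃[ x ] ∃[ y ]
  (b ≡ fromℤ x *ᵍ β M +ᵍ fromℤ y *ᵍ δ M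
   ⊎ b ≡ iᵍ *ᵍ (fromℤ x *ᵍ β M +ᵍ fromℤ y *ᵍ δ M))

ipowℕ : ℕ → 𝔾
ipowℕ k = iᵍ ^ᵍ k

ipow : ℤ → 𝔾
ipow t = ipowℕ (t %ℕ 4)

TwoSplit : ℤ → ℕ → ℤ → Set
TwoSplit n e n' = n ≡ (+ 2) ^ e * n' × n' %ℕ 2 ≡ 1

-- χ₄(𝒞) = val for a circle of curvature n and a chosen β' = a+bi;
-- (−1)^{be/4} is read as e^{iπ be/4} = i^{be/2} (b is even)
Chi4At : ℤ → 𝔾 → 𝔾 → Set
Chi4At n b' val =
  (n %ℕ 8 ≡ 0 × ∃[ e ] ∃[ n' ] (TwoSplit n e n' × ∃[ t ] ∃[ q ]
     (im b' * (+ e) ≡ (+ 2) * t × QuarticIs b' (fromℤ n') q × val ≡ ipow t *ᵍ q)))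
  ⊎ (n %ℕ 8 ≡ 1 × QuarticIs b' (fromℤ n) val)
  ⊎ (n %ℕ 8 ≡ 4 × ∃[ e ] ∃[ n' ] (TwoSplit n e n' × ∃[ s ] ∃[ q ]
     (KronIs (- 1ℤ) n' s × QuarticIs b' (fromℤ n') q × val ≡ fromℤ s *ᵍ q)))

Chi4Is : Config → 𝔾 → Set
Chi4Is root ε = ∀ D → Reach root D → ∀ i → curv (D i) ≢ 0ℤ →
  ∀ M → Represents M (D i) → ∀ b' → InLam M b' →
  Coprimeᵍ b' (fromℤ (curv (D i))) →
  (curv (D i) %ℕ 2 ≡ 0 → Primary b') →
  ∀ val → Chi4At (curv (D i)) b' val → val ≡ ε

Obstruction : Config → ℕ → ℕ → Set
Obstruction root d u =
  (∀ N → ∃[ m ] (N < (+ u) * m ^ d × InR root (((+ u) * m ^ d) %ℕ 24)))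
  × (∀ m → ¬ IsCurv root ((+ u) * m ^ d))

Exceptional : Config → ℕ → Set
Exceptional root r = InR root r ×
  (∀ N → ∃[ m ] (N ℕ.< m × m ℕ.% 24 ≡ r × ¬ IsCurv root (+ m)))

Conclusion : Config → List (ℕ × ℕ) → List ℕ → Set
Conclusion root obs cls =
  All (uncurry (Obstruction root)) obs × All (Exceptional root) cls

{-# OPTIONS --safe #-}
module Submission where

-- χ₂ and χ₄ are constant on the packing, so it suffices to evaluate them at a
-- circle of curvature n = u mᵈ.  There the primes of m cancel in the Kronecker
-- or quartic symbol, and what remains are symbols at 2 and 3 of a value of f_C,
-- respectively of a norm from Λ.  Both forms have discriminant −4n², so any two
-- of their values multiply to a square modulo n²; hence the remaining symbols
-- are read off the residues modulo 24 of the tangent curvatures.  A line in the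
-- packing (m = 0) leads by descent to a circle of curvature 1.


open import Defs
open import Data.Nat as ℕ using (ℕ; zero; suc; NonZero)
import Data.Nat.Properties as ℕ
import Data.Nat.Divisibility as ℕ
import Data.Nat.DivMod as ℕ
open import Data.Nat.Primality as Primality using (Prime; euclidsLemma; prime⇒nonZero; prime⇒irreducible)
open import Data.Nat.Primality.Factorisation using (factorise; PrimeFactorisation; factorisationHasAllPrimeFactors)
import Data.Nat.Coprimality as Coprimality
open import Data.Nat.GCD using (module Bézout; module GCD)
open import Data.Nat.ListAction using (product)
open import Data.Nat.ListAction.Properties using (∈⇒∣product; product-++)
open import Data.Integer as ℤ
  using (ℤ; +_; -[1+_]; -_; _+_; _*_; _-_; _<_; _≤_; _^_; ∣_∣; 0ℤ; 1ℤ; _%ℕ_; _/ℕ_; +<+; +≤+)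
import Data.Integer.Properties as ℤ
open import Data.Integer.DivMod using (n%ℕd<d; a≡a%ℕn+[a/ℕn]*n)
open import Data.Integer.Divisibility.Signed as Signed
  using (divides; ∣ᵤ⇒∣; ∣⇒∣ᵤ; ∣-refl; ∣-trans; ∣m∣n⇒∣m+n; ∣m∣n⇒∣m-n; ∣m⇒∣-m; ∣m⇒∣m*n; ∣n⇒∣m*n; ∣m+n∣m⇒∣n; ∣m+n∣n⇒∣m; _∣?_) renaming (_∣_ to _∣ᶻ_)
open import Data.Integer.Tactic.RingSolver using (solve-∀)
open import Data.List using (List; []; _∷_; _++_; filter)
open import Data.List.Relation.Unary.All as All using (All; []; _∷_)
open import Data.List.Relation.Unary.Any using (here; there)
open import Data.List.Membership.Propositional using (_∈_)
open import Data.List.Membership.Propositional.Properties using (∈-filter⁺; ∈-filter⁻)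
open import Data.Product using (∃-syntax; _×_; _,_; proj₁; proj₂)
open import Data.Sum using (_⊎_; inj₁; inj₂; [_,_]′; reduce)
open import Data.Empty using (⊥; ⊥-elim)
open import Function using (_∘_; case_of_)
open import Relation.Nullary using (¬_; Dec; yes; no; ¬?; _×-dec_)
open import Relation.Nullary.Decidable using (from-yes; from-no; _→-dec_; _⊎-dec_; True; toWitness; map′)
open import Relation.Binary.PropositionalEquality
  using (_≡_; _≢_; refl; sym; trans; cong; cong₂; subst; subst₂; isEquivalence; module ≡-Reasoning)
open import Data.Fin as Fin using (Fin; toℕ; fromℕ<)
import Data.Fin.Properties as Fin
import Data.List.Relation.Unary.All.Properties as All
open import Data.Fin.Patterns using (0F; 1F; 2F; 3F)
open import Data.List.Membership.DecPropositional ℕ._≟_ using (_∈?_)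
open import Function.Bundles using (Equivalence)
open import Algebra.Bundles using (CommutativeRing)
open import Level using (0ℓ)
open import Data.Maybe using (just; nothing)
import Tactic.RingSolver as 𝔾S
import Tactic.RingSolver.Core.AlmostCommutativeRing as ACR
import Algebra.Properties.CommutativeSemiring.Binomial as Binomial
import Algebra.Properties.Semiring.Exp as Exp
import Algebra.Properties.Semiring.Mult as Mult
import Algebra.Properties.Semiring.Sum as Sum
open import Data.Nat.Combinatorics using (nCn≡1; nCk≡nC[n∸k]; nCk≡n!/k![n-k]!; k![n∸k]!∣n!) renaming (_C_ to _choose_)
open import Data.Nat.Base using (_!)
import Data.Nat.Tactic.RingSolver as ℕSolver

-- Congruences

-- `Chi2Is` and `Chi4Is` are conditional statements about symbols given as relations: they yield
-- nothing until a concrete ρ or b', a prime factorisation of the modulus and a value of every prime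
-- symbol have been exhibited. Hence much of the work is existence: squares modulo p are decided by
-- search, and quartic symbols come from a Fermat congruence in ℤ[i]. The values at the primes of m
-- stay unknown; each is squared, or raised to the fourth power. The moduli 8 and 3 are special
-- because all their units square to 1. There, two units whose product is a square are congruent.
-- For χ₄ the matrix M describes a single circle, while the norms of Λ have to be compared with the
-- curvatures of its neighbours. Pulling back by M turns the circle into the real line and a
-- neighbour of curvature b into a circle tangent to that line at a rational point or at ∞. Its two
-- diagonal coefficients p and q are coprime with square product, hence squares, and p (b + n) and q
-- (b + n) are norms from Λ.

infix 4 _≡_[mod_]

-- A record keeps `a`, `b` and `m` visible to unification; in the bare divisibility they would sit
-- under a subtraction that unfolds.
record _≡_[mod_] (a b m : ℤ) : Set where
  constructor by-∣
  field diff : m ∣ᶻ (a - b)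
open _≡_[mod_] public

mod-reflexive : ∀ {m a b} → a ≡ b → a ≡ b [mod m ]
mod-reflexive {m} {a} refl = by-∣ (divides 0ℤ (trans (ℤ.+-inverseʳ a) (sym (ℤ.*-zeroˡ m))))

mod-refl : ∀ {m a} → a ≡ a [mod m ]
mod-refl = mod-reflexive refl

mod-sym : ∀ {m a b} → a ≡ b [mod m ] → b ≡ a [mod m ]
mod-sym {m} {a} {b} (by-∣ p) = by-∣ (subst (m ∣ᶻ_) (eq a b) (∣m⇒∣-m p))
  where eq : ∀ a b → - (a - b) ≡ b - a
        eq = solve-∀

mod-trans : ∀ {m a b c} → a ≡ b [mod m ] → b ≡ c [mod m ] → a ≡ c [mod m ]
mod-trans {m} {a} {b} {c} (by-∣ p) (by-∣ q) = by-∣ (subst (m ∣ᶻ_) (eq a b c) (∣m∣n⇒∣m+n p q))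
  where eq : ∀ a b c → (a - b) + (b - c) ≡ a - c
        eq = solve-∀

mod-+ : ∀ {m a b c d} → a ≡ b [mod m ] → c ≡ d [mod m ] → a + c ≡ b + d [mod m ]
mod-+ {m} {a} {b} {c} {d} (by-∣ p) (by-∣ q) = by-∣ (subst (m ∣ᶻ_) (eq a b c d) (∣m∣n⇒∣m+n p q))
  where eq : ∀ a b c d → (a - b) + (c - d) ≡ (a + c) - (b + d)
        eq = solve-∀

mod-* : ∀ {m a b c d} → a ≡ b [mod m ] → c ≡ d [mod m ] → a * c ≡ b * d [mod m ]
mod-* {m} {a} {b} {c} {d} (by-∣ p) (by-∣ q) =
  by-∣ (subst (m ∣ᶻ_) (eq a b c d) (∣m∣n⇒∣m+n (∣m⇒∣m*n c p) (∣n⇒∣m*n b q)))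
  where eq : ∀ a b c d → (a - b) * c + b * (c - d) ≡ a * c - b * d
        eq = solve-∀

mod-coarsen : ∀ {m k a b} → k ∣ᶻ m → a ≡ b [mod m ] → a ≡ b [mod k ]
mod-coarsen d (by-∣ p) = by-∣ (∣-trans d p)

∣⇒≡0 : ∀ {m a} → m ∣ᶻ a → a ≡ 0ℤ [mod m ]
∣⇒≡0 {m} {a} = by-∣ ∘ subst (m ∣ᶻ_) (sym (ℤ.+-identityʳ a))

≡0⇒∣ : ∀ {m a} → a ≡ 0ℤ [mod m ] → m ∣ᶻ a
≡0⇒∣ {m} {a} = subst (m ∣ᶻ_) (ℤ.+-identityʳ a) ∘ diff

mod-∣ : ∀ {m a b} → a ≡ b [mod m ] → m ∣ᶻ b → m ∣ᶻ a
mod-∣ p q = ≡0⇒∣ (mod-trans p (∣⇒≡0 q))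

≡%ℕ : ∀ a d .{{_ : NonZero d}} → a ≡ + (a %ℕ d) [mod + d ]
≡%ℕ a d = by-∣ (divides (a /ℕ d)
  (trans (cong (_- + (a %ℕ d)) (a≡a%ℕn+[a/ℕn]*n a d)) (eq (+ (a %ℕ d)) ((a /ℕ d) * + d))))
  where eq : ∀ x y → (x + y) - x ≡ y
        eq = solve-∀

%ℕ≡⇒mod : ∀ {a r} d .{{_ : NonZero d}} → a %ℕ d ≡ r → a ≡ + r [mod + d ]
%ℕ≡⇒mod {a} d eq = subst (λ r → a ≡ + r [mod + d ]) eq (≡%ℕ a d)

∣∧<⇒≡0 : ∀ {d k} → d ℕ.∣ k → k ℕ.< d → k ≡ 0
∣∧<⇒≡0 {k = zero}  _ _ = refl
∣∧<⇒≡0 {k = suc k} p q = ⊥-elim (ℕ.<⇒≱ q (ℕ.∣⇒≤ p))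

mod-unique : ∀ {d r s} → r ℕ.< d → s ℕ.< d → + r ≡ + s [mod + d ] → r ≡ s
mod-unique {d} {r} {s} r<d s<d p = ℤ.+-injective (ℤ.i-j≡0⇒i≡j (+ r) (+ s)
  (ℤ.∣i∣≡0⇒i≡0 (∣∧<⇒≡0 (∣⇒∣ᵤ (diff p)) bound)))
  where
  bound : ∣ + r - + s ∣ ℕ.< d
  bound = subst (λ z → ∣ z ∣ ℕ.< d) (sym (ℤ.[+m]-[+n]≡m⊖n r s))
    (ℕ.≤-<-trans (ℤ.∣m⊝n∣≤m⊔n r s) (ℕ.⊔-lub r<d s<d))

mod⇒%ℕ≡ : ∀ {a b} d .{{_ : NonZero d}} → a ≡ b [mod + d ] → a %ℕ d ≡ b %ℕ d
mod⇒%ℕ≡ {a} {b} d p = mod-unique (n%ℕd<d a d) (n%ℕd<d b d)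
  (mod-trans (mod-sym (≡%ℕ a d)) (mod-trans p (≡%ℕ b d)))

%ℕ-%ℕ : ∀ a d e .{{_ : NonZero d}} .{{_ : NonZero e}} → d ℕ.∣ e → (a %ℕ e) ℕ.% d ≡ a %ℕ d
%ℕ-%ℕ a d e d∣e = sym (mod⇒%ℕ≡ {a} {+ (a %ℕ e)} d (mod-coarsen (∣ᵤ⇒∣ d∣e) (≡%ℕ a e)))

%ℕ≡0⇒∣ : ∀ {a} d .{{_ : NonZero d}} → a %ℕ d ≡ 0 → + d ∣ᶻ a
%ℕ≡0⇒∣ {a} d eq = ≡0⇒∣ (%ℕ≡⇒mod {a} d eq)

∣⇒%ℕ≡0 : ∀ {a} d .{{_ : NonZero d}} → + d ∣ᶻ a → a %ℕ d ≡ 0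
∣⇒%ℕ≡0 {a} d p = trans (mod⇒%ℕ≡ {a} {0ℤ} d (∣⇒≡0 p)) (0%ℕ d)
  where 0%ℕ : ∀ d .{{_ : NonZero d}} → 0ℤ %ℕ d ≡ 0
        0%ℕ (suc d) = refl

-- Coprimality in Bézout form

-- With explicit cofactors, closure under products, divisors and congruent replacement becomes a
-- single ring identity each.
Bz : ℤ → ℤ → Set
Bz a b = ∃[ s ] ∃[ t ] s * a + t * b ≡ 1ℤ

Bz-sym : ∀ {a b} → Bz a b → Bz b a
Bz-sym {a} {b} (s , t , eq) = t , s , trans (ℤ.+-comm (t * b) (s * a)) eq

Bz-1 : ∀ {a} → Bz a 1ℤ
Bz-1 {a} = 0ℤ , 1ℤ , cong (_+ 1ℤ) (ℤ.*-zeroˡ a)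

Bz⇒CoprimeZ : ∀ {a b} → Bz a b → CoprimeZ a b
Bz⇒CoprimeZ {a} {b} (s , t , eq) g g∣a g∣b = ∣⇒∣ᵤ
  (subst (g ∣ᶻ_) eq (∣m∣n⇒∣m+n (∣n⇒∣m*n s (∣ᵤ⇒∣ g∣a)) (∣n⇒∣m*n t (∣ᵤ⇒∣ g∣b))))

Bz-* : ∀ {a b c} → Bz a b → Bz a c → Bz a (b * c)
Bz-* {a} {b} {c} (s , t , eq) (s' , t' , eq') =
  s * s' * a + s * t' * c + t * b * s' , t * t' ,
  trans (id s t s' t' a b c) (cong₂ _*_ eq eq')
  where
  id : ∀ s t s' t' a b c → (s * s' * a + s * t' * c + t * b * s') * a + t * t' * (b * c)
       ≡ (s * a + t * b) * (s' * a + t' * c)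
  id = solve-∀

Bz-divʳ : ∀ {a b c} → Bz a b → c ∣ᶻ b → Bz a c
Bz-divʳ {a} {b} {c} (s , t , eq) (divides q refl) = s , t * q ,
  trans (cong (λ z → s * a + z) (ℤ.*-assoc t q c)) eq

Bz-modˡ : ∀ {a b n} → a ≡ b [mod n ] → Bz b n → Bz a n
Bz-modˡ {a} {b} {n} (by-∣ (divides q eq)) (s , t , e) = s , t - s * q ,
  trans (id s t q a n) (trans (cong (λ z → s * a - s * z + t * n) (sym eq)) (trans (id' s t a b n) e))
  where
  id : ∀ s t q a n → s * a + (t - s * q) * n ≡ s * a - s * (q * n) + t * n
  id = solve-∀
  id' : ∀ s t a b n → s * a - s * (a - b) + t * n ≡ s * b + t * n
  id' = solve-∀

Bz-∣abs : ∀ {a n} → Bz a (+ ∣ n ∣) → Bz a n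
Bz-∣abs {a} {+ n}      p           = p
Bz-∣abs {a} { -[1+ n ]} (s , t , e) = s , - t , trans (id s t a -[1+ n ]) e
  where id : ∀ s t a n → s * a + - t * n ≡ s * a + t * - n
        id = solve-∀

euclidℤ : ∀ {p} → Prime p → ∀ a b → + p ∣ᶻ a * b → + p ∣ᶻ a ⊎ + p ∣ᶻ b
euclidℤ {p} pp a b d with euclidsLemma ∣ a ∣ ∣ b ∣ pp (subst (p ℕ.∣_) (ℤ.abs-* a b) (∣⇒∣ᵤ d))
... | inj₁ x = inj₁ (∣ᵤ⇒∣ x)
... | inj₂ x = inj₂ (∣ᵤ⇒∣ x)

prime∤1 : ∀ {p} → Prime p → ¬ (+ p ∣ᶻ 1ℤ)
prime∤1 {p} pp d with refl ← ℕ.∣1⇒≡1 (∣⇒∣ᵤ d) = Primality.¬prime[1] pp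

bézoutℤ : ∀ {d m n} → Bézout.Identity d m n → ∃[ s ] ∃[ t ] s * + m + t * + n ≡ + d
bézoutℤ {d} {m} {n} (Bézout.Identity.+- x y eq) = + x , - (+ y) ,
  trans (cong₂ _+_ (sym (ℤ.pos-* x m)) (trans (sym (ℤ.neg-distribˡ-* (+ y) (+ n))) (cong -_ (sym (ℤ.pos-* y n)))))
   (trans (cong (λ z → + z - + (y ℕ.* n)) (sym eq)) (id (+ d) (+ (y ℕ.* n))))
  where id : ∀ d z → d + z - z ≡ d
        id = solve-∀
bézoutℤ {d} {m} {n} (Bézout.Identity.-+ x y eq) = - (+ x) , + y ,
  trans (cong₂ _+_ (trans (sym (ℤ.neg-distribˡ-* (+ x) (+ m))) (cong -_ (sym (ℤ.pos-* x m)))) (sym (ℤ.pos-* y n)))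
   (trans (cong (λ z → - (+ (x ℕ.* m)) + + z) (sym eq)) (id (+ d) (+ (x ℕ.* m))))
  where id : ∀ d z → - z + (d + z) ≡ d
        id = solve-∀

Bz-fromℕ : ∀ {m n} → Coprimality.Coprime m n → Bz (+ m) (+ n)
Bz-fromℕ c = bézoutℤ (Coprimality.coprime-Bézout c)

prime∤⇒Bz : ∀ {p a} → Prime p → ¬ (+ p ∣ᶻ a) → Bz a (+ p)
prime∤⇒Bz {p} {a} pp ¬d = Bz-sym (Bz-∣abs (Bz-fromℕ cop))
  where
  cop : Coprimality.Coprime p ∣ a ∣
  cop {d} (d∣p , d∣a) with prime⇒irreducible pp d∣p
  ... | inj₁ d≡1  = d≡1
  ... | inj₂ refl = ⊥-elim (¬d (∣ᵤ⇒∣ d∣a))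

primes∤⇒Bz : ∀ {a} ps → All Prime ps → All (λ p → ¬ (+ p ∣ᶻ a)) ps → Bz a (+ product ps)
primes∤⇒Bz []       _          _          = Bz-1
primes∤⇒Bz {a} (p ∷ ps) (pp ∷ pps) (np ∷ nps) =
  subst (Bz a) (sym (ℤ.pos-* p (product ps))) (Bz-* (prime∤⇒Bz pp np) (primes∤⇒Bz ps pps nps))

Bz⇒prime∤ : ∀ {a b p} → Bz a b → Prime p → + p ∣ᶻ b → ¬ (+ p ∣ᶻ a)
Bz⇒prime∤ {p = p} (s , t , eq) pp p∣b p∣a =
  prime∤1 pp (subst (+ p ∣ᶻ_) eq (∣m∣n⇒∣m+n (∣n⇒∣m*n s p∣a) (∣n⇒∣m*n t p∣b)))

-- Values of a binary form coprime to n

module _ (A B C n : ℤ) (prim : ∀ p → Prime p → + p ∣ᶻ A → + p ∣ᶻ B → + p ∣ᶻ C → + p ∣ᶻ n → ⊥) where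

  private
    g : ℤ → ℤ → ℤ
    g x y = A * (x * x) + B * (x * y) + C * (y * y)

    inX? : ∀ p → Dec (+ p ∣ᶻ A × ¬ (+ p ∣ᶻ C))
    inX? p = (+ p ∣? A) ×-dec ¬? (+ p ∣? C)

    inY? : ∀ p → Dec (¬ (+ p ∣ᶻ A))
    inY? p = ¬? (+ p ∣? A)

    all-filter : ∀ {P Q : ℕ → Set} (Q? : ∀ p → Dec (Q p)) ps → All P ps → All P (filter Q? ps)
    all-filter Q? ps all = All.tabulate (λ e → All.lookup all (proj₁ (∈-filter⁻ Q? e)))

    sq∤ : ∀ {p} a x → Prime p → ¬ (+ p ∣ᶻ a) → ¬ (+ p ∣ᶻ x) → ¬ (+ p ∣ᶻ a * (x * x))
    sq∤ a x pp na nx d with euclidℤ pp a (x * x) d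
    ... | inj₁ e = na e
    ... | inj₂ e = [ nx , nx ]′ (euclidℤ pp x x e)

    g∤ : ∀ {p} → Prime p → + p ∣ᶻ n → ∀ x y →
      (+ p ∣ᶻ x → + p ∣ᶻ A × ¬ (+ p ∣ᶻ C)) → (+ p ∣ᶻ A × ¬ (+ p ∣ᶻ C) → + p ∣ᶻ x) →
      (+ p ∣ᶻ y → ¬ (+ p ∣ᶻ A)) → (¬ (+ p ∣ᶻ A) → + p ∣ᶻ y) → ¬ (+ p ∣ᶻ g x y)
    g∤ {p} pp ∣n x y ∣x⇒ ⇒∣x ∣y⇒ ⇒∣y d with + p ∣? A | + p ∣? C
    ... | no ¬A | _ = sq∤ A x pp ¬A (λ d' → ¬A (proj₁ (∣x⇒ d')))
          (∣m+n∣n⇒∣m {m = A * (x * x)} {B * (x * y)}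
            (∣m+n∣n⇒∣m {m = A * (x * x) + B * (x * y)} {C * (y * y)} d (∣n⇒∣m*n C (∣m⇒∣m*n y (⇒∣y ¬A))))
            (∣n⇒∣m*n B (∣n⇒∣m*n x (⇒∣y ¬A))))
    ... | yes A∣ | no ¬C = sq∤ C y pp ¬C (λ d' → ∣y⇒ d' A∣)
          (∣m+n∣m⇒∣n {m = A * (x * x) + B * (x * y)} d
            (∣m∣n⇒∣m+n (∣m⇒∣m*n (x * x) A∣) (∣n⇒∣m*n B (∣m⇒∣m*n y (⇒∣x (A∣ , ¬C))))))
    ... | yes A∣ | yes C∣
      with euclidℤ pp B (x * y) (∣m+n∣m⇒∣n {m = A * (x * x)}
             (∣m+n∣n⇒∣m {m = A * (x * x) + B * (x * y)} {C * (y * y)} d (∣m⇒∣m*n (y * y) C∣)) (∣m⇒∣m*n (x * x) A∣))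
    ... | inj₁ B∣ = prim p pp A∣ B∣ C∣ ∣n
    ... | inj₂ xy∣ with euclidℤ pp x y xy∣
    ...   | inj₁ x∣ = proj₂ (∣x⇒ x∣) C∣
    ...   | inj₂ y∣ = ∣y⇒ y∣ A∣

    fromPrimes : ∀ ps → All Prime ps → (∀ {p} → p ∈ ps → + p ∣ᶻ n) →
      ∃[ x ] ∃[ y ] (Bz x y × Bz (g x y) (+ product ps))
    fromPrimes ps pps ∣n = + product xs , + product ys ,
      -- Primes of x divide A and primes of y do not, so x and y share none.
      primes∤⇒Bz ys (all-filter inY? ps pps)
        (All.tabulate (λ e d → let e' , np = ∈-filter⁻ inY? e in np (proj₁ (∣x⇒ (All.lookup pps e') d)))) ,
      primes∤⇒Bz ps pps (All.tabulate (λ e → let pp = All.lookup pps e in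
        g∤ pp (∣n e) (+ product xs) (+ product ys)
          (∣x⇒ pp) (λ h → ∣ᵤ⇒∣ (∈⇒∣product (∈-filter⁺ inX? e h)))
          (∣y⇒ pp) (λ h → ∣ᵤ⇒∣ (∈⇒∣product (∈-filter⁺ inY? e h)))))
      where
      xs = filter inX? ps
      ys = filter inY? ps
      ∣x⇒ : ∀ {p} → Prime p → + p ∣ᶻ + product xs → + p ∣ᶻ A × ¬ (+ p ∣ᶻ C)
      ∣x⇒ pp d = proj₂
        (∈-filter⁻ inX? {xs = ps} (factorisationHasAllPrimeFactors pp (∣⇒∣ᵤ d) (all-filter inX? ps pps)))
      ∣y⇒ : ∀ {p} → Prime p → + p ∣ᶻ + product ys → ¬ (+ p ∣ᶻ A)
      ∣y⇒ pp d = proj₂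
        (∈-filter⁻ inY? {xs = ps} (factorisationHasAllPrimeFactors pp (∣⇒∣ᵤ d) (all-filter inY? ps pps)))

  -- Modulo p one of the values g(1,0), g(0,1), g(1,1) survives; x and y
  -- collect the primes of n at which they have to vanish.
  coprimeValue : n ≢ 0ℤ → ∃[ x ] ∃[ y ] (Bz x y × Bz (A * (x * x) + B * (x * y) + C * (y * y)) n)
  coprimeValue n≢0 with factorise ∣ n ∣ {{ℕ.≢-nonZero (n≢0 ∘ ℤ.∣i∣≡0⇒i≡0)}}
  ... | record { factors = ps ; isFactorisation = isF ; factorsPrime = pps }
    with fromPrimes ps pps (λ {p} e → ∣ᵤ⇒∣ (subst (p ℕ.∣_) (sym isF) (∈⇒∣product e)))
  ... | x , y , bz , bz' = x , y , bz , Bz-∣abs (subst (Bz (g x y)) (cong +_ (sym isF)) bz')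

-- Kronecker symbols

IsSign : ℤ → Set
IsSign v = v ≡ 1ℤ ⊎ v ≡ - 1ℤ

sign-sq : ∀ {v} → IsSign v → v * v ≡ 1ℤ
sign-sq (inj₁ refl) = refl
sign-sq (inj₂ refl) = refl

sign-* : ∀ {v w} → IsSign v → IsSign w → IsSign (v * w)
sign-* (inj₁ refl) (inj₁ refl) = inj₁ refl
sign-* (inj₁ refl) (inj₂ refl) = inj₂ refl
sign-* (inj₂ refl) (inj₁ refl) = inj₂ refl
sign-* (inj₂ refl) (inj₂ refl) = inj₁ refl

-- A search through the p residues. This is what makes a value of the relational Legendre symbol
-- available constructively.
squareMod? : ∀ a p .{{_ : NonZero p}} → Dec (∃[ x ] (+ p ∣ᶻ (x * x - a)))
squareMod? a p with Fin.any? (λ (x : Fin p) → + p ∣? (+ toℕ x * + toℕ x - a))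
... | yes (x , d) = yes (+ toℕ x , d)
... | no ¬d = no λ (x , d) → ¬d (fromℕ< (n%ℕd<d x p) ,
  subst (λ r → + p ∣ᶻ (+ r * + r - a)) (sym (Fin.toℕ-fromℕ< (n%ℕd<d x p)))
    (diff (mod-trans (mod-sym (mod-* (≡%ℕ x p) (≡%ℕ x p))) (by-∣ {a = x * x} {a} d))))

%8-odd : ∀ a → a %ℕ 2 ≡ 1 → (a %ℕ 8 ≡ 1 ⊎ a %ℕ 8 ≡ 7) ⊎ (a %ℕ 8 ≡ 3 ⊎ a %ℕ 8 ≡ 5)
%8-odd a h = go (a %ℕ 8) (n%ℕd<d a 8) (trans (%ℕ-%ℕ a 2 8 (ℕ.divides 4 refl)) h)
  where
  go : ∀ r → r ℕ.< 8 → r ℕ.% 2 ≡ 1 → (r ≡ 1 ⊎ r ≡ 7) ⊎ (r ≡ 3 ⊎ r ≡ 5)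
  go 1 _ _ = inj₁ (inj₁ refl)
  go 3 _ _ = inj₂ (inj₁ refl)
  go 5 _ _ = inj₂ (inj₂ refl)
  go 7 _ _ = inj₁ (inj₂ refl)
  go (suc (suc (suc (suc (suc (suc (suc (suc r))))))))
    (ℕ.s≤s (ℕ.s≤s (ℕ.s≤s (ℕ.s≤s (ℕ.s≤s (ℕ.s≤s (ℕ.s≤s (ℕ.s≤s ())))))))) _

∤2⇒odd : ∀ {a} → ¬ (+ 2 ∣ᶻ a) → a %ℕ 2 ≡ 1
∤2⇒odd {a} ¬d with a %ℕ 2 in eq | n%ℕd<d a 2
... | 0 | _ = ⊥-elim (¬d (%ℕ≡0⇒∣ {a} 2 eq))
... | 1 | _ = refl
... | suc (suc _) | ℕ.s≤s (ℕ.s≤s ())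

odd⇒∤2 : ∀ {a} → a %ℕ 2 ≡ 1 → ¬ (+ 2 ∣ᶻ a)
odd⇒∤2 {a} h d = case trans (sym h) (∣⇒%ℕ≡0 {a} 2 d) of λ ()

-- Existence is the point: the value at a prime of m is never identified, only known to be a sign
-- and therefore to square to 1.
kronPrime : ∀ {a p} → Prime p → ¬ (+ p ∣ᶻ a) → ∃[ v ] (KronPrimeIs a p v × IsSign v)
kronPrime {a} {p} pp ¬d = go (p ℕ.≟ 2)
  where
  at2 : p ≡ 2 → (a %ℕ 8 ≡ 1 ⊎ a %ℕ 8 ≡ 7) ⊎ (a %ℕ 8 ≡ 3 ⊎ a %ℕ 8 ≡ 5) →
    ∃[ v ] (KronPrimeIs a p v × IsSign v)
  at2 eq (inj₁ h) = 1ℤ , inj₁ (eq , inj₂ (inj₁ (h , refl))) , inj₁ refl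
  at2 eq (inj₂ h) = - 1ℤ , inj₁ (eq , inj₂ (inj₂ (h , refl))) , inj₂ refl
  atOdd : p ≢ 2 → Dec (∃[ x ] (+ p ∣ᶻ (x * x - a))) → ∃[ v ] (KronPrimeIs a p v × IsSign v)
  atOdd p≢2 (yes (x , e)) =
    1ℤ , inj₂ (p≢2 , inj₂ (inj₁ (¬d ∘ ∣ᵤ⇒∣ , (x , ∣⇒∣ᵤ e) , refl))) , inj₁ refl
  atOdd p≢2 (no ¬e) =
    - 1ℤ , inj₂ (p≢2 , inj₂ (inj₂ (¬d ∘ ∣ᵤ⇒∣ , (λ (x , e) → ¬e (x , ∣ᵤ⇒∣ e)) , refl))) , inj₂ refl
  go : Dec (p ≡ 2) → ∃[ v ] (KronPrimeIs a p v × IsSign v)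
  go (yes eq)  = at2 eq (%8-odd a (∤2⇒odd {a} (subst (λ q → ¬ (+ q ∣ᶻ a)) eq ¬d)))
  go (no p≢2) = atOdd p≢2 (squareMod? a p {{prime⇒nonZero pp}})

kronList : ∀ {a} ps → All Prime ps → All (λ p → ¬ (+ p ∣ᶻ a)) ps → ∃[ v ] (KronList a ps v × IsSign v)
kronList []       _          _          = 1ℤ , refl , inj₁ refl
kronList (p ∷ ps) (pp ∷ pps) (np ∷ nps) with kronPrime pp np | kronList ps pps nps
... | x , kx , sx | y , ky , sy = x * y , (x , y , kx , ky , refl) , sign-* sx sy

kronList-++ : ∀ {a} ps qs {v w} → KronList a ps v → KronList a qs w → KronList a (ps ++ qs) (v * w)
kronList-++ []       qs {w = w} refl ky = subst (KronList _ qs) (sym (ℤ.*-identityˡ w)) ky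
kronList-++ (p ∷ ps) qs {w = w} (x , y , kx , ky , refl) kz =
  x , y * w , kx , kronList-++ ps qs ky kz , ℤ.*-assoc x y w

product≡productℕ : ∀ ps → product ps ≡ productℕ ps
product≡productℕ []       = refl
product≡productℕ (p ∷ ps) = cong (p ℕ.*_) (product≡productℕ ps)

-- Each prime of m enters the factorisation twice, so its unknown sign squares away and the symbol
-- over `us` remains. The modulus is positive, hence the sign factor of the Kronecker symbol is 1.
kronSquare : ∀ {a t} us → All Prime us → KronList a us t → ∀ m → m ≢ 0 → Bz a (+ m) →
  KronIs a (+ (product us ℕ.* m ℕ.^ 2)) t
kronSquare {a} {t} us pus ku m m≢0 bz with factorise m {{ℕ.≢-nonZero m≢0}}
... | record { factors = qs ; isFactorisation = refl ; factorsPrime = pqs }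
  with kronList qs pqs (All.tabulate (λ e → Bz⇒prime∤ {a} bz (All.lookup pqs e) (∣ᵤ⇒∣ (∈⇒∣product e))))
... | y , ky , sy = nz , us ++ qs ++ qs , All.++⁺ pus (All.++⁺ pqs pqs) , prod ,
    1ℤ , t , inj₂ ((λ { (+<+ () , _) }) , refl) ,
    subst (KronList _ (us ++ qs ++ qs)) (trans (cong (t *_) (sign-sq sy)) (ℤ.*-identityʳ t))
      (kronList-++ us (qs ++ qs) ku (kronList-++ qs qs ky ky)) ,
    sym (ℤ.*-identityˡ t)
  where
  prod : productℕ (us ++ qs ++ qs) ≡ product us ℕ.* product qs ℕ.^ 2
  prod = begin
    productℕ (us ++ qs ++ qs) ≡⟨ product≡productℕ (us ++ qs ++ qs) ⟨
    product (us ++ qs ++ qs) ≡⟨ product-++ us (qs ++ qs) ⟩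
    product us ℕ.* product (qs ++ qs) ≡⟨ cong (product us ℕ.*_) (product-++ qs qs) ⟩
    product us ℕ.* (product qs ℕ.* product qs)
      ≡⟨ cong (λ z → product us ℕ.* (product qs ℕ.* z)) (sym (ℕ.*-identityʳ (product qs))) ⟩
    product us ℕ.* product qs ℕ.^ 2 ∎
    where open ≡-Reasoning
  nz : + (product us ℕ.* product qs ℕ.^ 2) ≢ 0ℤ
  nz eq with ℕ.m*n≡0⇒m≡0∨n≡0 (product us) (ℤ.+-injective eq)
  ... | inj₁ e = ℕ.≢-nonZero⁻¹ _ {{Primality.productOfPrimes≢0 pus}} e
  ... | inj₂ e = m≢0 (ℕ.m^n≡0⇒m≡0 (product qs) 2 e)

kron3⁺ : ∀ {a} → a %ℕ 3 ≡ 1 → KronPrimeIs a 3 1ℤ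
kron3⁺ {a} h = inj₂ ((λ ()) , inj₂ (inj₁ ((λ d → case trans (sym h) (∣⇒%ℕ≡0 {a} 3 (∣ᵤ⇒∣ d)) of λ ()) ,
  (1ℤ , ∣⇒∣ᵤ (diff (mod-sym (%ℕ≡⇒mod {a} 3 h)))) , refl)))

kron3⁻ : ∀ {a} → a %ℕ 3 ≡ 2 → KronPrimeIs a 3 (- 1ℤ)
kron3⁻ {a} h = inj₂ ((λ ()) , inj₂ (inj₂ ((λ d → case trans (sym h) (∣⇒%ℕ≡0 {a} 3 (∣ᵤ⇒∣ d)) of λ ()) ,
  nonsquare , refl)))
  where
  nonsquare : ¬ (∃[ x ] 3 ℕ.∣ ∣ x * x - a ∣)
  nonsquare (x , d) = go (x %ℕ 3) (n%ℕd<d x 3) (trans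
    (mod⇒%ℕ≡ {+ (x %ℕ 3) * + (x %ℕ 3)} {a} 3
      (mod-trans (mod-sym (mod-* (≡%ℕ x 3) (≡%ℕ x 3))) (by-∣ {a = x * x} {a} (∣ᵤ⇒∣ d)))) h)
    where
    go : ∀ r → r ℕ.< 3 → ¬ ((+ r * + r) %ℕ 3 ≡ 2)
    go 0 _ ()
    go 1 _ ()
    go 2 _ ()
    go (suc (suc (suc r))) (ℕ.s≤s (ℕ.s≤s (ℕ.s≤s ())))

-- Descartes configurations

0≤sq : ∀ a → 0ℤ ≤ a * a
0≤sq (+ n)      = subst (0ℤ ≤_) (ℤ.pos-* n n) (+≤+ ℕ.z≤n)
0≤sq -[1+ n ]   = +≤+ ℕ.z≤n

0<sq : ∀ {a} → 0ℤ < a → 0ℤ < a * a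
0<sq {a} a>0 = subst (_< a * a) (ℤ.*-zeroʳ a) (ℤ.*-monoˡ-<-pos a {{ℤ.positive a>0}} a>0)

*-cancel-0 : ∀ a {b} → a ≢ 0ℤ → a * b ≡ 0ℤ → b ≡ 0ℤ
*-cancel-0 a a≢0 eq with ℤ.i*j≡0⇒i≡0∨j≡0 a eq
... | inj₁ e = ⊥-elim (a≢0 e)
... | inj₂ e = e

form2-⊕ˡ : ∀ u v w → form2 (u ⊕ v) w ≡ form2 u w + form2 v w
form2-⊕ˡ (circ a b c d) (circ a' b' c' d') (circ a″ b″ c″ d″) = id a b c d a' b' c' d' a″ b″ c″ d″
  where
  id : ∀ a b c d a' b' c' d' a″ b″ c″ d″ →
    - ((a + a') * b″ + (b + b') * a″) + (+ 2) * ((c + c') * c″ + (d + d') * d″)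
    ≡ (- (a * b″ + b * a″) + (+ 2) * (c * c″ + d * d″)) + (- (a' * b″ + b' * a″) + (+ 2) * (c' * c″ + d' * d″))
  id = solve-∀

form2-⊙ˡ : ∀ k u w → form2 (k ⊙ u) w ≡ k * form2 u w
form2-⊙ˡ k (circ a b c d) (circ a″ b″ c″ d″) = id k a b c d a″ b″ c″ d″
  where
  id : ∀ k a b c d a″ b″ c″ d″ →
    - ((k * a) * b″ + (k * b) * a″) + (+ 2) * ((k * c) * c″ + (k * d) * d″)
    ≡ k * (- (a * b″ + b * a″) + (+ 2) * (c * c″ + d * d″))
  id = solve-∀

form2-sym : ∀ u w → form2 u w ≡ form2 w u
form2-sym (circ a b c d) (circ a' b' c' d') = id a b c d a' b' c' d'
  where
  id : ∀ a b c d a' b' c' d' → - (a * b' + b * a') + (+ 2) * (c * c' + d * d') ≡ - (a' * b + b' * a) + (+ 2) *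
    (c' * c + d' * d)
  id = solve-∀

record IsDesc (n b c d : ℤ) : Set where
  constructor desc-by
  field eqn : (n + b + c + d) * (n + b + c + d) ≡ + 2 * (n * n + b * b + c * c + d * d)
open IsDesc public

-- The vectors e_j = b₀ w_j − b_j w₀ (j = 1, 2, 3) lie in a plane, so their
-- Gram determinant vanishes; tangency expresses it through curvatures alone.
desc-core : ∀ v₀ v₁ v₂ v₃ → curv v₀ ≢ 0ℤ →
  IsCircle v₀ → IsCircle v₁ → IsCircle v₂ → IsCircle v₃ →
  form2 v₀ v₁ ≡ - (+ 2) → form2 v₀ v₂ ≡ - (+ 2) → form2 v₀ v₃ ≡ - (+ 2) →
  form2 v₁ v₂ ≡ - (+ 2) → form2 v₁ v₃ ≡ - (+ 2) → form2 v₂ v₃ ≡ - (+ 2) →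
  IsDesc (curv v₀) (curv v₁) (curv v₂) (curv v₃)
desc-core v₀ v₁ v₂ v₃ b≢0 c₀ c₁ c₂ c₃ f₀₁ f₀₂ f₀₃ f₁₂ f₁₃ f₂₃ =
  -- By `final` the Gram determinant equals 32 b₀⁴ times the defect of the Descartes equation; the
  -- factors are cancelled one at a time.
  desc-by (ℤ.i-j≡0⇒i≡j _ _ (*-cancel-0 b₀ b≢0 (*-cancel-0 b₀ b≢0 (*-cancel-0 b₀ b≢0 (*-cancel-0 b₀ b≢0
    (*-cancel-0 (+ 32) (λ ()) (trans (final b₀ (curv v₁) (curv v₂) (curv v₃)) det-vanishes)))))))
  where
  b₀ = curv v₀
  -- The vector b₀ v - `curv v` · v₀ has curvature coordinate 0, so on such vectors the Lorentz form
  -- is the Euclidean form of the last two coordinates and the co-curvatures drop out.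
  ex ey : Circle → ℤ
  ex v = wx v * b₀ - wx v₀ * curv v
  ey v = wy v * b₀ - wy v₀ * curv v
  G : Circle → Circle → ℤ
  G u v = + 2 * (ex u * ex v + ey u * ey v)
  det : (a b c d e f : ℤ) → ℤ
  det a b c d e f = a * b * c + + 2 * (d * e * f) - a * (f * f) - b * (e * e) - c * (d * d)
  planar : ∀ x₁ y₁ x₂ y₂ x₃ y₃ →
    let g₁₁ = + 2 * (x₁ * x₁ + y₁ * y₁)
        g₂₂ = + 2 * (x₂ * x₂ + y₂ * y₂)
        g₃₃ = + 2 * (x₃ * x₃ + y₃ * y₃)
        g₁₂ = + 2 * (x₁ * x₂ + y₁ * y₂)
        g₁₃ = + 2 * (x₁ * x₃ + y₁ * y₃)
        g₂₃ = + 2 * (x₂ * x₃ + y₂ * y₃)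
    in g₁₁ * g₂₂ * g₃₃ + + 2 * (g₁₂ * g₁₃ * g₂₃) - g₁₁ * (g₂₃ * g₂₃) - g₂₂ * (g₁₃ * g₁₃) - g₃₃ * (g₁₂ * g₁₂) ≡ 0ℤ
  planar = solve-∀
  expand : ∀ a₀ b₀ x₀ y₀ a b x y a' b' x' y' →
    + 2 * ((x * b₀ - x₀ * b) * (x' * b₀ - x₀ * b') + (y * b₀ - y₀ * b) * (y' * b₀ - y₀ * b'))
    ≡ b₀ * b₀ * (- (a * b' + b * a') + + 2 * (x * x' + y * y'))
      - b₀ * b' * (- (a₀ * b + b₀ * a) + + 2 * (x₀ * x + y₀ * y))
      - b₀ * b * (- (a₀ * b' + b₀ * a') + + 2 * (x₀ * x' + y₀ * y'))
      + b * b' * (- (a₀ * b₀ + b₀ * a₀) + + 2 * (x₀ * x₀ + y₀ * y₀))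
  expand = solve-∀
  G-eval : ∀ u v {r} → form2 v₀ u ≡ - (+ 2) → form2 v₀ v ≡ - (+ 2) → form2 u v ≡ r →
    G u v ≡ b₀ * b₀ * r - b₀ * curv v * - (+ 2) - b₀ * curv u * - (+ 2) + curv u * curv v * (+ 2)
  G-eval u v {r} f₀ᵤ f₀ᵥ fᵤᵥ = trans
    (expand (cobar v₀) b₀ (wx v₀) (wy v₀) (cobar u) (curv u) (wx u) (wy u) (cobar v) (curv v) (wx v) (wy v))
    (cong₂ _+_ (cong₂ _-_ (cong₂ _-_ (cong (b₀ * b₀ *_) fᵤᵥ) (cong (b₀ * curv v *_) f₀ᵤ)) (cong (b₀ * curv u *_) f₀ᵥ))
      (cong (curv u * curv v *_) c₀))
  cong₆ : ∀ {a a' b b' c c' d d' e e' f f'} → a ≡ a' → b ≡ b' → c ≡ c' → d ≡ d' → e ≡ e' → f ≡ f' →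
    det a b c d e f ≡ det a' b' c' d' e' f'
  cong₆ refl refl refl refl refl refl = refl
  final : ∀ z b c d →
    let g : ℤ → ℤ → ℤ → ℤ
        g r u v = z * z * r - z * v * - (+ 2) - z * u * - (+ 2) + u * v * (+ 2)
        g₁₁ = g (+ 2) b b
        g₂₂ = g (+ 2) c c
        g₃₃ = g (+ 2) d d
        g₁₂ = g (- (+ 2)) b c
        g₁₃ = g (- (+ 2)) b d
        g₂₃ = g (- (+ 2)) c d
    in + 32 * (z * (z * (z * (z * ((z + b + c + d) * (z + b + c + d) - + 2 * (z * z + b * b + c * c + d * d))))))
       ≡ g₁₁ * g₂₂ * g₃₃ + + 2 * (g₁₂ * g₁₃ * g₂₃) - g₁₁ * (g₂₃ * g₂₃) - g₂₂ * (g₁₃ * g₁₃) - g₃₃ * (g₁₂ * g₁₂)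
  final = solve-∀
  det-vanishes : _ ≡ 0ℤ
  det-vanishes = trans (sym (cong₆
    (G-eval v₁ v₁ f₀₁ f₀₁ c₁) (G-eval v₂ v₂ f₀₂ f₀₂ c₂) (G-eval v₃ v₃ f₀₃ f₀₃ c₃)
    (G-eval v₁ v₂ f₀₁ f₀₂ f₁₂) (G-eval v₁ v₃ f₀₁ f₀₃ f₁₃) (G-eval v₂ v₃ f₀₂ f₀₃ f₂₃)))
    (planar (ex v₁) (ey v₁) (ex v₂) (ey v₂) (ex v₃) (ey v₃))

desc-swap₁ : ∀ {a b c d} → IsDesc a b c d → IsDesc b a c d
desc-swap₁ {a} {b} {c} {d} (desc-by h) = desc-by (trans (l a b c d) (trans h (r a b c d)))
  where
  l : ∀ a b c d → (b + a + c + d) * (b + a + c + d) ≡ (a + b + c + d) * (a + b + c + d)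
  l = solve-∀
  r : ∀ a b c d → + 2 * (a * a + b * b + c * c + d * d) ≡ + 2 * (b * b + a * a + c * c + d * d)
  r = solve-∀

desc-swap₂ : ∀ {a b c d} → IsDesc a b c d → IsDesc a c b d
desc-swap₂ {a} {b} {c} {d} (desc-by h) = desc-by (trans (l a b c d) (trans h (r a b c d)))
  where
  l : ∀ a b c d → (a + c + b + d) * (a + c + b + d) ≡ (a + b + c + d) * (a + b + c + d)
  l = solve-∀
  r : ∀ a b c d → + 2 * (a * a + b * b + c * c + d * d) ≡ + 2 * (a * a + c * c + b * b + d * d)
  r = solve-∀

desc-swap₃ : ∀ {a b c d} → IsDesc a b c d → IsDesc a b d c
desc-swap₃ {a} {b} {c} {d} (desc-by h) = desc-by (trans (l a b c d) (trans h (r a b c d)))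
  where
  l : ∀ a b c d → (a + b + d + c) * (a + b + d + c) ≡ (a + b + c + d) * (a + b + c + d)
  l = solve-∀
  r : ∀ a b c d → + 2 * (a * a + b * b + c * c + d * d) ≡ + 2 * (a * a + b * b + d * d + c * c)
  r = solve-∀

-- `desc-core` cancels powers of one nonzero curvature. Positivity of the total guarantees one among
-- the four; it is moved to the front and the relation permuted back.
descartes : ∀ {D} → IsDescartes D → IsDesc (curv (D 0F)) (curv (D 1F)) (curv (D 2F)) (curv (D 3F))
descartes {D} (circ? , tang , pos)
  with curv (D 0F) ℤ.≟ 0ℤ | curv (D 1F) ℤ.≟ 0ℤ | curv (D 2F) ℤ.≟ 0ℤ | curv (D 3F) ℤ.≟ 0ℤ
... | no ≢0 | _ | _ | _ = desc-core (D 0F) (D 1F) (D 2F) (D 3F) ≢0 (circ? 0F) (circ? 1F) (circ? 2F) (circ? 3F)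
  (tang 0F 1F λ ()) (tang 0F 2F λ ()) (tang 0F 3F λ ()) (tang 1F 2F λ ()) (tang 1F 3F λ ()) (tang 2F 3F λ ())
... | yes _ | no ≢0 | _ | _ = desc-swap₁ (desc-core (D 1F) (D 0F) (D 2F) (D 3F) ≢0 (circ? 1F) (circ? 0F) (circ? 2F)
  (circ? 3F)
  (tang 1F 0F λ ()) (tang 1F 2F λ ()) (tang 1F 3F λ ()) (tang 0F 2F λ ()) (tang 0F 3F λ ()) (tang 2F 3F λ ()))
... | yes _ | yes _ | no ≢0 | _ = desc-swap₂
  (desc-swap₁ (desc-core (D 2F) (D 0F) (D 1F) (D 3F) ≢0 (circ? 2F) (circ? 0F) (circ? 1F) (circ? 3F)
  (tang 2F 0F λ ()) (tang 2F 1F λ ()) (tang 2F 3F λ ()) (tang 0F 1F λ ()) (tang 0F 3F λ ()) (tang 1F 3F λ ())))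
... | yes _ | yes _ | yes _ | no ≢0 = desc-swap₃
  (desc-swap₂ (desc-swap₁ (desc-core (D 3F) (D 0F) (D 1F) (D 2F) ≢0 (circ? 3F) (circ? 0F) (circ? 1F) (circ? 2F)
  (tang 3F 0F λ ()) (tang 3F 1F λ ()) (tang 3F 2F λ ()) (tang 0F 1F λ ()) (tang 0F 2F λ ()) (tang 1F 2F λ ()))))
... | yes a | yes b | yes c | yes d = ⊥-elim (ℤ.<-irrefl refl
  (subst (0ℤ <_) (cong₂ _+_ (cong₂ _+_ (cong₂ _+_ a b) c) d) pos))

-- Swaps: positivity, tangency and primitivity along the packing

swap-≢ : ∀ {i j} D → j ≢ i → swap i D j ≡ D j
swap-≢ {i} {j} D j≢i with j Fin.≟ i
... | yes j≡i = ⊥-elim (j≢i j≡i)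
... | no _    = refl

-- With 4n = 3S + t the Descartes equation reads S² + 4St + t² + (squares) = 0.
swapped-sum-positive : ∀ {n b c d} → IsDesc n b c d → 0ℤ < n + b + c + d → 0ℤ < + 3 * (n + b + c + d) - + 4 * n
swapped-sum-positive {n} {b} {c} {d} h S>0 = ℤ.≰⇒> λ le → ℤ.<-irrefl (sym (id n b c d h)) (pos le)
  where
  S = n + b + c + d
  t = + 4 * n - + 3 * S
  id : ∀ n b c d → IsDesc n b c d →
    let S = n + b + c + d
        t = + 4 * n - + 3 * S
    in S * S + (+ 4 * (S * t) + t * t + + 4 * ((b - c) * (b - c) + (b - d) * (b - d) + (c - d) * (c - d))) ≡ 0ℤ
  id n b c d h = trans (lem n b c d)
    (trans (cong (λ z → - (+ 6) * (z - + 2 * (n * n + b * b + c * c + d * d))) (eqn h))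
      (lem' (+ 2 * (n * n + b * b + c * c + d * d))))
    where
    lem : ∀ n b c d →
      let S = n + b + c + d
          t = + 4 * n - + 3 * S
      in S * S + (+ 4 * (S * t) + t * t + + 4 * ((b - c) * (b - c) + (b - d) * (b - d) + (c - d) * (c - d)))
         ≡ - (+ 6) * ((n + b + c + d) * (n + b + c + d) - + 2 * (n * n + b * b + c * c + d * d))
    lem = solve-∀
    lem' : ∀ z → - (+ 6) * (z - z) ≡ 0ℤ
    lem' = solve-∀
  0≤4 : ∀ {z} → 0ℤ ≤ z → 0ℤ ≤ + 4 * z
  0≤4 {z} = ℤ.*-monoˡ-≤-nonNeg (+ 4) {0ℤ} {z}
  -- The new total is -t. Were it nonpositive, then t ≥ 0, every term of the identity would be
  -- nonnegative, and S² strictly positive.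
  pos : + 3 * S - + 4 * n ≤ 0ℤ →
    0ℤ < S * S + (+ 4 * (S * t) + t * t + + 4 * ((b - c) * (b - c) + (b - d) * (b - d) + (c - d) * (c - d)))
  pos le = ℤ.+-mono-<-≤ {0ℤ} {S * S} {0ℤ}
      (0<sq S>0)
      (ℤ.+-mono-≤ {0ℤ} {_} {0ℤ} (ℤ.+-mono-≤ {0ℤ} {_} {0ℤ} (0≤4 S*t) (0≤sq t))
        (0≤4 (ℤ.+-mono-≤ {0ℤ} {_} {0ℤ} (ℤ.+-mono-≤ {0ℤ} {_} {0ℤ} (0≤sq (b - c)) (0≤sq (b - d))) (0≤sq (c - d)))))
    where
    0≤t : 0ℤ ≤ t
    0≤t = subst (0ℤ ≤_) (neg-swap (+ 3 * S) (+ 4 * n)) (ℤ.neg-mono-≤ le)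
      where neg-swap : ∀ x y → - (x - y) ≡ y - x
            neg-swap = solve-∀
    S*t : 0ℤ ≤ S * t
    S*t = subst (_≤ S * t) (ℤ.*-zeroʳ S) (ℤ.*-monoˡ-≤-nonNeg S {{ℤ.nonNegative (ℤ.<⇒≤ S>0)}} 0≤t)

curvSum-swap : ∀ l D → curvSum (swap l D) ≡ + 3 * curvSum D - + 4 * curv (D l)
curvSum-swap 0F D = id (curv (D 0F)) (curv (D 1F)) (curv (D 2F)) (curv (D 3F))
  where id : ∀ a b c d → (+ 2 * (a + (b + (c + d))) + - (+ 3) * a) + b + c + d ≡ + 3 * (a + b + c + d) - + 4 * a
        id = solve-∀
curvSum-swap 1F D = id (curv (D 0F)) (curv (D 1F)) (curv (D 2F)) (curv (D 3F))
  where id : ∀ a b c d → a + (+ 2 * (a + (b + (c + d))) + - (+ 3) * b) + c + d ≡ + 3 * (a + b + c + d) - + 4 * b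
        id = solve-∀
curvSum-swap 2F D = id (curv (D 0F)) (curv (D 1F)) (curv (D 2F)) (curv (D 3F))
  where id : ∀ a b c d → a + b + (+ 2 * (a + (b + (c + d))) + - (+ 3) * c) + d ≡ + 3 * (a + b + c + d) - + 4 * c
        id = solve-∀
curvSum-swap 3F D = id (curv (D 0F)) (curv (D 1F)) (curv (D 2F)) (curv (D 3F))
  where id : ∀ a b c d → a + b + c + (+ 2 * (a + (b + (c + d))) + - (+ 3) * d) ≡ + 3 * (a + b + c + d) - + 4 * d
        id = solve-∀

AllDiv : ℤ → Config → Set
AllDiv g D = ∀ j → g ∣ᶻ curv (D j)

-- Puts circle i in front of the other three, so that arguments about it are carried out once
-- instead of for each of the four indices.
record Tuple (D : Config) (i : Fin 4) : Set where
  field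
    j k l : Fin 4
    distinct : Distinct4 i j k l
    desc : IsDesc (curv (D i)) (curv (D j)) (curv (D k)) (curv (D l))
    sum : curv (D i) + curv (D j) + curv (D k) + curv (D l) ≡ curvSum D
    allDiv : ∀ {g} → g ∣ᶻ curv (D i) → g ∣ᶻ curv (D j) → g ∣ᶻ curv (D k) → g ∣ᶻ curv (D l) → AllDiv g D

tuple : ∀ {D} → IsDescartes D → ∀ i → Tuple D i
tuple {D} isD = go
  where
  h : IsDesc (curv (D 0F)) (curv (D 1F)) (curv (D 2F)) (curv (D 3F))
  h = descartes {D} isD
  go : ∀ i → Tuple D i
  go 0F = record
    { j = 1F ; k = 2F ; l = 3F ; distinct = (λ ()) , (λ ()) , (λ ()) , (λ ()) , (λ ()) , (λ ())
    ; desc = h ; sum = refl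
    ; allDiv = λ d₀ d₁ d₂ d₃ → λ { 0F → d₀ ; 1F → d₁ ; 2F → d₂ ; 3F → d₃ } }
  go 1F = record
    { j = 0F ; k = 2F ; l = 3F ; distinct = (λ ()) , (λ ()) , (λ ()) , (λ ()) , (λ ()) , (λ ())
    ; desc = desc-swap₁ h ; sum = id (curv (D 0F)) (curv (D 1F)) (curv (D 2F)) (curv (D 3F))
    ; allDiv = λ d₁ d₀ d₂ d₃ → λ { 0F → d₀ ; 1F → d₁ ; 2F → d₂ ; 3F → d₃ } }
    where id : ∀ a b c d → b + a + c + d ≡ a + b + c + d
          id = solve-∀
  go 2F = record
    { j = 0F ; k = 1F ; l = 3F ; distinct = (λ ()) , (λ ()) , (λ ()) , (λ ()) , (λ ()) , (λ ())
    ; desc = desc-swap₁ (desc-swap₂ h) ; sum = id (curv (D 0F)) (curv (D 1F)) (curv (D 2F)) (curv (D 3F))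
    ; allDiv = λ d₂ d₀ d₁ d₃ → λ { 0F → d₀ ; 1F → d₁ ; 2F → d₂ ; 3F → d₃ } }
    where id : ∀ a b c d → c + a + b + d ≡ a + b + c + d
          id = solve-∀
  go 3F = record
    { j = 0F ; k = 1F ; l = 2F ; distinct = (λ ()) , (λ ()) , (λ ()) , (λ ()) , (λ ()) , (λ ())
    ; desc = desc-swap₁ (desc-swap₂ (desc-swap₃ h))
    ; sum = id (curv (D 0F)) (curv (D 1F)) (curv (D 2F)) (curv (D 3F))
    ; allDiv = λ d₃ d₀ d₁ d₂ → λ { 0F → d₀ ; 1F → d₁ ; 2F → d₂ ; 3F → d₃ } }
    where id : ∀ a b c d → d + a + b + c ≡ a + b + c + d
          id = solve-∀

curvSum-swap-positive : ∀ {D} i → IsDescartes D → 0ℤ < curvSum (swap i D)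
curvSum-swap-positive {D} i isD = subst (0ℤ <_)
    (trans (cong (λ S → + 3 * S - + 4 * curv (D i)) sum) (sym (curvSum-swap i D)))
    (swapped-sum-positive desc (subst (0ℤ <_) (sym sum) (proj₂ (proj₂ isD))))
  where open Tuple (tuple {D} isD i)

-- One self-product 2 and three tangencies -2 add up to -4; summing this over the four circles gives
-- the -16 of `form2-total²`.
form2-total : ∀ {D} → IsDescartes D → ∀ k → form2 (total D) (D k) ≡ - (+ 4)
form2-total {D} (circ? , tang , _) k = trans expand (go k)
  where
  expand : form2 (total D) (D k) ≡ form2 (D 0F) (D k) + (form2 (D 1F) (D k) +
    (form2 (D 2F) (D k) + form2 (D 3F) (D k)))
  expand = trans (form2-⊕ˡ (D 0F) _ (D k)) (cong (λ z → form2 (D 0F) (D k) + z)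
    (trans (form2-⊕ˡ (D 1F) _ (D k)) (cong (λ z → form2 (D 1F) (D k) + z) (form2-⊕ˡ (D 2F) (D 3F) (D k)))))
  go : ∀ k → form2 (D 0F) (D k) + (form2 (D 1F) (D k) + (form2 (D 2F) (D k) + form2 (D 3F) (D k))) ≡ - (+ 4)
  go 0F = cong₂ _+_ (circ? 0F) (cong₂ _+_ (tang 1F 0F λ ()) (cong₂ _+_ (tang 2F 0F λ ()) (tang 3F 0F λ ())))
  go 1F = cong₂ _+_ (tang 0F 1F λ ()) (cong₂ _+_ (circ? 1F) (cong₂ _+_ (tang 2F 1F λ ()) (tang 3F 1F λ ())))
  go 2F = cong₂ _+_ (tang 0F 2F λ ()) (cong₂ _+_ (tang 1F 2F λ ()) (cong₂ _+_ (circ? 2F) (tang 3F 2F λ ())))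
  go 3F = cong₂ _+_ (tang 0F 3F λ ()) (cong₂ _+_ (tang 1F 3F λ ()) (cong₂ _+_ (tang 2F 3F λ ()) (circ? 3F)))

form2-total² : ∀ {D} → IsDescartes D → form2 (total D) (total D) ≡ - (+ 16)
form2-total² {D} isD = trans (form2-⊕ˡ (D 0F) _ t) (trans (cong (λ z → form2 (D 0F) t + z)
    (trans (form2-⊕ˡ (D 1F) _ t) (cong (λ z → form2 (D 1F) t + z) (form2-⊕ˡ (D 2F) (D 3F) t))))
    (cong₂ _+_ (f 0F) (cong₂ _+_ (f 1F) (cong₂ _+_ (f 2F) (f 3F)))))
  where
  t = total D
  f : ∀ k → form2 (D k) t ≡ - (+ 4)
  f k = trans (form2-sym (D k) t) (form2-total {D} isD k)

form2-comb : ∀ p q u v w → form2 ((p ⊙ u) ⊕ (q ⊙ v)) w ≡ p * form2 u w + q * form2 v w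
form2-comb p q u v w = trans (form2-⊕ˡ (p ⊙ u) (q ⊙ v) w) (cong₂ _+_ (form2-⊙ˡ p u w) (form2-⊙ˡ q v w))

-- With t the total and v the replaced circle, 2t - 3v pairs with another circle to 2(-4) - 3(-2) =
-- -2 and with itself to 4(-16) - 12(-4) + 9 · 2 = 2.
swap-descartes : ∀ {D} i → IsDescartes D → IsDescartes (swap i D)
swap-descartes {D} i isD@(circ? , tang , _) = circles , tangents , curvSum-swap-positive {D} i isD
  where
  new = ((+ 2) ⊙ total D) ⊕ ((- (+ 3)) ⊙ D i)
  new-D : ∀ k {r} → form2 (D i) (D k) ≡ r → form2 new (D k) ≡ + 2 * - (+ 4) + - (+ 3) * r
  new-D k h = trans (form2-comb (+ 2) (- (+ 3)) (total D) (D i) (D k))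
    (cong₂ (λ x y → + 2 * x + - (+ 3) * y) (form2-total {D} isD k) h)
  new-new : form2 new new ≡ + 2
  new-new = trans (form2-comb (+ 2) (- (+ 3)) (total D) (D i) new) (cong₂ (λ x y → + 2 * x + - (+ 3) * y)
    (trans (form2-sym (total D) new) (trans (form2-comb (+ 2) (- (+ 3)) (total D) (D i) (total D))
      (cong₂ (λ x y → + 2 * x + - (+ 3) * y) (form2-total² {D} isD)
        (trans (form2-sym (D i) (total D)) (form2-total {D} isD i)))))
    (trans (form2-sym (D i) new) (new-D i (circ? i))))
  circles : ∀ j → IsCircle (swap i D j)
  circles j with j Fin.≟ i
  ... | yes _ = new-new
  ... | no _  = circ? j
  tangents : ∀ j k → j ≢ k → form2 (swap i D j) (swap i D k) ≡ - (+ 2)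
  tangents j k j≢k with j Fin.≟ i | k Fin.≟ i
  ... | yes refl | yes refl = ⊥-elim (j≢k refl)
  ... | yes refl | no k≢i   = new-D k (tang i k j≢k)
  ... | no j≢i   | yes refl = trans (form2-sym (D j) new) (new-D j (tang i j (j≢k ∘ sym)))
  ... | no _     | no _     = tang j k j≢k

reach-descartes : ∀ {root D} → IsDescartes root → Reach root D → IsDescartes D
reach-descartes isD base       = isD
reach-descartes {root} isD (step {D} i r) = swap-descartes {D} i (reach-descartes {root} isD r)

total-div : ∀ {g D} → AllDiv g D → g ∣ᶻ curv (total D)
total-div h = ∣m∣n⇒∣m+n (h 0F) (∣m∣n⇒∣m+n (h 1F) (∣m∣n⇒∣m+n (h 2F) (h 3F)))

swap-div : ∀ {g D} i → AllDiv g D → AllDiv g (swap i D)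
swap-div {g} {D} i h j with j Fin.≟ i
... | yes _ = ∣m∣n⇒∣m+n (∣n⇒∣m*n (+ 2) (total-div {g} {D} h)) (∣n⇒∣m*n (- (+ 3)) (h i))
... | no _  = h j

unswap-div : ∀ {g D} i → AllDiv g (swap i D) → AllDiv g D
unswap-div {g} {D} i h j with j Fin.≟ i
... | no j≢i   = subst (λ v → g ∣ᶻ curv v) (swap-≢ D j≢i) (h j)
... | yes refl = subst (g ∣ᶻ_) (invol j)
    (∣m∣n⇒∣m+n (∣n⇒∣m*n (+ 2) (total-div {g} {swap j D} h)) (∣n⇒∣m*n (- (+ 3)) (h j)))
  where
  invol : ∀ i → + 2 * curv (total (swap i D)) + - (+ 3) * curv (swap i D i) ≡ curv (D i)
  invol 0F = id (curv (D 0F)) (curv (D 1F)) (curv (D 2F)) (curv (D 3F))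
    where id : ∀ a b c d → let a' = + 2 * (a + (b + (c + d))) + - (+ 3) * a in + 2 *
                                 (a' + (b + (c + d))) + - (+ 3) * a' ≡ a
          id = solve-∀
  invol 1F = id (curv (D 0F)) (curv (D 1F)) (curv (D 2F)) (curv (D 3F))
    where id : ∀ a b c d → let b' = + 2 * (a + (b + (c + d))) + - (+ 3) * b in + 2 *
                                 (a + (b' + (c + d))) + - (+ 3) * b' ≡ b
          id = solve-∀
  invol 2F = id (curv (D 0F)) (curv (D 1F)) (curv (D 2F)) (curv (D 3F))
    where id : ∀ a b c d → let c' = + 2 * (a + (b + (c + d))) + - (+ 3) * c in + 2 *
                                 (a + (b + (c' + d))) + - (+ 3) * c' ≡ c
          id = solve-∀
  invol 3F = id (curv (D 0F)) (curv (D 1F)) (curv (D 2F)) (curv (D 3F))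
    where id : ∀ a b c d → let d' = + 2 * (a + (b + (c + d))) + - (+ 3) * d in + 2 *
                                 (a + (b + (c + d'))) + - (+ 3) * d' ≡ d
          id = solve-∀

reach-div : ∀ {g root D} → Reach root D → AllDiv g root → AllDiv g D
reach-div base       h = h
reach-div {g} (step {D} i r) h = swap-div {g} {D} i (reach-div r h)

unreach-div : ∀ {g root D} → Reach root D → AllDiv g D → AllDiv g root
unreach-div base       h = h
unreach-div {g} (step {D} i r) h = unreach-div r (unswap-div {g} {D} i h)

-- Swaps are involutions on curvatures, so a common divisor of one reachable quadruple travels back
-- to the root and from there to every circle of the packing.
reach-primitive : ∀ {root D g} → Primitive root → Reach root D → AllDiv g D → g ∣ᶻ 1ℤ
reach-primitive {g = g} prim r h = ∣ᵤ⇒∣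
  (prim g (λ { v (D' , r' , i , refl) → ∣⇒∣ᵤ (reach-div r' (unreach-div r h) i) }))

-- Values of the form of a circle

-- Says that the form of the circle is (A, 2h, C) with AC - h² = n², that is, of discriminant -4n².
-- The middle coefficient is even because the Descartes equation makes the square of the total even;
-- `disc`, multiplied by 4, is the Descartes equation itself.
record HalfForm (n b c d : ℤ) : Set where
  field
    h : ℤ
    middle : n + b + c - d ≡ + 2 * h
    disc : (n + b) * (n + c) ≡ h * h + n * n

halfForm : ∀ {n b c d} → IsDesc n b c d → HalfForm n b c d
halfForm {n} {b} {c} {d} (desc-by e) = go S-even
  where
  S = n + b + c + d
  S-even : + 2 ∣ᶻ S
  S-even = reduce (euclidℤ Primality.prime[2] S S (divides (n * n + b * b + c * c + d * d)
    (trans e (ℤ.*-comm (+ 2) (n * n + b * b + c * c + d * d)))))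
  go : + 2 ∣ᶻ S → HalfForm n b c d
  go (divides s eq) = record { h = s - d ; middle = middle ; disc = disc }
    where
    middle : n + b + c - d ≡ + 2 * (s - d)
    middle = trans (i₁ n b c d) (trans (cong (_- + 2 * d) eq) (i₂ s d))
      where i₁ : ∀ n b c d → n + b + c - d ≡ (n + b + c + d) - + 2 * d
            i₁ = solve-∀
            i₂ : ∀ s d → s * + 2 - + 2 * d ≡ + 2 * (s - d)
            i₂ = solve-∀
    disc : (n + b) * (n + c) ≡ (s - d) * (s - d) + n * n
    disc = ℤ.i-j≡0⇒i≡j _ _ (*-cancel-0 (+ 4) (λ ()) (trans (i₁ n b c d (s - d))
        (trans (cong₂ (λ x y → x - y * y) (i₂ n b c d) (sym middle)) (trans (i₃ n b c d) (ℤ.i≡j⇒i-j≡0 e)))))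
      where
      i₁ : ∀ n b c d h → + 4 * ((n + b) * (n + c) - (h * h + n * n)) ≡ + 4 * ((n + b) * (n + c) - n * n) - (+ 2 * h) *
        (+ 2 * h)
      i₁ = solve-∀
      i₂ : ∀ n b c d → + 4 * ((n + b) * (n + c) - n * n) ≡ + 4 * (n * b + n * c + b * c)
      i₂ = solve-∀
      i₃ : ∀ n b c d → + 4 * (n * b + n * c + b * c) - (n + b + c - d) * (n + b + c - d)
        ≡ (n + b + c + d) * (n + b + c + d) - + 2 * (n * n + b * b + c * c + d * d)
      i₃ = solve-∀

complete-square : ∀ {A C h n} x y → A * C ≡ h * h + n * n →
  A * (A * (x * x) + (+ 2 * h) * (x * y) + C * (y * y)) ≡ (A * x + h * y) * (A * x + h * y) + n * n * (y * y)
complete-square {A} {C} {h} {n} x y e = trans (id A h C x y)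
  (trans (cong (λ z → (A * x + h * y) * (A * x + h * y) + (z - h * h) * (y * y)) e) (id' (A * x + h * y) h n y))
  where
  id : ∀ A h C x y → A * (A * (x * x) + (+ 2 * h) * (x * y) + C * (y * y)) ≡ (A * x + h * y) * (A * x + h * y) +
    (A * C - h * h) * (y * y)
  id = solve-∀
  id' : ∀ z h n y → z * z + (h * h + n * n - h * h) * (y * y) ≡ z * z + n * n * (y * y)
  id' = solve-∀

-- Instantiated for q = 2, m = 8 and q = 3, m = 3. For such m a coset of the squares among the units
-- is a single residue class, which is how symbols at 2 and 3 can be read off.
record UnitsSquareToOne (q : ℕ) (m : ℤ) : Set where
  field
    prime : Prime q
    q∣m : + q ∣ᶻ m
    square : ∀ a → ¬ (+ q ∣ᶻ a) → a * a ≡ 1ℤ [mod m ]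

units8 : UnitsSquareToOne 2 (+ 8)
units8 = record { prime = Primality.prime[2] ; q∣m = divides (+ 4) refl ; square = sq }
  where
  from : ∀ a r → a %ℕ 8 ≡ r → (+ r * + r) %ℕ 8 ≡ 1 → a * a ≡ 1ℤ [mod + 8 ]
  from a r e f = mod-trans (mod-* (%ℕ≡⇒mod {a} 8 e) (%ℕ≡⇒mod {a} 8 e)) (%ℕ≡⇒mod {+ r * + r} 8 f)
  sq : ∀ a → ¬ (+ 2 ∣ᶻ a) → a * a ≡ 1ℤ [mod + 8 ]
  sq a ¬d = [ [ (λ e → from a 1 e refl) , (λ e → from a 7 e refl) ]′
            , [ (λ e → from a 3 e refl) , (λ e → from a 5 e refl) ]′ ]′ (%8-odd a (∤2⇒odd {a} ¬d))

prime[3] : Prime 3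
prime[3] = from-yes (Primality.prime? 3)

units3 : UnitsSquareToOne 3 (+ 3)
units3 = record { prime = prime[3] ; q∣m = ∣-refl ; square = sq }
  where
  sq : ∀ a → ¬ (+ 3 ∣ᶻ a) → a * a ≡ 1ℤ [mod + 3 ]
  sq a ¬d = go (a %ℕ 3) refl (n%ℕd<d a 3)
    where
    from : ∀ r → a %ℕ 3 ≡ r → (+ r * + r) %ℕ 3 ≡ 1 → a * a ≡ 1ℤ [mod + 3 ]
    from r e f = mod-trans (mod-* (%ℕ≡⇒mod {a} 3 e) (%ℕ≡⇒mod {a} 3 e)) (%ℕ≡⇒mod {+ r * + r} 3 f)
    go : ∀ r → a %ℕ 3 ≡ r → r ℕ.< 3 → a * a ≡ 1ℤ [mod + 3 ]
    go 0 e _ = ⊥-elim (¬d (%ℕ≡0⇒∣ {a} 3 e))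
    go 1 e _ = from 1 e refl
    go 2 e _ = from 2 e refl
    go (suc (suc (suc r))) _ (ℕ.s≤s (ℕ.s≤s (ℕ.s≤s ())))

module _ {q m} (U : UnitsSquareToOne q m) where
  open UnitsSquareToOne U

  -- f ≡ a (a f) ≡ a, as a f is the square of a unit.
  unit-class : ∀ {a f z n t} → m ∣ᶻ n → a * f ≡ z * z + n * n * t → ¬ (+ q ∣ᶻ a) → ¬ (+ q ∣ᶻ f) → f ≡ a [mod m ]
  unit-class {a} {f} {z} {n} {t} m∣n eq ¬a ¬f =
    mod-trans (mod-trans (mod-reflexive (sym (ℤ.*-identityˡ f))) (mod-* (mod-sym (square a ¬a)) mod-refl))
      (mod-trans (mod-reflexive (ℤ.*-assoc a a f))
        (mod-trans (mod-* (mod-refl {a = a}) af≡1) (mod-reflexive (ℤ.*-identityʳ a))))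
    where
    af≡zz : a * f ≡ z * z [mod m ]
    af≡zz = by-∣ (subst (m ∣ᶻ_) (trans (i (z * z) (n * n * t)) (cong (_- z * z) (sym eq)))
      (∣m⇒∣m*n t (∣m⇒∣m*n n m∣n)))
      where i : ∀ x y → y ≡ (x + y) - x
            i = solve-∀
    ¬z : ¬ (+ q ∣ᶻ z)
    ¬z d = [ ¬a , ¬f ]′ (euclidℤ prime a f (mod-∣ (mod-coarsen q∣m af≡zz) (∣m⇒∣m*n z d)))
    af≡1 : a * f ≡ 1ℤ [mod m ]
    af≡1 = mod-trans af≡zz (square z ¬z)

  -- The values A = f(1,0) and C = f(0,1) are congruent to b and c, as m divides n, and `unit-class`
  -- applies with whichever is prime to q. If q divided both, then h² = AC - n² would be divisible
  -- by q too, and with it f.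
  value-class : ∀ {n b c d s} → IsDesc n b c d → m ∣ᶻ n →
    (¬ (+ q ∣ᶻ b) → b ≡ s [mod m ]) → (¬ (+ q ∣ᶻ c) → c ≡ s [mod m ]) →
    ∀ x y → ¬ (+ q ∣ᶻ fC n b c d x y) → fC n b c d x y ≡ s [mod m ]
  value-class {n} {b} {c} {d} {s} isD m∣n b≡ c≡ x y ¬f = cases (+ q ∣? A) (+ q ∣? C)
    where
    open HalfForm (halfForm isD)
    A = n + b
    C = n + c
    f = fC n b c d x y
    f≡ : f ≡ A * (x * x) + (+ 2 * h) * (x * y) + C * (y * y)
    f≡ = cong (λ z → A * (x * x) + z * (x * y) + C * (y * y)) middle
    q∣n : + q ∣ᶻ n
    q∣n = ∣-trans q∣m m∣n
    shift : ∀ {b} → n + b ≡ b [mod m ]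
    shift {b} = by-∣ (subst (m ∣ᶻ_) (i n b) m∣n)
      where i : ∀ n b → n ≡ n + b - b
            i = solve-∀
    Af : A * f ≡ (A * x + h * y) * (A * x + h * y) + n * n * (y * y)
    Af = trans (cong (A *_) f≡) (complete-square {A} {C} {h} {n} x y disc)
    Cf : C * f ≡ (C * y + h * x) * (C * y + h * x) + n * n * (x * x)
    Cf = trans (cong (C *_) (trans f≡ (id A h C x y))) (complete-square {C} {A} {h} {n} y x
      (trans (ℤ.*-comm C A) disc))
      where id : ∀ A h C x y → A * (x * x) + (+ 2 * h) * (x * y) + C * (y * y) ≡ C * (y * y) + (+ 2 * h) *
              (y * x) + A * (x * x)
            id = solve-∀
    cases : Dec (+ q ∣ᶻ A) → Dec (+ q ∣ᶻ C) → f ≡ s [mod m ]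
    cases (no ¬A) _ = mod-trans (unit-class {z = A * x + h * y} {t = y * y} m∣n Af ¬A ¬f)
      (mod-trans shift (b≡ λ d → ¬A (∣m∣n⇒∣m+n q∣n d)))
    cases (yes _) (no ¬C) = mod-trans (unit-class {z = C * y + h * x} {t = x * x} m∣n Cf ¬C ¬f)
      (mod-trans shift (c≡ λ d → ¬C (∣m∣n⇒∣m+n q∣n d)))
    cases (yes dA) (yes dC) = ⊥-elim (¬f (subst (+ q ∣ᶻ_) (sym f≡)
      (∣m∣n⇒∣m+n (∣m∣n⇒∣m+n (∣m⇒∣m*n (x * x) dA) (∣m⇒∣m*n (x * y) (∣n⇒∣m*n (+ 2) dh))) (∣m⇒∣m*n (y * y) dC))))
      where
      dh : + q ∣ᶻ h
      dh = reduce (euclidℤ prime h h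
        (∣m+n∣n⇒∣m {m = h * h} {n * n} (subst (+ q ∣ᶻ_) disc (∣m⇒∣m*n C dA)) (∣m⇒∣m*n n q∣n)))

-- `ValidRho` asks for ρ > 0. Adding multiples of n keeps the class of f, and |f| + 1 of them
-- outweigh a negative f.
positive-shift : ∀ f n → 0ℤ < n → 0ℤ < f + (+ suc ∣ f ∣) * n
positive-shift f (+ suc k) _ = ℤ.<-≤-trans lem
  (ℤ.+-monoʳ-≤ f (subst (+ suc ∣ f ∣ ≤_) (ℤ.pos-* (suc ∣ f ∣) (suc k)) (+≤+ (ℕ.m≤m*n (suc ∣ f ∣) (suc k)))))
  where
  lem : 0ℤ < f + + suc ∣ f ∣
  lem = nonneg f
    where
    nonneg : ∀ f → 0ℤ < f + + suc ∣ f ∣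
    nonneg (+ k) = +<+ (ℕ.<-≤-trans (ℕ.s≤s ℕ.z≤n) (ℕ.m≤n+m (suc k) k))
    nonneg -[1+ k ] = subst (0ℤ <_) (sym (i k)) (+<+ (ℕ.s≤s ℕ.z≤n))
      where i : ∀ k → suc (suc k) ℤ.⊖ suc k ≡ + 1
            i k = trans (ℤ.⊖-≥ (ℕ.n≤1+n (suc k))) (cong +_ (ℕ.m+n∸n≡m 1 k))
positive-shift f (+ 0) (+<+ ())

-- What the evaluations of χ₂ use of ρ. By `class`, its residue modulo 8 or 3 is the one shared by
-- those curvatures of the quadruple that are units there.
record Rho (D : Config) (i : Fin 4) (ε : ℤ) : Set where
  field
    ρ : ℤ
    coprime : Bz ρ (curv (D i))
    class : ∀ {q m s} → UnitsSquareToOne q m → m ∣ᶻ curv (D i) →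
      (∀ j → ¬ (+ q ∣ᶻ curv (D j)) → curv (D j) ≡ s [mod m ]) → ρ ≡ s [mod m ]
    chi : ∀ v → Chi2At (curv (D i)) ρ v → v ≡ ε

rho : ∀ {root D ε} → IsDescartes root → Primitive root → Chi2Is root ε → Reach root D →
  ∀ i → 0ℤ < curv (D i) → Rho D i ε
rho {root} {D} {ε} isR primR chi₂ r i n>0 = go (coprimeValue (n + b) (n + b + c - d) (n + c) n prim' n≢0)
  where
  open Tuple (tuple {D} (reach-descartes {root} isR r) i)
  n = curv (D i)
  b = curv (D j)
  c = curv (D k)
  d = curv (D l)
  n≢0 : n ≢ 0ℤ
  n≢0 e = ℤ.<-irrefl (sym e) n>0
  -- A prime dividing n and the three coefficients divides b, c and then d, contradicting
  -- primitivity.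
  prim' : ∀ p → Prime p → + p ∣ᶻ n + b → + p ∣ᶻ n + b + c - d → + p ∣ᶻ n + c → + p ∣ᶻ n → ⊥
  prim' p pp dA dB dC dn = prime∤1 pp (reach-primitive primR r (allDiv dn (∣m+n∣m⇒∣n dA dn) dc
      (subst (+ p ∣ᶻ_) (id n b c d) (∣m∣n⇒∣m-n (∣m∣n⇒∣m+n dA dc) dB))))
    where dc : + p ∣ᶻ c
          dc = ∣m+n∣m⇒∣n dC dn
          id : ∀ n b c d → n + b + c - (n + b + c - d) ≡ d
          id = solve-∀
  go : ∃[ x ] ∃[ y ] (Bz x y × Bz (fC n b c d x y) n) → Rho D i ε
  go (x , y , bz , bzf) = record
    { ρ = ρ
    ; coprime = Bz-modˡ ρ≡f bzf
    ; class = λ {q} U m∣n cl → mod-trans (mod-coarsen m∣n ρ≡f)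
        (value-class U {n} {b} {c} {d} desc m∣n (cl j) (cl k) x y
          (Bz⇒prime∤ bzf (UnitsSquareToOne.prime U) (∣-trans (UnitsSquareToOne.q∣m U) m∣n)))
    ; chi = chi₂ D r i j k l distinct n≢0 ρ
        (positive-shift f n n>0 , x , y , 1ℤ , Bz⇒CoprimeZ bz , Bz⇒CoprimeZ bzf , Bz⇒CoprimeZ (Bz-sym (Bz-1 {n})) ,
         ∣⇒∣ᵤ (divides (+ suc ∣ f ∣) (id f ((+ suc ∣ f ∣) * n))))
    }
    where
    f = fC n b c d x y
    ρ = f + (+ suc ∣ f ∣) * n
    ρ≡f : ρ ≡ f [mod n ]
    ρ≡f = by-∣ (divides (+ suc ∣ f ∣) (id' f ((+ suc ∣ f ∣) * n)))
      where id' : ∀ f z → f + z - f ≡ z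
            id' = solve-∀
    id : ∀ f z → f + z - f * (1ℤ * 1ℤ) ≡ z
    id = solve-∀

-- A packing containing a line

abs-< : ∀ {a b} → 0ℤ < a → a < b → ∣ a ∣ ℕ.< ∣ b ∣
abs-< {+ _} {+ _} _ (+<+ lt) = lt

0≤* : ∀ {a b} → 0ℤ ≤ a → 0ℤ ≤ b → 0ℤ ≤ a * b
0≤* {+ a} {+ b} _ _ = subst (0ℤ ≤_) (ℤ.pos-* a b) (+≤+ ℕ.z≤n)

nonneg-sum-0 : ∀ {a b} → 0ℤ ≤ a → 0ℤ ≤ b → a + b ≡ 0ℤ → a ≡ 0ℤ × b ≡ 0ℤ
nonneg-sum-0 {+ zero} {+ zero} _ _ _ = refl , refl

-- For u = b + c − d, v = b + d − c, w = c + d − b the Descartes equation with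
-- a zero entry is uv + uw + vw = 0.
flat-triple : ∀ {b c d} → IsDesc 0ℤ b c d → d ≤ b + c → c ≤ b + d → b ≤ c + d →
  (b ≡ 0ℤ × c ≡ d) ⊎ (c ≡ 0ℤ × b ≡ d) ⊎ (d ≡ 0ℤ × b ≡ c)
flat-triple {b} {c} {d} (desc-by e) d≤ c≤ b≤ = cases (ℤ.i*j≡0⇒i≡0∨j≡0 u uv≡0) (ℤ.i*j≡0⇒i≡0∨j≡0 u uw≡0)
  (ℤ.i*j≡0⇒i≡0∨j≡0 v vw≡0)
  where
  u = b + c - d
  v = b + d - c
  w = c + d - b
  0≤u : 0ℤ ≤ u
  0≤u = ℤ.i≤j⇒0≤j-i d≤
  0≤v : 0ℤ ≤ v
  0≤v = ℤ.i≤j⇒0≤j-i c≤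
  0≤w : 0ℤ ≤ w
  0≤w = ℤ.i≤j⇒0≤j-i b≤
  sum≡0 : u * v + (u * w + v * w) ≡ 0ℤ
  sum≡0 = trans (id b c d) (ℤ.i≡j⇒i-j≡0 e)
    where id : ∀ b c d → (b + c - d) * (b + d - c) + ((b + c - d) * (c + d - b) + (b + d - c) * (c + d - b))
               ≡ (0ℤ + b + c + d) * (0ℤ + b + c + d) - + 2 * (0ℤ * 0ℤ + b * b + c * c + d * d)
          id = solve-∀
  s₁ : u * v ≡ 0ℤ × u * w + v * w ≡ 0ℤ
  s₁ = nonneg-sum-0 (0≤* 0≤u 0≤v) (ℤ.+-mono-≤ {0ℤ} {_} {0ℤ} (0≤* 0≤u 0≤w) (0≤* 0≤v 0≤w)) sum≡0
  uv≡0 : u * v ≡ 0ℤ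
  uv≡0 = proj₁ s₁
  s₂ : u * w ≡ 0ℤ × v * w ≡ 0ℤ
  s₂ = nonneg-sum-0 (0≤* 0≤u 0≤w) (0≤* 0≤v 0≤w) (proj₂ s₁)
  uw≡0 : u * w ≡ 0ℤ
  uw≡0 = proj₁ s₂
  vw≡0 : v * w ≡ 0ℤ
  vw≡0 = proj₂ s₂
  half : ∀ {x y z} → x + y ≡ + 2 * z → x ≡ 0ℤ → y ≡ 0ℤ → z ≡ 0ℤ
  half {z = z} e refl refl = *-cancel-0 (+ 2) (λ ()) (sym e)
  u+v : u + v ≡ + 2 * b
  u+v = id b c d
    where id : ∀ b c d → (b + c - d) + (b + d - c) ≡ + 2 * b
          id = solve-∀
  u+w : u + w ≡ + 2 * c
  u+w = id b c d
    where id : ∀ b c d → (b + c - d) + (c + d - b) ≡ + 2 * c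
          id = solve-∀
  v+w : v + w ≡ + 2 * d
  v+w = id b c d
    where id : ∀ b c d → (b + d - c) + (c + d - b) ≡ + 2 * d
          id = solve-∀
  b0 : u ≡ 0ℤ → v ≡ 0ℤ → b ≡ 0ℤ × c ≡ d
  b0 u0 v0 = bz , trans (sym (trans (cong (_+ c) bz) (ℤ.+-identityˡ c))) (ℤ.i-j≡0⇒i≡j (b + c) d u0)
    where bz = half u+v u0 v0
  c0 : u ≡ 0ℤ → w ≡ 0ℤ → c ≡ 0ℤ × b ≡ d
  c0 u0 w0 = cz , trans (sym (trans (cong (λ z → b + z) cz) (ℤ.+-identityʳ b))) (ℤ.i-j≡0⇒i≡j (b + c) d u0)
    where cz = half u+w u0 w0
  d0 : v ≡ 0ℤ → w ≡ 0ℤ → d ≡ 0ℤ × b ≡ c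
  d0 v0 w0 = dz , trans (sym (trans (cong (λ z → b + z) dz) (ℤ.+-identityʳ b))) (ℤ.i-j≡0⇒i≡j (b + d) c v0)
    where dz = half v+w v0 w0
  cases : u ≡ 0ℤ ⊎ v ≡ 0ℤ → u ≡ 0ℤ ⊎ w ≡ 0ℤ → v ≡ 0ℤ ⊎ w ≡ 0ℤ →
    (b ≡ 0ℤ × c ≡ d) ⊎ (c ≡ 0ℤ × b ≡ d) ⊎ (d ≡ 0ℤ × b ≡ c)
  cases (inj₁ u0) _ (inj₁ v0) = inj₁ (b0 u0 v0)
  cases (inj₁ u0) _ (inj₂ w0) = inj₂ (inj₁ (c0 u0 w0))
  cases (inj₂ v0) (inj₁ u0) _ = inj₁ (b0 u0 v0)
  cases (inj₂ v0) (inj₂ w0) _ = inj₂ (inj₂ (d0 v0 w0))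

unit-positive : ∀ {x} → x ∣ᶻ 1ℤ → 0ℤ < x + x → x ≡ 1ℤ
unit-positive {+ n} d _ = cong +_ (ℕ.∣1⇒≡1 (∣⇒∣ᵤ d))
unit-positive { -[1+ n ]} d ()

module _ {root : Config} (isR : IsDescartes root) (primR : Primitive root) where

  -- Replacing the largest of the other three circles lowers the total
  -- curvature until a second line appears.
  zero⇒one : ∀ fuel {D} i → Reach root D → ∣ curvSum D ∣ ℕ.< fuel → curv (D i) ≡ 0ℤ → IsCurv root 1ℤ
  zero⇒one (suc fuel) {D} i r lt n≡0 = cases (d ℤ.≤? b + c) (c ℤ.≤? b + d) (b ℤ.≤? c + d)
    where
    isD = reach-descartes {root} isR r
    open Tuple (tuple {D} isD i)
    n = curv (D i)
    b = curv (D j)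
    c = curv (D k)
    d = curv (D l)
    i≢j = proj₁ distinct
    i≢k = proj₁ (proj₂ distinct)
    i≢l = proj₁ (proj₂ (proj₂ distinct))
    sum' : b + c + d ≡ curvSum D
    sum' = trans (trans (id b c d) (cong (λ z → z + b + c + d) (sym n≡0))) sum
      where id : ∀ b c d → b + c + d ≡ 0ℤ + b + c + d
            id = solve-∀
    S>0 : 0ℤ < b + c + d
    S>0 = subst (0ℤ <_) (sym sum') (proj₂ (proj₂ isD))
    desc₀ : IsDesc 0ℤ b c d
    desc₀ = subst (λ z → IsDesc z b c d) n≡0 desc
    -- As n = 0, replacing a circle of curvature x changes the total S into 3S - 4x = S + 2 (S -
    -- 2x), a decrease exactly when 2x > S. Totals stay positive, so their size bounds the
    -- recursion.
    continue : ∀ l → i ≢ l → ¬ (+ 2 * curv (D l) ≤ b + c + d) → IsCurv root 1ℤ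
    continue l i≢l ≰ = zero⇒one fuel {swap l D} i (step l r)
        (ℕ.<-≤-trans (abs-< (curvSum-swap-positive {D} l isD) smaller) (ℕ.≤-pred lt))
        (trans (cong curv (swap-≢ D i≢l)) n≡0)
      where
      smaller : curvSum (swap l D) < curvSum D
      smaller = subst₂ _<_
        (sym (trans (curvSum-swap l D) (trans (cong (λ z → + 3 * z - + 4 * curv (D l)) (sym sum'))
        (id (b + c + d) (curv (D l))))))
        (trans (id' (b + c + d)) sum')
        (ℤ.+-monoʳ-< (b + c + d)
          (ℤ.*-monoˡ-<-pos (+ 2) (subst (b + c + d - + 2 * curv (D l) <_) (ℤ.+-inverseʳ (+ 2 * curv (D l)))
          (ℤ.+-monoˡ-< (- (+ 2 * curv (D l))) (ℤ.≰⇒> ≰)))))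
        where
        id : ∀ S d → + 3 * S - + 4 * d ≡ S + + 2 * (S - + 2 * d)
        id = solve-∀
        id' : ∀ S → S + + 2 * 0ℤ ≡ S
        id' = solve-∀
    unit : ∀ g → g ∣ᶻ b → g ∣ᶻ c → g ∣ᶻ d → g ∣ᶻ 1ℤ
    unit g b∣ c∣ d∣ = reach-primitive primR r (allDiv (subst (g ∣ᶻ_) (sym n≡0) (divides 0ℤ refl)) b∣ c∣ d∣)
    -- The descent ends at curvatures 0, 0, x, x. Then x divides all four, so primitivity makes it a
    -- unit, and the positive total x + x makes it 1.
    found : ∀ x → x ∣ᶻ 1ℤ → x + x ≡ b + c + d → ∀ l → curv (D l) ≡ x → IsCurv root 1ℤ
    found x x∣1 e l e' = D l , (D , r , l , refl) , trans e' (unit-positive x∣1 (subst (0ℤ <_) (sym e) S>0))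
    finish : (b ≡ 0ℤ × c ≡ d) ⊎ (c ≡ 0ℤ × b ≡ d) ⊎ (d ≡ 0ℤ × b ≡ c) → IsCurv root 1ℤ
    finish (inj₁ (b0 , cd)) = found c (unit c (subst (c ∣ᶻ_) (sym b0) (divides 0ℤ refl)) ∣-refl
      (subst (c ∣ᶻ_) cd ∣-refl))
      (trans (id c) (cong₂ (λ x y → x + c + y) (sym b0) cd)) k refl
      where id : ∀ c → c + c ≡ 0ℤ + c + c
            id = solve-∀
    finish (inj₂ (inj₁ (c0 , bd))) = found b (unit b ∣-refl (subst (b ∣ᶻ_) (sym c0) (divides 0ℤ refl))
      (subst (b ∣ᶻ_) bd ∣-refl))
      (trans (id b) (cong₂ (λ x y → b + x + y) (sym c0) bd)) j refl
      where id : ∀ c → c + c ≡ c + 0ℤ + c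
            id = solve-∀
    finish (inj₂ (inj₂ (d0 , bc))) = found b (unit b ∣-refl (subst (b ∣ᶻ_) bc ∣-refl)
      (subst (b ∣ᶻ_) (sym d0) (divides 0ℤ refl)))
      (trans (id b) (cong₂ (λ x y → b + y + x) (sym d0) bc)) j refl
      where id : ∀ c → c + c ≡ c + c + 0ℤ
            id = solve-∀
    large : ∀ x y z → x + y + z ≡ b + c + d → ¬ (z ≤ x + y) → ¬ (+ 2 * z ≤ b + c + d)
    large x y z e ≰ le = ≰ (subst₂ _≤_ (id₁ z) (id₂ x y z) (ℤ.+-monoˡ-≤ (- z) (subst (+ 2 * z ≤_) (sym e) le)))
      where id₁ : ∀ z → + 2 * z + - z ≡ z
            id₁ = solve-∀
            id₂ : ∀ x y z → x + y + z + - z ≡ x + y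
            id₂ = solve-∀
    cases : Dec (d ≤ b + c) → Dec (c ≤ b + d) → Dec (b ≤ c + d) → IsCurv root 1ℤ
    cases (no ≰) _ _ = continue l i≢l (large b c d refl ≰)
    cases (yes _) (no ≰) _ = continue k i≢k (large b d c (id b c d) ≰)
      where id : ∀ b c d → b + d + c ≡ b + c + d
            id = solve-∀
    cases (yes _) (yes _) (no ≰) = continue j i≢j (large c d b (id b c d) ≰)
      where id : ∀ b c d → c + d + b ≡ b + c + d
            id = solve-∀
    cases (yes d≤) (yes c≤) (yes b≤) = finish (flat-triple desc₀ d≤ c≤ b≤)

  curv0⇒curv1 : IsCurv root 0ℤ → IsCurv root 1ℤ
  curv0⇒curv1 (_ , (D , r , i , refl) , n≡0) = zero⇒one (suc ∣ curvSum D ∣) i r ℕ.≤-refl n≡0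

-- Residues modulo 24

^-%ℕ : ∀ m d k .{{_ : NonZero k}} → (m ℕ.^ d) ℕ.% k ≡ ((m ℕ.% k) ℕ.^ d) ℕ.% k
^-%ℕ m zero    k = refl
^-%ℕ m (suc d) k = begin
  (m ℕ.* m ℕ.^ d) ℕ.% k                                        ≡⟨ ℕ.%-distribˡ-* m (m ℕ.^ d) k ⟩
  ((m ℕ.% k) ℕ.* ((m ℕ.^ d) ℕ.% k)) ℕ.% k                      ≡⟨ cong (λ z → ((m ℕ.% k) ℕ.* z) ℕ.% k) (^-%ℕ m d k) ⟩
  ((m ℕ.% k) ℕ.* (((m ℕ.% k) ℕ.^ d) ℕ.% k)) ℕ.% k              ≡⟨ cong (λ z → (z ℕ.* (((m ℕ.% k) ℕ.^ d) ℕ.% k)) ℕ.% k)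
    (ℕ.m%n%n≡m%n m k) ⟨
  ((m ℕ.% k ℕ.% k) ℕ.* (((m ℕ.% k) ℕ.^ d) ℕ.% k)) ℕ.% k        ≡⟨ ℕ.%-distribˡ-* (m ℕ.% k) ((m ℕ.% k) ℕ.^ d) k ⟨
  ((m ℕ.% k) ℕ.^ suc d) ℕ.% k                                  ∎
  where open ≡-Reasoning

*^-%ℕ : ∀ u m d k .{{_ : NonZero k}} → (u ℕ.* m ℕ.^ d) ℕ.% k ≡ (u ℕ.* (m ℕ.% k) ℕ.^ d) ℕ.% k
*^-%ℕ u m d k = begin
  (u ℕ.* m ℕ.^ d) ℕ.% k                                        ≡⟨ ℕ.%-distribˡ-* u (m ℕ.^ d) k ⟩
  ((u ℕ.% k) ℕ.* ((m ℕ.^ d) ℕ.% k)) ℕ.% k                      ≡⟨ cong (λ z → ((u ℕ.% k) ℕ.* z) ℕ.% k) (^-%ℕ m d k) ⟩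
  ((u ℕ.% k) ℕ.* (((m ℕ.% k) ℕ.^ d) ℕ.% k)) ℕ.% k              ≡⟨ ℕ.%-distribˡ-* u ((m ℕ.% k) ℕ.^ d) k ⟨
  (u ℕ.* (m ℕ.% k) ℕ.^ d) ℕ.% k                                ∎
  where open ≡-Reasoning

-- The residue of u mᵈ depends only on m modulo 24, so a claim about all admissible values reduces
-- to 24 bases and is settled by evaluation.
record Residues (u d : ℕ) (S : List ℕ) (P : ℕ → Set) : Set where
  constructor by-cases
  field case24 : ∀ (r : Fin 24) → (u ℕ.* toℕ r ℕ.^ d) ℕ.% 24 ∈ S → P ((u ℕ.* toℕ r ℕ.^ d) ℕ.% 24)

residues? : ∀ u d S {P : ℕ → Set} → (∀ r → Dec (P r)) → Dec (Residues u d S P)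
residues? u d S P? = map′ by-cases Residues.case24 (Fin.all? λ r → (_ ∈? S) →-dec P? _)

residues : ∀ {u d S P} → Residues u d S P → ∀ m → (u ℕ.* m ℕ.^ d) ℕ.% 24 ∈ S → P ((u ℕ.* m ℕ.^ d) ℕ.% 24)
residues {u} {d} {S} {P} (by-cases h) m = subst (λ z → z ∈ S → P z) eq (h (fromℕ< (ℕ.m%n<n m 24)))
  where
  eq : (u ℕ.* toℕ (fromℕ< (ℕ.m%n<n m 24)) ℕ.^ d) ℕ.% 24 ≡ (u ℕ.* m ℕ.^ d) ℕ.% 24
  eq = trans (cong (λ z → (u ℕ.* z ℕ.^ d) ℕ.% 24) (Fin.toℕ-fromℕ< (ℕ.m%n<n m 24))) (sym (*^-%ℕ u m d 24))

≡0⊎≡? : ∀ q m s .{{_ : NonZero q}} .{{_ : NonZero m}} → ∀ r → Dec (r ℕ.% q ≡ 0 ⊎ r ℕ.% m ≡ s)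
≡0⊎≡? q m s r = (r ℕ.% q ℕ.≟ 0) ⊎-dec (r ℕ.% m ℕ.≟ s)

-- The finite fact behind all symbol values: admissible curvatures prime to 3 share one class modulo
-- 3, and in the types (6,·) odd ones share one class modulo 8.
Class : (q m s : ℕ) .{{_ : NonZero q}} .{{_ : NonZero m}} → List ℕ → Set
Class q m s S = All (λ r → r ℕ.% q ≡ 0 ⊎ r ℕ.% m ≡ s) S

class? : ∀ q m s .{{_ : NonZero q}} .{{_ : NonZero m}} S → Dec (Class q m s S)
class? q m s S = All.all? (≡0⊎≡? q m s) S

module _ {root : Config} {S : List ℕ} (ty : TypeIs root S) where

  residue∈ : ∀ {D} → Reach root D → ∀ j → curv (D j) %ℕ 24 ∈ S
  residue∈ {D} r j = Equivalence.to (ty _) (D j , (D , r , j , refl) , refl)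

  class-mod : ∀ {q m s} .{{_ : NonZero q}} .{{_ : NonZero m}} → q ℕ.∣ 24 → m ℕ.∣ 24 → Class q m s S →
    ∀ {D} → Reach root D → ∀ j → ¬ (+ q ∣ᶻ curv (D j)) → curv (D j) ≡ + s [mod + m ]
  class-mod {q} {m} q∣ m∣ cl {D} r j ¬d with All.lookup cl (residue∈ r j)
  ... | inj₁ e = ⊥-elim (¬d (%ℕ≡0⇒∣ {curv (D j)} q (trans (sym (%ℕ-%ℕ (curv (D j)) q 24 q∣)) e)))
  ... | inj₂ e = %ℕ≡⇒mod {curv (D j)} m (trans (sym (%ℕ-%ℕ (curv (D j)) m 24 m∣)) e)

  curv-residue : ∀ {n} → IsCurv root (+ n) → n ℕ.% 24 ∈ S
  curv-residue (v , inP , refl) = Equivalence.to (ty _) (v , inP , refl)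

∣24 : ∀ m {_ : True (m ℕ.∣? 24)} → m ℕ.∣ 24
∣24 m {t} = toWitness t

-- Squares times a constant

-- Reads a residue as its symbol. Only 1, 5 modulo 8 and 1, 2 modulo 3 occur, so the default -1
-- serves both 5 at the prime 2 and 2 at the prime 3.
signOf : ℕ → ℤ
signOf 1 = 1ℤ
signOf _ = - 1ℤ

kron2 : ∀ {a s} → s ≡ 1 ⊎ s ≡ 5 → a ≡ + s [mod + 8 ] → KronPrimeIs a 2 (signOf s)
kron2 {a} (inj₁ refl) h = inj₁ (refl , inj₂ (inj₁ (inj₁ (mod⇒%ℕ≡ {a} {+ 1} 8 h) , refl)))
kron2 {a} (inj₂ refl) h = inj₁ (refl , inj₂ (inj₂ (inj₂ (mod⇒%ℕ≡ {a} {+ 5} 8 h) , refl)))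

kron3 : ∀ {a s} → s ≡ 1 ⊎ s ≡ 2 → a ≡ + s [mod + 3 ] → KronPrimeIs a 3 (signOf s)
kron3 {a} (inj₁ refl) h = kron3⁺ {a} (mod⇒%ℕ≡ {a} {+ 1} 3 h)
kron3 {a} (inj₂ refl) h = kron3⁻ {a} (mod⇒%ℕ≡ {a} {+ 2} 3 h)

kronList₁ : ∀ {a p x} → KronPrimeIs a p x → KronList a (p ∷ []) x
kronList₁ {x = x} k = x , 1ℤ , k , refl , sym (ℤ.*-identityʳ x)

module _ {D : Config} {i : Fin 4} {ε : ℤ} (R : Rho D i ε) (us : List ℕ) (pus : All Prime us) {m : ℕ}
  (m≢0 : m ≢ 0) {t : ℤ} where
  open Rho R

  private
    n = curv (D i)
    N = product us ℕ.* m ℕ.^ 2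

    ∣N : + m ∣ᶻ + N
    ∣N = ∣ᵤ⇒∣ (ℕ.∣n⇒∣m*n (product us) (ℕ.divides m (cong (m ℕ.*_) (ℕ.*-identityʳ m))))

  eval-0-1 : n ≡ + N → (n %ℕ 4 ≡ 0 ⊎ n %ℕ 4 ≡ 1) → KronList ρ us t → t ≡ ε
  eval-0-1 e h k = chi t (inj₁ (h , subst (λ z → KronIs ρ z t) (sym e)
    (kronSquare us pus k m m≢0 (Bz-divʳ coprime (subst (+ m ∣ᶻ_) (sym e) ∣N)))))

  -- For n ≡ 2 (mod 4) the symbol is taken modulo n/2, so `us` lists the primes of u/2 when n = u
  -- m²: none for u = 2, only 3 for u = 6.
  eval-2 : n ≡ + (2 ℕ.* N) → n %ℕ 4 ≡ 2 → KronList (- ρ) us t → t ≡ ε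
  eval-2 e h k = chi t (inj₂ (inj₁ (h , + N , trans e (ℤ.pos-* 2 N) ,
    kronSquare us pus k m m≢0
      (bz-neg (Bz-divʳ coprime (subst (+ m ∣ᶻ_) (sym e) (∣-trans ∣N (divides (+ 2) (ℤ.pos-* 2 N)))))))))
    where
    bz-neg : ∀ {a b} → Bz a b → Bz (- a) b
    bz-neg {a} {b} (x , y , eq) = - x , y , trans (id x y a b) eq
      where id : ∀ x y a b → - x * - a + y * b ≡ x * a + y * b
            id = solve-∀

  -- The numerator is 2ρ, and cancelling the primes of m requires it to be prime to m; besides
  -- coprimality of ρ this uses that m is odd, as n is.
  eval-3 : n ≡ + N → n %ℕ 4 ≡ 3 → KronList (+ 2 * ρ) us t → t ≡ ε
  eval-3 e h k = chi t (inj₂ (inj₂ (h , subst (λ z → KronIs (+ 2 * ρ) z t) (sym e)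
    (kronSquare us pus k m m≢0 (Bz-sym (Bz-* m-odd (Bz-sym (Bz-divʳ coprime m∣n))))))))
    where
    m∣n : + m ∣ᶻ n
    m∣n = subst (+ m ∣ᶻ_) (sym e) ∣N
    n-odd : ¬ (+ 2 ∣ᶻ n)
    n-odd = odd⇒∤2 {n} (trans (sym (%ℕ-%ℕ n 2 4 (ℕ.divides 2 refl))) (cong (ℕ._% 2) h))
    m-odd : Bz (+ m) (+ 2)
    m-odd = prime∤⇒Bz Primality.prime[2] λ d → n-odd (∣-trans d m∣n)

module Quadratic {root : Config} (isR : IsDescartes root) (primR : Primitive root)
  {S : List ℕ} (ty : TypeIs root S) {ε : ℤ} (chi₂ : Chi2Is root ε) where

  private
    rhoAt : ∀ {D} → Reach root D → ∀ i {N} → N ≢ 0 → curv (D i) ≡ + N → Rho D i ε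
    rhoAt {D} r i {zero} N≢0 e = ⊥-elim (N≢0 refl)
    rhoAt {D} r i {suc N} N≢0 e = rho {root} {D} isR primR chi₂ r i (subst (0ℤ <_) (sym e) (+<+ (ℕ.s≤s ℕ.z≤n)))

    u*m²≢0 : ∀ u {m} .{{_ : NonZero u}} → m ≢ 0 → u ℕ.* m ℕ.^ 2 ≢ 0
    u*m²≢0 u {m} m≢0 e with ℕ.m*n≡0⇒m≡0∨n≡0 u e
    ... | inj₁ u≡0 = ℕ.≢-nonZero⁻¹ u u≡0
    ... | inj₂ e'  = m≢0 (ℕ.m^n≡0⇒m≡0 m 2 e')

    res : ∀ u {P : ℕ → Set} → Residues u 2 S P → ∀ {D} → Reach root D → ∀ i m → curv (D i) ≡ + (u ℕ.* m ℕ.^ 2) → P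
      (curv (D i) %ℕ 24)
    res u {P} h {D} r i m e = subst P (cong (_%ℕ 24) (sym e))
      (residues {u} {2} {S} {P} h m (subst (λ z → z %ℕ 24 ∈ S) e (residue∈ ty {D} r i)))

    %4 : ∀ {n s} → (n %ℕ 24) ℕ.% 4 ≡ s → n %ℕ 4 ≡ s
    %4 {n} = trans (sym (%ℕ-%ℕ n 4 24 (∣24 4)))

    %4' : ∀ {n} → (n %ℕ 24) ℕ.% 4 ≡ 0 ⊎ (n %ℕ 24) ℕ.% 4 ≡ 1 → n %ℕ 4 ≡ 0 ⊎ n %ℕ 4 ≡ 1
    %4' {n} = [ inj₁ ∘ %4 {n} , inj₂ ∘ %4 {n} ]′

    8∣ : ∀ {n} → (n %ℕ 24) ℕ.% 8 ≡ 0 → + 8 ∣ᶻ n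
    8∣ {n} h = %ℕ≡0⇒∣ {n} 8 (trans (sym (%ℕ-%ℕ n 8 24 (∣24 8))) h)

    8∣⇒%4 : ∀ {n} → + 8 ∣ᶻ n → n %ℕ 4 ≡ 0
    8∣⇒%4 {n} d = ∣⇒%ℕ≡0 {n} 4 (∣-trans (divides (+ 2) refl) d)

    3∣ : ∀ {n} u m → n ≡ + (3 ℕ.* u ℕ.* m ℕ.^ 2) → + 3 ∣ᶻ n
    3∣ u m refl = ∣ᵤ⇒∣ (ℕ.∣m⇒∣m*n (m ℕ.^ 2) (ℕ.m∣m*n u))

    p2 : All Prime (2 ∷ [])
    p2 = Primality.prime[2] ∷ []
    p3 : All Prime (3 ∷ [])
    p3 = prime[3] ∷ []
    p6 : All Prime (2 ∷ 3 ∷ [])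
    p6 = Primality.prime[2] ∷ prime[3] ∷ []

  square₁ : Residues 1 2 S (λ r → r ℕ.% 4 ≡ 0 ⊎ r ℕ.% 4 ≡ 1) →
    ∀ m → m ≢ 0 → IsCurv root (+ (1 ℕ.* m ℕ.^ 2)) → 1ℤ ≡ ε
  square₁ h m m≢0 (_ , (D , r , i , refl) , e) =
    eval-0-1 (rhoAt {D} r i (u*m²≢0 1 m≢0) e) [] [] m≢0 e (%4' {curv (D i)} (res 1 h r i m e)) refl

  -- The symbol at 2 depends on ρ modulo 8, and ρ is controlled only modulo divisors of n. In the
  -- types (6,·) the admissible residues force m to be even, whence 8 divides 2m².
  square₂ : ∀ {s} → s ≡ 1 ⊎ s ≡ 5 → Class 2 8 s S → Residues 2 2 S (λ r → r ℕ.% 8 ≡ 0) →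
    ∀ m → m ≢ 0 → IsCurv root (+ (2 ℕ.* m ℕ.^ 2)) → signOf s ≡ ε
  square₂ hs cl h m m≢0 (_ , (D , r , i , refl) , e) =
    eval-0-1 R (2 ∷ []) p2 m≢0 e (inj₁ (8∣⇒%4 {curv (D i)} d8))
      (kronList₁ {Rho.ρ R} (kron2 hs (Rho.class R units8 d8 (class-mod ty (∣24 2) (∣24 8) cl {D} r))))
    where
    R = rhoAt {D} r i (u*m²≢0 2 m≢0) e
    d8 = 8∣ {curv (D i)} (res 2 h r i m e)

  square₃ : ∀ {s} → s ≡ 1 ⊎ s ≡ 2 → Class 3 3 s S → Residues 3 2 S (λ r → r ℕ.% 4 ≡ 0 ⊎ r ℕ.% 4 ≡ 1) →
    ∀ m → m ≢ 0 → IsCurv root (+ (3 ℕ.* m ℕ.^ 2)) → signOf s ≡ ε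
  square₃ hs cl h m m≢0 (_ , (D , r , i , refl) , e) =
    eval-0-1 R (3 ∷ []) p3 m≢0 e (%4' {curv (D i)} (res 3 h r i m e))
      (kronList₁ {Rho.ρ R}
        (kron3 hs (Rho.class R units3 (3∣ {curv (D i)} 1 m e) (class-mod ty (∣24 3) (∣24 3) cl {D} r))))
    where
    R = rhoAt {D} r i (u*m²≢0 3 m≢0) e

  square₆ : ∀ {s s'} → s ≡ 1 ⊎ s ≡ 5 → s' ≡ 1 ⊎ s' ≡ 2 → Class 2 8 s S → Class 3 3 s' S → Residues 6 2 S
    (λ r → r ℕ.% 8 ≡ 0) →
    ∀ m → m ≢ 0 → IsCurv root (+ (6 ℕ.* m ℕ.^ 2)) → signOf s * signOf s' ≡ ε
  square₆ {s} {s'} hs hs' cl cl' h m m≢0 (_ , (D , r , i , refl) , e) =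
    eval-0-1 R (2 ∷ 3 ∷ []) p6 m≢0 e (inj₁ (8∣⇒%4 {curv (D i)} d8))
      (signOf s , signOf s' , kron2 hs (Rho.class R units8 d8 (class-mod ty (∣24 2) (∣24 8) cl {D} r)) ,
        kronList₁ {Rho.ρ R}
          (kron3 hs' (Rho.class R units3 (3∣ {curv (D i)} 2 m e) (class-mod ty (∣24 3) (∣24 3) cl' {D} r))) , refl)
    where
    R = rhoAt {D} r i (u*m²≢0 6 m≢0) e
    d8 = 8∣ {curv (D i)} (res 6 h r i m e)

  -- Here n/2 = m² is a perfect square, so the symbol is 1 whatever ρ is.
  square₂′ : Residues 2 2 S (λ r → r ℕ.% 4 ≡ 2) →
    ∀ m → m ≢ 0 → IsCurv root (+ (2 ℕ.* m ℕ.^ 2)) → 1ℤ ≡ ε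
  square₂′ h m m≢0 (_ , (D , r , i , refl) , e) =
    eval-2 (rhoAt {D} r i (u*m²≢0 2 m≢0) e) [] [] m≢0
      (trans e (cong (λ z → + (2 ℕ.* z)) (sym (ℕ.*-identityˡ (m ℕ.^ 2)))))
      (%4 {curv (D i)} (res 2 h r i m e)) refl

  -- s' is the class of 2ρ, which is also that of −ρ modulo 3.
  square₃′ : ∀ {s s'} → (s ≡ 1 × s' ≡ 2) ⊎ (s ≡ 2 × s' ≡ 1) → Class 3 3 s S → Residues 3 2 S (λ r → r ℕ.% 4 ≡ 3) →
    ∀ m → m ≢ 0 → IsCurv root (+ (3 ℕ.* m ℕ.^ 2)) → signOf s' ≡ ε
  square₃′ {s} {s'} hs cl h m m≢0 (_ , (D , r , i , refl) , e) =
    eval-3 R (3 ∷ []) p3 m≢0 e (%4 {curv (D i)} (res 3 h r i m e)) (kronList₁ {+ 2 * Rho.ρ R} (dbl hs))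
    where
    R = rhoAt {D} r i (u*m²≢0 3 m≢0) e
    ρ≡ : Rho.ρ R ≡ + s [mod + 3 ]
    ρ≡ = Rho.class R units3 (3∣ {curv (D i)} 1 m e) (class-mod ty (∣24 3) (∣24 3) cl {D} r)
    dbl : (s ≡ 1 × s' ≡ 2) ⊎ (s ≡ 2 × s' ≡ 1) → KronPrimeIs (+ 2 * Rho.ρ R) 3 (signOf s')
    dbl (inj₁ (refl , refl)) = kron3 (inj₂ refl) (mod-* (mod-refl {a = + 2}) ρ≡)
    dbl (inj₂ (refl , refl)) = kron3 (inj₁ refl) (mod-trans (mod-* (mod-refl {a = + 2}) ρ≡)
      (by-∣ (divides (+ 1) refl)))

  square₆′ : ∀ {s s'} → (s ≡ 1 × s' ≡ 2) ⊎ (s ≡ 2 × s' ≡ 1) → Class 3 3 s S → Residues 6 2 S (λ r → r ℕ.% 4 ≡ 2) →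
    ∀ m → m ≢ 0 → IsCurv root (+ (6 ℕ.* m ℕ.^ 2)) → signOf s' ≡ ε
  square₆′ {s} {s'} hs cl h m m≢0 (_ , (D , r , i , refl) , e) =
    eval-2 R (3 ∷ []) p3 m≢0 (trans e (cong +_ (ℕ.*-assoc 2 3 (m ℕ.^ 2)))) (%4 {curv (D i)} (res 6 h r i m e))
      (kronList₁ { - Rho.ρ R} (ngt hs))
    where
    R = rhoAt {D} r i (u*m²≢0 6 m≢0) e
    ρ≡ : Rho.ρ R ≡ + s [mod + 3 ]
    ρ≡ = Rho.class R units3 (3∣ {curv (D i)} 2 m e) (class-mod ty (∣24 3) (∣24 3) cl {D} r)
    neg : ∀ a → - a ≡ - 1ℤ * a
    neg = solve-∀
    -ρ≡ : - Rho.ρ R ≡ - 1ℤ * + s [mod + 3 ]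
    -ρ≡ = mod-trans (mod-reflexive (neg (Rho.ρ R))) (mod-* (mod-refl {a = - 1ℤ}) ρ≡)
    ngt : (s ≡ 1 × s' ≡ 2) ⊎ (s ≡ 2 × s' ≡ 1) → KronPrimeIs (- Rho.ρ R) 3 (signOf s')
    ngt (inj₁ (refl , refl)) = kron3 (inj₂ refl) (mod-trans -ρ≡ (by-∣ (divides (- 1ℤ) refl)))
    ngt (inj₂ (refl , refl)) = kron3 (inj₁ refl) (mod-trans -ρ≡ (by-∣ (divides (- 1ℤ) refl)))

-- From missing values to obstructions

abs-^ : ∀ m d → ∣ m ^ d ∣ ≡ ∣ m ∣ ℕ.^ d
abs-^ m zero    = refl
abs-^ m (suc d) = trans (ℤ.abs-* m (m ^ d)) (cong (∣ m ∣ ℕ.*_) (abs-^ m d))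

NonNegExp : ℕ → Set
NonNegExp d = ∀ m → 0ℤ ≤ m ^ d

nonNeg2 : NonNegExp 2
nonNeg2 m = subst (λ z → 0ℤ ≤ m * z) (sym (ℤ.*-identityʳ m)) (0≤sq m)

nonNeg4 : NonNegExp 4
nonNeg4 m = subst (0ℤ ≤_) (id m) (0≤sq (m * m))
  where id : ∀ m → (m * m) * (m * m) ≡ m * (m * (m * (m * 1ℤ)))
        id = solve-∀

*^-abs : ∀ {d} → NonNegExp d → ∀ u m → + u * m ^ d ≡ + (u ℕ.* ∣ m ∣ ℕ.^ d)
*^-abs {d} nn u m = trans (cong (λ z → + u * z) (trans (sym (ℤ.0≤i⇒+∣i∣≡i (nn m))) (cong +_ (abs-^ m d))))
  (sym (ℤ.pos-* u (∣ m ∣ ℕ.^ d)))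

-- Natural bases suffice because the exponents are even. The base 0 is split off: it asks for a
-- line, on which χ₂ and χ₄ have no value.
Missing : Config → ℕ → ℕ → Set
Missing root d u = ∀ m → m ≢ 0 → ¬ IsCurv root (+ (u ℕ.* m ℕ.^ d))

module _ {root : Config} {S : List ℕ} (ty : TypeIs root S) where

  member : ∀ {r} → r ∈ S → InR root r
  member {r} = Equivalence.from (ty r)

  -- The arithmetic progression r₀ + 24 k supplies infinitely many bases.
  large : ∀ u d r₀ .{{_ : NonZero u}} .{{_ : NonZero d}} N →
    ∃[ m ] (N ℕ.< u ℕ.* m ℕ.^ d × (u ℕ.* m ℕ.^ d) ℕ.% 24 ≡ (u ℕ.* r₀ ℕ.^ d) ℕ.% 24)
  large u (suc d) r₀ N = m , bound , res
    where
    m = suc N ℕ.* 24 ℕ.+ r₀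
    bound : N ℕ.< u ℕ.* m ℕ.^ suc d
    bound = begin
      suc N              ≤⟨ ℕ.m≤m*n (suc N) 24 ⟩
      suc N ℕ.* 24       ≤⟨ ℕ.m≤m+n (suc N ℕ.* 24) r₀ ⟩
      m                  ≤⟨ ℕ.m≤m*n m (m ℕ.^ d) {{ℕ.m^n≢0 m d}} ⟩
      m ℕ.^ suc d        ≤⟨ ℕ.m≤n*m (m ℕ.^ suc d) u ⟩
      u ℕ.* m ℕ.^ suc d  ∎
      where open ℕ.≤-Reasoning
    res : (u ℕ.* m ℕ.^ suc d) ℕ.% 24 ≡ (u ℕ.* r₀ ℕ.^ suc d) ℕ.% 24
    res = trans (*^-%ℕ u m (suc d) 24) (trans
      (cong (λ z → (u ℕ.* z ℕ.^ suc d) ℕ.% 24) (ℕ.%-remove-+ˡ {suc N ℕ.* 24} r₀ (ℕ.n∣m*n (suc N))))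
      (sym (*^-%ℕ u r₀ (suc d) 24)))

  exceptional : ∀ u d r₀ {r} .{{_ : NonZero u}} .{{_ : NonZero d}} → (u ℕ.* r₀ ℕ.^ d) ℕ.% 24 ≡ r → r ∈ S →
    Missing root d u → Exceptional root r
  exceptional u d r₀ {r} e r∈S miss = member r∈S , λ N → pick N (large u d r₀ N)
    where
    m≢0 : ∀ {N m} → N ℕ.< u ℕ.* m ℕ.^ d → m ≢ 0
    m≢0 {N} lt refl = ℕ.n≮0 (subst (N ℕ.<_) (trans (cong (u ℕ.*_) (0^ d)) (ℕ.*-zeroʳ u)) lt)
      where 0^ : ∀ d .{{_ : NonZero d}} → 0 ℕ.^ d ≡ 0
            0^ (suc d) = refl
    pick : ∀ N → ∃[ m ] (N ℕ.< u ℕ.* m ℕ.^ d × (u ℕ.* m ℕ.^ d) ℕ.% 24 ≡ (u ℕ.* r₀ ℕ.^ d) ℕ.% 24) →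
      ∃[ m ] (N ℕ.< m × m ℕ.% 24 ≡ r × ¬ IsCurv root (+ m))
    pick N (m , lt , e') = u ℕ.* m ℕ.^ d , lt , trans e' e , miss m (m≢0 {N} {m} lt)

  obstruction : ∀ u d r₀ .{{_ : NonZero u}} .{{_ : NonZero d}} → NonNegExp d → (u ℕ.* r₀ ℕ.^ d) ℕ.% 24 ∈ S →
    IsDescartes root → Primitive root → ¬ IsCurv root 1ℤ → Missing root d u → Obstruction root d u
  obstruction u d r₀ nn r∈S isR primR no1 miss = infinite , missing
    where
    infinite : ∀ N → ∃[ m ] (N < + u * m ^ d × InR root ((+ u * m ^ d) %ℕ 24))
    infinite N = pick (large u d r₀ ∣ N ∣)
      where
      ≤abs : ∀ N → N ≤ + ∣ N ∣
      ≤abs (+ n)    = ℤ.≤-refl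
      ≤abs -[1+ n ] = ℤ.-≤+
      pick : ∃[ m ] (∣ N ∣ ℕ.< u ℕ.* m ℕ.^ d × (u ℕ.* m ℕ.^ d) ℕ.% 24 ≡ (u ℕ.* r₀ ℕ.^ d) ℕ.% 24) →
        ∃[ m ] (N < + u * m ^ d × InR root ((+ u * m ^ d) %ℕ 24))
      pick (m , lt , e) = + m ,
        subst (N <_) (sym (*^-abs {d} nn u (+ m))) (ℤ.≤-<-trans (≤abs N) (+<+ lt)) ,
        subst (λ z → InR root (z %ℕ 24)) (sym (*^-abs {d} nn u (+ m))) (subst (InR root) (sym e) (member r∈S))
    missing : ∀ m → ¬ IsCurv root (+ u * m ^ d)
    missing m c with ∣ m ∣ ℕ.≟ 0
    ... | no m≢0  = miss ∣ m ∣ m≢0 (subst (IsCurv root) (*^-abs {d} nn u m) c)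
    -- The base 0 gives curvature 0, and a primitive packing with a line contains a circle of
    -- curvature 1.
    ... | yes m≡0 = no1 (curv0⇒curv1 {root} isR primR
          (subst (IsCurv root)
            (trans (*^-abs {d} nn u m) (trans (cong (λ z → + (u ℕ.* z ℕ.^ d)) m≡0) (cong +_ (u*0 d)))) c))
      where u*0 : ∀ d .{{_ : NonZero d}} → u ℕ.* 0 ℕ.^ d ≡ 0
            u*0 (suc d) = ℕ.*-zeroʳ u

-- Gaussian integers

𝔾-commutativeRing : CommutativeRing 0ℓ 0ℓ
𝔾-commutativeRing = record
  { Carrier = 𝔾 ; _≈_ = _≡_ ; _+_ = _+ᵍ_ ; _*_ = _*ᵍ_ ; -_ = λ z → -ᵍ z ; 0# = 0ᵍ ; 1# = 1ᵍ
  ; isCommutativeRing = record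
    { isRing = record
      { +-isAbelianGroup = record
        { isGroup = record
          { isMonoid = record
            { isSemigroup = record
              { isMagma = record { isEquivalence = isEquivalence ; ∙-cong = cong₂ _+ᵍ_ }
              ; assoc = λ (a +i b) (c +i d) (e +i f) → cong₂ _+i_ (ℤ.+-assoc a c e) (ℤ.+-assoc b d f) }
            ; identity = (λ (a +i b) → cong₂ _+i_ (ℤ.+-identityˡ a) (ℤ.+-identityˡ b))
                       , (λ (a +i b) → cong₂ _+i_ (ℤ.+-identityʳ a) (ℤ.+-identityʳ b)) }
          ; inverse = (λ (a +i b) → cong₂ _+i_ (ℤ.+-inverseˡ a) (ℤ.+-inverseˡ b))
                    , (λ (a +i b) → cong₂ _+i_ (ℤ.+-inverseʳ a) (ℤ.+-inverseʳ b))
          ; ⁻¹-cong = cong (λ z → -ᵍ z) }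
        ; comm = λ (a +i b) (c +i d) → cong₂ _+i_ (ℤ.+-comm a c) (ℤ.+-comm b d) }
      ; *-cong = cong₂ _*ᵍ_
      ; *-assoc = λ (a +i b) (c +i d) (e +i f) → cong₂ _+i_ (assoc₁ a b c d e f) (assoc₂ a b c d e f)
      ; *-identity = (λ (a +i b) → cong₂ _+i_ (idˡ₁ a b) (idˡ₂ a b)) , (λ (a +i b) → cong₂ _+i_ (idʳ₁ a b) (idʳ₂ a b))
      ; distrib = (λ (a +i b) (c +i d) (e +i f) → cong₂ _+i_ (disˡ₁ a b c d e f) (disˡ₂ a b c d e f))
                , (λ (a +i b) (c +i d) (e +i f) → cong₂ _+i_ (disʳ₁ a b c d e f) (disʳ₂ a b c d e f))
      }
    ; *-comm = λ (a +i b) (c +i d) → cong₂ _+i_ (comm₁ a b c d) (comm₂ a b c d)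
    }
  }
  where
  assoc₁ : ∀ a b c d e f → (a * c - b * d) * e - (a * d + b * c) * f ≡ a * (c * e - d * f) - b * (c * f + d * e)
  assoc₁ = solve-∀
  assoc₂ : ∀ a b c d e f → (a * c - b * d) * f + (a * d + b * c) * e ≡ a * (c * f + d * e) + b * (c * e - d * f)
  assoc₂ = solve-∀
  idˡ₁ : ∀ a b → 1ℤ * a - 0ℤ * b ≡ a
  idˡ₁ = solve-∀
  idˡ₂ : ∀ a b → 1ℤ * b + 0ℤ * a ≡ b
  idˡ₂ = solve-∀
  idʳ₁ : ∀ a b → a * 1ℤ - b * 0ℤ ≡ a
  idʳ₁ = solve-∀
  idʳ₂ : ∀ a b → a * 0ℤ + b * 1ℤ ≡ b
  idʳ₂ = solve-∀
  disˡ₁ : ∀ a b c d e f → a * (c + e) - b * (d + f) ≡ (a * c - b * d) + (a * e - b * f)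
  disˡ₁ = solve-∀
  disˡ₂ : ∀ a b c d e f → a * (d + f) + b * (c + e) ≡ (a * d + b * c) + (a * f + b * e)
  disˡ₂ = solve-∀
  disʳ₁ : ∀ a b c d e f → (c + e) * a - (d + f) * b ≡ (c * a - d * b) + (e * a - f * b)
  disʳ₁ = solve-∀
  disʳ₂ : ∀ a b c d e f → (c + e) * b + (d + f) * a ≡ (c * b + d * a) + (e * b + f * a)
  disʳ₂ = solve-∀
  comm₁ : ∀ a b c d → a * c - b * d ≡ c * a - d * b
  comm₁ = solve-∀
  comm₂ : ∀ a b c d → a * d + b * c ≡ c * b + d * a
  comm₂ = solve-∀

𝔾-ring : ACR.AlmostCommutativeRing 0ℓ 0ℓ
𝔾-ring = ACR.fromCommutativeRing 𝔾-commutativeRing λ { ((+ 0) +i (+ 0)) → just refl ; _ → nothing }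

module 𝔾R = CommutativeRing 𝔾-commutativeRing

Nᵍ-* : ∀ x y → Nᵍ (x *ᵍ y) ≡ Nᵍ x * Nᵍ y
Nᵍ-* (a +i b) (c +i d) = id a b c d
  where id : ∀ a b c d → (a * c - b * d) * (a * c - b * d) + (a * d + b * c) * (a * d + b * c) ≡ (a * a + b * b) *
          (c * c + d * d)
        id = solve-∀

conj-norm : ∀ x → x *ᵍ conj x ≡ fromℤ (Nᵍ x)
conj-norm (a +i b) = cong₂ _+i_ (id₁ a b) (id₂ a b)
  where id₁ : ∀ a b → a * a - b * - b ≡ a * a + b * b
        id₁ = solve-∀
        id₂ : ∀ a b → a * - b + b * a ≡ 0ℤ
        id₂ = solve-∀

Nᵍ-conj : ∀ x → Nᵍ (conj x) ≡ Nᵍ x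
Nᵍ-conj (a +i b) = id a b
  where id : ∀ a b → a * a + - b * - b ≡ a * a + b * b
        id = solve-∀

Nᵍ-fromℤ : ∀ a → Nᵍ (fromℤ a) ≡ a * a
Nᵍ-fromℤ a = ℤ.+-identityʳ (a * a)

fromℤ-* : ∀ a b → fromℤ (a * b) ≡ fromℤ a *ᵍ fromℤ b
fromℤ-* a b = cong₂ _+i_ (id₁ a b) (id₂ a b)
  where id₁ : ∀ a b → a * b ≡ a * b - 0ℤ * 0ℤ
        id₁ = solve-∀
        id₂ : ∀ a b → 0ℤ ≡ a * 0ℤ + 0ℤ * b
        id₂ = solve-∀

0≤N : ∀ x → 0ℤ ≤ Nᵍ x
0≤N (a +i b) = ℤ.+-mono-≤ {0ℤ} {_} {0ℤ} (0≤sq a) (0≤sq b)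

N≡0⇒≡0 : ∀ x → Nᵍ x ≡ 0ℤ → x ≡ 0ᵍ
N≡0⇒≡0 (a +i b) e = let a² , b² = nonneg-sum-0 (0≤sq a) (0≤sq b) e in cong₂ _+i_ (root a a²) (root b b²)
  where root : ∀ a → a * a ≡ 0ℤ → a ≡ 0ℤ
        root a e = reduce (ℤ.i*j≡0⇒i≡0∨j≡0 a e)

-- _∣ᵍ_ as a record, so that its arguments can be inferred.
infix 4 _∥_

record _∥_ (x y : 𝔾) : Set where
  constructor dividesᵍ
  field
    quotᵍ : 𝔾
    eqᵍ : y ≡ x *ᵍ quotᵍ

∥⇒∣ᵍ : ∀ {x y} → x ∥ y → x ∣ᵍ y
∥⇒∣ᵍ (dividesᵍ k e) = k , e

∣ᵍ⇒∥ : ∀ {x y} → x ∣ᵍ y → x ∥ y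
∣ᵍ⇒∥ (k , e) = dividesᵍ k e

∥-refl : ∀ {x} → x ∥ x
∥-refl {x} = dividesᵍ 1ᵍ (sym (𝔾R.*-identityʳ x))

∥-trans : ∀ {x y z} → x ∥ y → y ∥ z → x ∥ z
∥-trans {x} (dividesᵍ k refl) (dividesᵍ l refl) = dividesᵍ (k *ᵍ l) (𝔾R.*-assoc x k l)

∥-*ʳ : ∀ {x y} z → x ∥ y → x ∥ y *ᵍ z
∥-*ʳ {x} z (dividesᵍ k refl) = dividesᵍ (k *ᵍ z) (𝔾R.*-assoc x k z)

∥-*ˡ : ∀ {x y} z → x ∥ y → x ∥ z *ᵍ y
∥-*ˡ {x} z (dividesᵍ k refl) = dividesᵍ (z *ᵍ k) (id x z k)
  where id : ∀ x z k → z *ᵍ (x *ᵍ k) ≡ x *ᵍ (z *ᵍ k)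
        id = 𝔾S.solve-∀ 𝔾-ring

∥-+ : ∀ {x y z} → x ∥ y → x ∥ z → x ∥ y +ᵍ z
∥-+ {x} (dividesᵍ k refl) (dividesᵍ l refl) = dividesᵍ (k +ᵍ l) (sym (𝔾R.distribˡ x k l))

∥-0 : ∀ {x} → x ∥ 0ᵍ
∥-0 {x} = dividesᵍ 0ᵍ (sym (𝔾R.zeroʳ x))

unit-conj : ∀ {u} → Unitᵍ u → u *ᵍ conj u ≡ 1ᵍ
unit-conj {u} e = trans (conj-norm u) (cong fromℤ e)

infix 4 _≈_⟨_⟩

record _≈_⟨_⟩ (x y π : 𝔾) : Set where
  constructor by-∣ᵍ
  field diffᵍ : π ∥ x -ᵍ y
open _≈_⟨_⟩ public

≈-reflexive : ∀ {π x y} → x ≡ y → x ≈ y ⟨ π ⟩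
≈-reflexive {π} {x} refl = by-∣ᵍ (dividesᵍ 0ᵍ (trans (𝔾R.-‿inverseʳ x) (sym (𝔾R.zeroʳ π))))

≈-refl : ∀ {π x} → x ≈ x ⟨ π ⟩
≈-refl = ≈-reflexive refl

≈-trans : ∀ {π x y z} → x ≈ y ⟨ π ⟩ → y ≈ z ⟨ π ⟩ → x ≈ z ⟨ π ⟩
≈-trans {π} {x} {y} {z} (by-∣ᵍ p) (by-∣ᵍ q) = by-∣ᵍ (subst (π ∥_) (id x y z) (∥-+ p q))
  where id : ∀ x y z → (x -ᵍ y) +ᵍ (y -ᵍ z) ≡ x -ᵍ z
        id = 𝔾S.solve-∀ 𝔾-ring

≈-sym : ∀ {π x y} → x ≈ y ⟨ π ⟩ → y ≈ x ⟨ π ⟩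
≈-sym {π} {x} {y} (by-∣ᵍ (dividesᵍ k e)) = by-∣ᵍ (dividesᵍ (-ᵍ k)
  (trans (id₁ x y) (trans (cong (λ z → -ᵍ z) e) (id₂ π k))))
  where id₁ : ∀ x y → y -ᵍ x ≡ -ᵍ (x -ᵍ y)
        id₁ = 𝔾S.solve-∀ 𝔾-ring
        id₂ : ∀ π k → -ᵍ (π *ᵍ k) ≡ π *ᵍ (-ᵍ k)
        id₂ = 𝔾S.solve-∀ 𝔾-ring

≈-+ : ∀ {π x y z w} → x ≈ y ⟨ π ⟩ → z ≈ w ⟨ π ⟩ → x +ᵍ z ≈ y +ᵍ w ⟨ π ⟩
≈-+ {π} {x} {y} {z} {w} (by-∣ᵍ p) (by-∣ᵍ q) = by-∣ᵍ (subst (π ∥_) (id x y z w) (∥-+ p q))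
  where id : ∀ x y z w → (x -ᵍ y) +ᵍ (z -ᵍ w) ≡ (x +ᵍ z) -ᵍ (y +ᵍ w)
        id = 𝔾S.solve-∀ 𝔾-ring

≈-* : ∀ {π x y z w} → x ≈ y ⟨ π ⟩ → z ≈ w ⟨ π ⟩ → x *ᵍ z ≈ y *ᵍ w ⟨ π ⟩
≈-* {π} {x} {y} {z} {w} (by-∣ᵍ p) (by-∣ᵍ q) = by-∣ᵍ (subst (π ∥_) (id x y z w) (∥-+ (∥-*ʳ z p) (∥-*ˡ y q)))
  where id : ∀ x y z w → (x -ᵍ y) *ᵍ z +ᵍ y *ᵍ (z -ᵍ w) ≡ (x *ᵍ z) -ᵍ (y *ᵍ w)
        id = 𝔾S.solve-∀ 𝔾-ring

≈-^ : ∀ {π x y} n → x ≈ y ⟨ π ⟩ → (x ^ᵍ n) ≈ (y ^ᵍ n) ⟨ π ⟩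
≈-^ zero    p = ≈-refl
≈-^ (suc n) p = ≈-* p (≈-^ n p)

≈-coarsen : ∀ {π σ x y} → π ∥ σ → x ≈ y ⟨ σ ⟩ → x ≈ y ⟨ π ⟩
≈-coarsen d (by-∣ᵍ p) = by-∣ᵍ (∥-trans d p)

fromℤ-mod : ∀ {a b m} → a ≡ b [mod m ] → fromℤ a ≈ fromℤ b ⟨ fromℤ m ⟩
fromℤ-mod {a} {b} {m} (by-∣ (divides q e)) = by-∣ᵍ (dividesᵍ (fromℤ q)
  (trans (cong fromℤ (trans e (ℤ.*-comm q m))) (fromℤ-* m q)))

-- Euclidean division and Bézout in ℤ[i]

-- Rounding to the nearest multiple leaves |s| ≤ n/2, written as 4s² ≤ n² so that the bounds of two
-- coordinates can be added.
nearest : ∀ A n → 0ℤ < n → ∃[ q ] ∃[ s ] (A ≡ q * n + s × + 4 * (s * s) ≤ n * n)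
nearest A (+ zero) (+<+ ())
nearest A (+ suc k) _ = pick (2 ℕ.* r ℕ.≤? n)
  where
  n = suc k
  r = A %ℕ n
  q = A /ℕ n
  A≡ : A ≡ + r + q * + n
  A≡ = a≡a%ℕn+[a/ℕn]*n A n
  bound : ∀ t → 2 ℕ.* t ℕ.≤ n → + 4 * (+ t * + t) ≤ + n * + n
  bound t le = subst₂ _≤_
    (trans (ℤ.pos-* (2 ℕ.* t) (2 ℕ.* t)) (trans (cong₂ _*_ (ℤ.pos-* 2 t) (ℤ.pos-* 2 t)) (id (+ t)))) (ℤ.pos-* n n)
      (+≤+ (ℕ.*-mono-≤ le le))
    where id : ∀ t → (+ 2 * t) * (+ 2 * t) ≡ + 4 * (t * t)
          id = solve-∀
  pick : Dec (2 ℕ.* r ℕ.≤ n) → ∃[ q ] ∃[ s ] (A ≡ q * + n + s × + 4 * (s * s) ≤ + n * + n)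
  pick (yes le) = q , + r , trans A≡ (ℤ.+-comm (+ r) (q * + n)) , bound r le
  pick (no ≰) = q + 1ℤ , - (+ t) , trans A≡ (trans (id (+ r) q (+ n)) (cong (λ z → (q + 1ℤ) * + n + z) r-n)) ,
      subst (λ z → + 4 * z ≤ + n * + n) (id' (+ t)) (bound t le')
    where
    t = n ℕ.∸ r
    id : ∀ r q n → r + q * n ≡ (q + 1ℤ) * n + (r - n)
    id = solve-∀
    id' : ∀ t → t * t ≡ - t * - t
    id' = solve-∀
    r-n : + r - + n ≡ - (+ t)
    r-n = trans (ℤ.[+m]-[+n]≡m⊖n r n) (ℤ.⊖-≤ (ℕ.<⇒≤ (n%ℕd<d A n)))
    le' : 2 ℕ.* t ℕ.≤ n
    le' = subst (ℕ._≤ n) (sym (ℕ.*-distribˡ-∸ 2 n r))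
      (ℕ.≤-trans (ℕ.∸-monoʳ-≤ (2 ℕ.* n) (ℕ.<⇒≤ (ℕ.≰⇒> ≰))) (ℕ.≤-reflexive
        (trans (ℕ.m+n∸m≡n n (n ℕ.+ 0)) (ℕ.+-identityʳ n))))

half-bound : ∀ N n → 0ℤ < n → + 4 * (N * n) ≤ n * n + n * n → N < n
half-bound N n n>0 upper = ℤ.≰⇒> λ n≤N → ℤ.<⇒≱ strict (ℤ.≤-trans (lower n≤N) upper)
  where
  lower : n ≤ N → + 4 * (n * n) ≤ + 4 * (N * n)
  lower le = ℤ.*-monoˡ-≤-nonNeg (+ 4) (ℤ.*-monoʳ-≤-nonNeg n {{ℤ.nonNegative (ℤ.<⇒≤ n>0)}} le)
  strict : n * n + n * n < + 4 * (n * n)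
  strict = subst₂ _<_ (ℤ.+-identityʳ _) (j (n * n)) (ℤ.+-monoʳ-< (n * n + n * n) (ℤ.+-mono-< (0<sq n>0) (0<sq n>0)))
    where j : ∀ z → z + z + (z + z) ≡ + 4 * z
          j = solve-∀

sub-multiple : ∀ c n {q₁ q₂ s₁ s₂} → re c ≡ q₁ * n + s₁ → im c ≡ q₂ * n + s₂ → c -ᵍ (q₁ +i q₂) *ᵍ fromℤ n ≡ s₁ +i s₂
sub-multiple (_ +i _) n {q₁} {q₂} {s₁} {s₂} refl refl = cong₂ _+i_ (i₁ q₁ q₂ n s₁) (i₂ q₁ q₂ n s₂)
  where i₁ : ∀ q₁ q₂ n s → q₁ * n + s + - (q₁ * n - q₂ * 0ℤ) ≡ s
        i₁ = solve-∀
        i₂ : ∀ q₁ q₂ n s → q₂ * n + s + - (q₁ * 0ℤ + q₂ * n) ≡ s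
        i₂ = solve-∀

-- The quotient is a b̄ / N(b) rounded in both coordinates. The remainder satisfies r b̄ = s₁ + s₂
-- i, so N(r) N(b) = s₁² + s₂² ≤ N(b)²/2.
divideᵍ : ∀ a b → b ≢ 0ᵍ → ∃[ q ] ∃[ r ] (a ≡ q *ᵍ b +ᵍ r × Nᵍ r < Nᵍ b)
divideᵍ a b b≢0 = go (a *ᵍ conj b) (Nᵍ b) refl refl n>0 (nearest _ _ n>0) (nearest _ _ n>0)
  where
  n>0 : 0ℤ < Nᵍ b
  n>0 = ℤ.≤∧≢⇒< (0≤N b) (λ e → b≢0 (N≡0⇒≡0 b (sym e)))
  go : ∀ c n → a *ᵍ conj b ≡ c → Nᵍ b ≡ n → 0ℤ < n →
    (∃[ q ] ∃[ s ] (re c ≡ q * n + s × + 4 * (s * s) ≤ n * n)) →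
    (∃[ q ] ∃[ s ] (im c ≡ q * n + s × + 4 * (s * s) ≤ n * n)) →
    ∃[ q ] ∃[ r ] (a ≡ q *ᵍ b +ᵍ r × Nᵍ r < n)
  go c n c≡ n≡ n>0 (q₁ , s₁ , e₁ , h₁) (q₂ , s₂ , e₂ , h₂) = q , r , id a q b , half-bound (Nᵍ r) n n>0 upper
    where
    q = q₁ +i q₂
    r = a -ᵍ q *ᵍ b
    id : ∀ a q b → a ≡ q *ᵍ b +ᵍ (a -ᵍ q *ᵍ b)
    id = 𝔾S.solve-∀ 𝔾-ring
    rb̄ : r *ᵍ conj b ≡ s₁ +i s₂
    rb̄ = trans (i₁ a q b (conj b)) (trans (cong₂ (λ y z → y -ᵍ q *ᵍ z) c≡ (trans (conj-norm b) (cong fromℤ n≡)))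
      (sub-multiple c n {q₁} {q₂} {s₁} {s₂} e₁ e₂))
      where
      i₁ : ∀ a q b b' → (a -ᵍ q *ᵍ b) *ᵍ b' ≡ a *ᵍ b' -ᵍ q *ᵍ (b *ᵍ b')
      i₁ = 𝔾S.solve-∀ 𝔾-ring
    norm : Nᵍ r * n ≡ s₁ * s₁ + s₂ * s₂
    norm = trans (cong (λ z → Nᵍ r * z) (trans (sym n≡) (sym (Nᵍ-conj b))))
      (trans (sym (Nᵍ-* r (conj b))) (cong Nᵍ rb̄))
    upper : + 4 * (Nᵍ r * n) ≤ n * n + n * n
    upper = subst (_≤ n * n + n * n) (trans (sym (ℤ.*-distribˡ-+ (+ 4) (s₁ * s₁) (s₂ * s₂)))
      (cong (+ 4 *_) (sym norm))) (ℤ.+-mono-≤ h₁ h₂)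

nat< : ∀ {x y} → 0ℤ ≤ x → x < y → ∣ x ∣ ℕ.< ∣ y ∣
nat< {+ _} {+ _} _ (+<+ l) = l

record Bezoutᵍ (a b : 𝔾) : Set where
  field
    g s t : 𝔾
    g∣a : g ∥ a
    g∣b : g ∥ b
    comb : g ≡ s *ᵍ a +ᵍ t *ᵍ b

bezoutᵍ : ∀ fuel a b → ∣ Nᵍ b ∣ ℕ.< fuel → Bezoutᵍ a b
bezoutᵍ (suc fuel) a b lt = cases (Nᵍ b ℤ.≟ 0ℤ)
  where
  id₀ : ∀ a b → a ≡ 1ᵍ *ᵍ a +ᵍ 0ᵍ *ᵍ b
  id₀ = 𝔾S.solve-∀ 𝔾-ring
  id : ∀ s t q b r → s *ᵍ b +ᵍ t *ᵍ r ≡ t *ᵍ (q *ᵍ b +ᵍ r) +ᵍ (s -ᵍ t *ᵍ q) *ᵍ b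
  id = 𝔾S.solve-∀ 𝔾-ring
  go : ∃[ q ] ∃[ r ] (a ≡ q *ᵍ b +ᵍ r × Nᵍ r < Nᵍ b) → Bezoutᵍ a b
  go (q , r , e , r<b) = record { g = g ; s = t ; t = s -ᵍ t *ᵍ q
    ; g∣a = subst (g ∥_) (sym e) (∥-+ (∥-*ˡ q g∣a) g∣b) ; g∣b = g∣a
    ; comb = trans comb (trans (id s t q b r) (cong (λ z → t *ᵍ z +ᵍ (s -ᵍ t *ᵍ q) *ᵍ b) (sym e))) }
    where open Bezoutᵍ (bezoutᵍ fuel b r (ℕ.<-≤-trans (nat< (0≤N r) r<b) (ℕ.≤-pred lt)))
  cases : Dec (Nᵍ b ≡ 0ℤ) → Bezoutᵍ a b
  cases (yes e) = record { g = a ; s = 1ᵍ ; t = 0ᵍ ; g∣a = ∥-refl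
    ; g∣b = subst (a ∥_) (sym (N≡0⇒≡0 b e)) ∥-0 ; comb = id₀ a b }
  cases (no ne) = go (divideᵍ a b (λ e → ne (cong Nᵍ e)))

-- Let g be a gcd of π and x; being a combination of them, it gives π | g y. Irreducibility of π = g
-- h makes g a unit, and then π | y, or h a unit, and then π | g | x.
euclidᵍ : ∀ {π} → GPrime π → ∀ x y → π ∥ x *ᵍ y → π ∥ x ⊎ π ∥ y
euclidᵍ {π} (_ , _ , irr) x y d = go g∣a
  where
  open Bezoutᵍ (bezoutᵍ (suc ∣ Nᵍ x ∣) π x ℕ.≤-refl)
  π∥gy : π ∥ g *ᵍ y
  π∥gy = subst (π ∥_) (trans (id s π t x y) (cong (_*ᵍ y) (sym comb))) (∥-+ (∥-*ʳ (s *ᵍ y) ∥-refl) (∥-*ˡ t d))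
    where
    id : ∀ s π t x y → π *ᵍ (s *ᵍ y) +ᵍ t *ᵍ (x *ᵍ y) ≡ (s *ᵍ π +ᵍ t *ᵍ x) *ᵍ y
    id = 𝔾S.solve-∀ 𝔾-ring
  go : g ∥ π → π ∥ x ⊎ π ∥ y
  go (dividesᵍ h e) = [ inj₂ ∘ unit-g , inj₁ ∘ unit-h ]′ (irr g h e)
    where
    unit-g : Unitᵍ g → π ∥ y
    unit-g ug = ∥-trans π∥gy
      (dividesᵍ (conj g) (trans (sym (𝔾R.*-identityˡ y))
      (trans (cong (_*ᵍ y) (sym (unit-conj {g} ug))) (id' g y (conj g)))))
      where id' : ∀ g y c → g *ᵍ c *ᵍ y ≡ g *ᵍ y *ᵍ c
            id' = 𝔾S.solve-∀ 𝔾-ring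
    unit-h : Unitᵍ h → π ∥ x
    unit-h uh = ∥-trans
      (dividesᵍ (conj h) (trans (sym (𝔾R.*-identityʳ g)) (trans (cong (g *ᵍ_) (sym (unit-conj {h} uh)))
        (trans (sym (𝔾R.*-assoc g h (conj h))) (cong (_*ᵍ conj h) (sym e)))))) g∣b

-- Frobenius and Fermat in ℤ[i]

private
  module B = Binomial 𝔾R.commutativeSemiring
  module E = Exp 𝔾R.semiring
  module M = Mult 𝔾R.semiring
  module Sm = Sum 𝔾R.semiring

^ᵍ≡^ : ∀ x n → x ^ᵍ n ≡ x E.^ n
^ᵍ≡^ x zero    = refl
^ᵍ≡^ x (suc n) = cong (x *ᵍ_) (^ᵍ≡^ x n)

^ᵍ-* : ∀ x m n → (x ^ᵍ m) ^ᵍ n ≡ x ^ᵍ (m ℕ.* n)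
^ᵍ-* x m n = trans (^ᵍ≡^ (x ^ᵍ m) n) (trans (cong (E._^ n) (^ᵍ≡^ x m))
  (trans (E.^-assocʳ x m n) (sym (^ᵍ≡^ x (m ℕ.* n)))))

^ᵍ-+ : ∀ x m n → x ^ᵍ (m ℕ.+ n) ≡ x ^ᵍ m *ᵍ x ^ᵍ n
^ᵍ-+ x m n = trans (^ᵍ≡^ x (m ℕ.+ n)) (trans (E.^-homo-* x m n) (sym (cong₂ _*ᵍ_ (^ᵍ≡^ x m) (^ᵍ≡^ x n))))

*ᵍ-^ᵍ : ∀ x y n → (x *ᵍ y) ^ᵍ n ≡ x ^ᵍ n *ᵍ y ^ᵍ n
*ᵍ-^ᵍ x y zero    = refl
*ᵍ-^ᵍ x y (suc n) = trans (cong (x *ᵍ y *ᵍ_) (*ᵍ-^ᵍ x y n)) (id x y (x ^ᵍ n) (y ^ᵍ n))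
  where id : ∀ x y z w → x *ᵍ y *ᵍ (z *ᵍ w) ≡ x *ᵍ z *ᵍ (y *ᵍ w)
        id = 𝔾S.solve-∀ 𝔾-ring

1^ᵍ : ∀ n → 1ᵍ ^ᵍ n ≡ 1ᵍ
1^ᵍ zero    = refl
1^ᵍ (suc n) = trans (𝔾R.*-identityˡ (1ᵍ ^ᵍ n)) (1^ᵍ n)

×≡fromℤ : ∀ n z → n M.× z ≡ fromℤ (+ n) *ᵍ z
×≡fromℤ zero    z = sym (𝔾R.zeroˡ z)
×≡fromℤ (suc n) z = trans (cong (z +ᵍ_) (×≡fromℤ n z)) (trans (cong (_+ᵍ fromℤ (+ n) *ᵍ z) (sym (𝔾R.*-identityˡ z)))
  (sym (𝔾R.distribʳ z 1ᵍ (fromℤ (+ n)))))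

sum≈last : ∀ {π} n (f : Fin (suc n) → 𝔾) → (∀ k → toℕ k ℕ.< n → π ∥ f k) → Sm.sum f ≈ f (Fin.fromℕ n) ⟨ π ⟩
sum≈last zero    f h = ≈-reflexive (𝔾R.+-identityʳ (f 0F))
sum≈last (suc n) f h = ≈-trans
  (≈-+ (f0≈0 (h 0F (ℕ.s≤s ℕ.z≤n))) (sum≈last n (f ∘ Fin.suc) (λ k lt → h (Fin.suc k) (ℕ.s≤s lt))))
    (≈-reflexive (𝔾R.+-identityˡ (f (Fin.fromℕ (suc n)))))
  where
  f0≈0 : ∀ {π x} → π ∥ x → x ≈ 0ᵍ ⟨ π ⟩
  f0≈0 {π} {x} d = by-∣ᵍ (subst (π ∥_) (sym (𝔾R.+-identityʳ x)) d)

prime∤! : ∀ {p} → Prime p → ∀ k → k ℕ.< p → ¬ (p ℕ.∣ k !)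
prime∤! pp zero    _  d with refl ← ℕ.∣1⇒≡1 d = Primality.¬prime[1] pp
prime∤! pp (suc k) lt d with euclidsLemma (suc k) (k !) pp d
... | inj₁ e = ℕ.<⇒≱ lt (ℕ.∣⇒≤ e)
... | inj₂ e = prime∤! pp k (ℕ.<-trans (ℕ.n<1+n k) lt) e

prime∣C : ∀ {p} → Prime p → ∀ k → 0 ℕ.< k → k ℕ.< p → p ℕ.∣ (p choose k)
prime∣C {p} pp k 0<k k<p with euclidsLemma (p choose k) (k ! ℕ.* (p ℕ.∸ k) !) pp
    (subst (p ℕ.∣_) p!≡ (p∣p! p (ℕ.≢-nonZero⁻¹ p {{prime⇒nonZero pp}})))
  where
  p∣p! : ∀ p → p ≢ 0 → p ℕ.∣ p !
  p∣p! zero    h = ⊥-elim (h refl)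
  p∣p! (suc p) _ = ℕ.m∣m*n (p !)
  instance
    nz : NonZero (k ! ℕ.* (p ℕ.∸ k) !)
    nz = ℕ._!*_!≢0 k (p ℕ.∸ k)
  p!≡ : p ! ≡ (p choose k) ℕ.* (k ! ℕ.* (p ℕ.∸ k) !)
  p!≡ = trans (sym (ℕ.m/n*n≡m (k![n∸k]!∣n! (ℕ.<⇒≤ k<p)))) (cong (ℕ._* (k ! ℕ.* (p ℕ.∸ k) !))
    (sym (nCk≡n!/k![n-k]! (ℕ.<⇒≤ k<p))))
... | inj₁ d = d
... | inj₂ d with euclidsLemma (k !) ((p ℕ.∸ k) !) pp d
...   | inj₁ e = ⊥-elim (prime∤! pp k k<p e)
...   | inj₂ e = ⊥-elim (prime∤! pp (p ℕ.∸ k) (ℕ.∸-monoʳ-< 0<k (ℕ.<⇒≤ k<p)) e)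

freshman : ∀ {p} → Prime p → ∀ x y → (x +ᵍ y) ^ᵍ p ≈ x ^ᵍ p +ᵍ y ^ᵍ p ⟨ fromℤ (+ p) ⟩
freshman {zero}  pp = ⊥-elim (Primality.¬prime[0] pp)
freshman {suc q} pp x y = ≈-trans (≈-reflexive (trans (^ᵍ≡^ (x +ᵍ y) p) (B.theorem p x y)))
  (≈-trans (≈-+ (≈-reflexive first) (≈-trans (sum≈last q (term ∘ Fin.suc) middle) (≈-reflexive final)))
    -- Term k of the binomial sum carries the k-th power of x, so its surviving ends come out as yᵖ
    -- + xᵖ.
    (≈-reflexive (𝔾R.+-comm (y ^ᵍ p) (x ^ᵍ p))))
  where
  p = suc q
  term : Fin (suc p) → 𝔾
  term = B.binomialTerm x y p
  first : term 0F ≡ y ^ᵍ p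
  first = begin
    (p choose 0) M.× (1ᵍ *ᵍ y E.^ p)  ≡⟨ cong (M._× (1ᵍ *ᵍ y E.^ p)) (trans (nCk≡nC[n∸k] {0} {p} ℕ.z≤n) (nCn≡1 p)) ⟩
    1 M.× (1ᵍ *ᵍ y E.^ p)        ≡⟨ M.×-homo-1 (1ᵍ *ᵍ y E.^ p) ⟩
    1ᵍ *ᵍ y E.^ p                ≡⟨ 𝔾R.*-identityˡ (y E.^ p) ⟩
    y E.^ p                      ≡⟨ ^ᵍ≡^ y p ⟨
    y ^ᵍ p                       ∎
    where open ≡-Reasoning
  final : term (Fin.suc (Fin.fromℕ q)) ≡ x ^ᵍ p
  final = begin
    term (Fin.suc (Fin.fromℕ q))                  ≡⟨ cong (λ k → (p choose k) M.× (x E.^ k *ᵍ y E.^ (p ℕ.∸ k)))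
      (cong suc (Fin.toℕ-fromℕ q)) ⟩
    (p choose p) M.× (x E.^ p *ᵍ y E.^ (p ℕ.∸ p))      ≡⟨ cong₂ (λ c e → c M.× (x E.^ p *ᵍ y E.^ e)) (nCn≡1 p)
      (ℕ.n∸n≡0 p) ⟩
    1 M.× (x E.^ p *ᵍ 1ᵍ)                         ≡⟨ M.×-homo-1 (x E.^ p *ᵍ 1ᵍ) ⟩
    x E.^ p *ᵍ 1ᵍ                                 ≡⟨ 𝔾R.*-identityʳ (x E.^ p) ⟩
    x E.^ p                                       ≡⟨ ^ᵍ≡^ x p ⟨
    x ^ᵍ p                                        ∎
    where open ≡-Reasoning
  middle : ∀ k → toℕ k ℕ.< q → fromℤ (+ p) ∥ term (Fin.suc k)
  middle k lt = subst (fromℤ (+ p) ∥_) (sym (×≡fromℤ (p choose suc (toℕ k)) _))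
      (∥-*ʳ _ (fromℕ-∣ (prime∣C pp (suc (toℕ k)) (ℕ.s≤s ℕ.z≤n) (ℕ.s≤s lt))))
    where
    fromℕ-∣ : ∀ {m n} → m ℕ.∣ n → fromℤ (+ m) ∥ fromℤ (+ n)
    fromℕ-∣ {m} (ℕ.divides c refl) = dividesᵍ (fromℤ (+ c)) (trans
      (cong fromℤ (trans (ℤ.pos-* c m) (ℤ.*-comm (+ c) (+ m)))) (fromℤ-* (+ m) (+ c)))

fermatℕ : ∀ {p} → Prime p → ∀ n → fromℤ (+ n) ^ᵍ p ≈ fromℤ (+ n) ⟨ fromℤ (+ p) ⟩
fermatℕ {p} pp zero    = ≈-reflexive (0^ p (ℕ.≢-nonZero⁻¹ p {{prime⇒nonZero pp}}))
  where 0^ : ∀ p → p ≢ 0 → 0ᵍ ^ᵍ p ≡ 0ᵍ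
        0^ zero    h = ⊥-elim (h refl)
        0^ (suc p) _ = 𝔾R.zeroˡ (0ᵍ ^ᵍ p)
fermatℕ {p} pp (suc n) = ≈-trans (freshman pp 1ᵍ (fromℤ (+ n))) (≈-+ (≈-reflexive (1^ᵍ p)) (fermatℕ pp n))

fermatℤ : ∀ {p} → Prime p → ∀ a → fromℤ a ^ᵍ p ≈ fromℤ a ⟨ fromℤ (+ p) ⟩
fermatℤ {p} pp a = ≈-trans (≈-^ p red) (≈-trans (fermatℕ pp (a %ℕ p)) (≈-sym red))
  where
  instance
    nz : NonZero p
    nz = prime⇒nonZero pp
  red : fromℤ a ≈ fromℤ (+ (a %ℕ p)) ⟨ fromℤ (+ p) ⟩
  red = fromℤ-mod (≡%ℕ a p)

recombine : ∀ α → fromℤ (re α) +ᵍ fromℤ (im α) *ᵍ iᵍ ≡ α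
recombine (a +i b) = cong₂ _+i_ (i₁ a b) (i₂ a b)
  where i₁ : ∀ a b → a + (b * 0ℤ - 0ℤ * 1ℤ) ≡ a
        i₁ = solve-∀
        i₂ : ∀ a b → 0ℤ + (b * 1ℤ + 0ℤ * 0ℤ) ≡ b
        i₂ = solve-∀

recombine-conj : ∀ α → fromℤ (re α) +ᵍ fromℤ (im α) *ᵍ (-ᵍ iᵍ) ≡ conj α
recombine-conj (a +i b) = cong₂ _+i_ (i₁ a b) (i₂ a b)
  where i₁ : ∀ a b → a + (b * 0ℤ - 0ℤ * - 1ℤ) ≡ a
        i₁ = solve-∀
        i₂ : ∀ a b → 0ℤ + (b * - 1ℤ + 0ℤ * 0ℤ) ≡ - b
        i₂ = solve-∀

frobenius : ∀ {p} → Prime p → ∀ α → α ^ᵍ p ≈ fromℤ (re α) +ᵍ fromℤ (im α) *ᵍ iᵍ ^ᵍ p ⟨ fromℤ (+ p) ⟩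
frobenius {p} pp α = ≈-trans (≈-reflexive (cong (_^ᵍ p) (sym (recombine α))))
  (≈-trans (freshman pp (fromℤ (re α)) (fromℤ (im α) *ᵍ iᵍ))
    (≈-+ (fermatℤ pp (re α)) (≈-trans (≈-reflexive (*ᵍ-^ᵍ (fromℤ (im α)) iᵍ p)) (≈-* (fermatℤ pp (im α)) ≈-refl))))

i^4k+ : ∀ k r → iᵍ ^ᵍ (r ℕ.+ k ℕ.* 4) ≡ iᵍ ^ᵍ r
i^4k+ k r = trans (^ᵍ-+ iᵍ r (k ℕ.* 4)) (trans (cong (iᵍ ^ᵍ r *ᵍ_)
    (trans (cong (iᵍ ^ᵍ_) (ℕ.*-comm k 4)) (trans (sym (^ᵍ-* iᵍ 4 k)) (1^ᵍ k)))) (𝔾R.*-identityʳ (iᵍ ^ᵍ r)))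

i^% : ∀ n → iᵍ ^ᵍ n ≡ iᵍ ^ᵍ (n ℕ.% 4)
i^% n = trans (cong (iᵍ ^ᵍ_) (ℕ.m≡m%n+[m/n]*n n 4)) (i^4k+ (n ℕ./ 4) (n ℕ.% 4))

frobenius₁ : ∀ {p} → Prime p → p ℕ.% 4 ≡ 1 → ∀ α → α ^ᵍ p ≈ α ⟨ fromℤ (+ p) ⟩
frobenius₁ {p} pp h α = ≈-trans (frobenius pp α) (≈-reflexive
  (trans (cong (λ z → fromℤ (re α) +ᵍ fromℤ (im α) *ᵍ z) (trans (i^% p) (cong (iᵍ ^ᵍ_) h))) (recombine α)))

frobenius₃ : ∀ {p} → Prime p → p ℕ.% 4 ≡ 3 → ∀ α → α ^ᵍ p ≈ conj α ⟨ fromℤ (+ p) ⟩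
frobenius₃ {p} pp h α = ≈-trans (frobenius pp α) (≈-reflexive
  (trans (cong (λ z → fromℤ (re α) +ᵍ fromℤ (im α) *ᵍ z) (trans (i^% p) (cong (iᵍ ^ᵍ_) h))) (recombine-conj α)))

-- For p ≡ 3 (mod 4) the p-th power is conjugation, an involution; for p ≡ 1 it is already the
-- identity.
frobenius² : ∀ {p} → Prime p → p ℕ.% 4 ≡ 1 ⊎ p ℕ.% 4 ≡ 3 → ∀ α → α ^ᵍ (p ℕ.* p) ≈ α ⟨ fromℤ (+ p) ⟩
frobenius² {p} pp (inj₁ h) α = ≈-trans (≈-reflexive (sym (^ᵍ-* α p p)))
  (≈-trans (≈-^ p (frobenius₁ pp h α)) (frobenius₁ pp h α))
frobenius² {p} pp (inj₂ h) α = ≈-trans (≈-reflexive (sym (^ᵍ-* α p p)))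
  (≈-trans (≈-^ p (frobenius₃ pp h α)) (≈-trans (frobenius₃ pp h (conj α)) (≈-reflexive (conj² α))))
  where conj² : ∀ α → conj (conj α) ≡ α
        conj² (a +i b) = cong (a +i_) (ℤ.neg-involutive b)

-- Quartic residue symbols

-- The fields `fermat` and `norm%4` replace knowledge of the residue field: they make α^((N-1)/4) a
-- fourth root of unity modulo π. Both are derived from the p-th power map rather than from a count
-- of residues.
record QPrime (π : 𝔾) : Set where
  field
    gprime : GPrime π
    odd : Oddᵍ π
    norm%4 : ∣ Nᵍ π ∣ ℕ.% 4 ≡ 1
    fermat : ∀ α → α ^ᵍ ∣ Nᵍ π ∣ ≈ α ⟨ π ⟩

Fourth : 𝔾 → Set
Fourth v = v *ᵍ v *ᵍ (v *ᵍ v) ≡ 1ᵍ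

fourth-* : ∀ {v w} → Fourth v → Fourth w → Fourth (v *ᵍ w)
fourth-* {v} {w} e f = trans (id v w) (cong₂ _*ᵍ_ e f)
  where id : ∀ v w → v *ᵍ w *ᵍ (v *ᵍ w) *ᵍ (v *ᵍ w *ᵍ (v *ᵍ w)) ≡ v *ᵍ v *ᵍ (v *ᵍ v) *ᵍ (w *ᵍ w *ᵍ (w *ᵍ w))
        id = 𝔾S.solve-∀ 𝔾-ring

-- x = α^{(N−1)/4} satisfies x⁴ ≡ 1, and x⁴ − 1 = (x−1)(x+1)(x−i)(x+i).
symbol : ∀ {π α} → QPrime π → ¬ (π ∥ α) → ∃[ v ] (QuarticPrimeIs α π v × Fourth v)
symbol {π} {α} Q ¬d = go (euclidᵍ gprime α (x⁴ -ᵍ 1ᵍ) π∥)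
  where
  open QPrime Q
  N = ∣ Nᵍ π ∣
  e = (N ℕ.∸ 1) ℕ./ 4
  N≡ : N ≡ suc (e ℕ.* 4)
  N≡ = trans N≡' (cong (λ z → suc (z ℕ.* 4)) (sym (trans (cong (λ z → (z ℕ.∸ 1) ℕ./ 4) N≡') (ℕ.m*n/n≡m (N ℕ./ 4) 4))))
    where N≡' : N ≡ suc (N ℕ./ 4 ℕ.* 4)
          N≡' = trans (ℕ.m≡m%n+[m/n]*n N 4) (cong (ℕ._+ N ℕ./ 4 ℕ.* 4) norm%4)
  x = α ^ᵍ e
  x⁴ = x ^ᵍ 4
  π∥ : π ∥ α *ᵍ (x⁴ -ᵍ 1ᵍ)
  π∥ = subst (π ∥_) (trans (cong (_-ᵍ α) (trans (cong (α ^ᵍ_) N≡) (cong (α *ᵍ_) (sym (^ᵍ-* α e 4))))) (id α x⁴))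
    (diffᵍ (fermat α))
    where id : ∀ α y → α *ᵍ y -ᵍ α ≡ α *ᵍ (y -ᵍ 1ᵍ)
          id = 𝔾S.solve-∀ 𝔾-ring
  Result = ∃[ v ] (QuarticPrimeIs α π v × Fourth v)
  at : ∀ v → Unitᵍ v → Fourth v → π ∥ x -ᵍ v → Result
  at v u f d = v , (¬d ∘ ∣ᵍ⇒∥ , u , ∥⇒∣ᵍ d) , f
  split₃ : π ∥ (x -ᵍ iᵍ) *ᵍ (x -ᵍ (-ᵍ iᵍ)) → Result
  split₃ d = [ at iᵍ refl refl , at (-ᵍ iᵍ) refl refl ]′ (euclidᵍ gprime (x -ᵍ iᵍ) (x -ᵍ (-ᵍ iᵍ)) d)
  split₂ : π ∥ (x -ᵍ (-ᵍ 1ᵍ)) *ᵍ ((x -ᵍ iᵍ) *ᵍ (x -ᵍ (-ᵍ iᵍ))) → Result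
  split₂ d = [ at (-ᵍ 1ᵍ) refl refl , split₃ ]′ (euclidᵍ gprime (x -ᵍ (-ᵍ 1ᵍ)) ((x -ᵍ iᵍ) *ᵍ (x -ᵍ (-ᵍ iᵍ))) d)
  split₁ : π ∥ (x -ᵍ 1ᵍ) *ᵍ ((x -ᵍ (-ᵍ 1ᵍ)) *ᵍ ((x -ᵍ iᵍ) *ᵍ (x -ᵍ (-ᵍ iᵍ)))) → Result
  split₁ d = [ at 1ᵍ refl refl , split₂ ]′ (euclidᵍ gprime (x -ᵍ 1ᵍ)
    ((x -ᵍ (-ᵍ 1ᵍ)) *ᵍ ((x -ᵍ iᵍ) *ᵍ (x -ᵍ (-ᵍ iᵍ)))) d)
  factor : ∀ x → x ^ᵍ 4 -ᵍ 1ᵍ ≡ (x -ᵍ 1ᵍ) *ᵍ ((x -ᵍ (-ᵍ 1ᵍ)) *ᵍ ((x -ᵍ iᵍ) *ᵍ (x -ᵍ (-ᵍ iᵍ))))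
  factor x = sym (trans (id₁ x iᵍ) (id₂ x))
    where
    id₁ : ∀ x j → (x -ᵍ 1ᵍ) *ᵍ ((x -ᵍ (-ᵍ 1ᵍ)) *ᵍ ((x -ᵍ j) *ᵍ (x -ᵍ (-ᵍ j)))) ≡ (x *ᵍ x -ᵍ 1ᵍ) *ᵍ (x *ᵍ x -ᵍ j *ᵍ j)
    id₁ = 𝔾S.solve-∀ 𝔾-ring
    id₂ : ∀ x → (x *ᵍ x -ᵍ 1ᵍ) *ᵍ (x *ᵍ x -ᵍ (-ᵍ 1ᵍ)) ≡ x *ᵍ (x *ᵍ (x *ᵍ (x *ᵍ 1ᵍ))) -ᵍ 1ᵍ
    id₂ = 𝔾S.solve-∀ 𝔾-ring
  go : π ∥ α ⊎ π ∥ x⁴ -ᵍ 1ᵍ → Result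
  go (inj₁ d) = ⊥-elim (¬d d)
  go (inj₂ d) = split₁ (subst (π ∥_) (factor x) d)

quarticList : ∀ {α} πs → All QPrime πs → All (λ π → ¬ (π ∥ α)) πs → ∃[ v ] (QuarticList α πs v × Fourth v)
quarticList []       _        _        = 1ᵍ , refl , refl
quarticList {α} (π ∷ πs) (q ∷ qs) (n ∷ ns) = go (symbol q n) (quarticList πs qs ns)
  where
  go : ∃[ v ] (QuarticPrimeIs α π v × Fourth v) → ∃[ v ] (QuarticList α πs v × Fourth v) →
    ∃[ v ] (QuarticList α (π ∷ πs) v × Fourth v)
  go (x , sx , fx) (y , sy , fy) = x *ᵍ y , (x , y , sx , sy , refl) , fourth-* {x} {y} fx fy

quarticList-++ : ∀ {α} πs σs {v w} → QuarticList α πs v → QuarticList α σs w → QuarticList α (πs ++ σs) (v *ᵍ w)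
quarticList-++ []       σs {w = w} refl ky = subst (QuarticList _ σs) (sym (𝔾R.*-identityˡ w)) ky
quarticList-++ (π ∷ πs) σs {w = w} (x , y , kx , ky , refl) kz =
  x , y *ᵍ w , kx , quarticList-++ πs σs ky kz , 𝔾R.*-assoc x y w

productᵍ-++ : ∀ πs σs → productᵍ (πs ++ σs) ≡ productᵍ πs *ᵍ productᵍ σs
productᵍ-++ []       σs = sym (𝔾R.*-identityˡ (productᵍ σs))
productᵍ-++ (π ∷ πs) σs = trans (cong (π *ᵍ_) (productᵍ-++ πs σs)) (sym (𝔾R.*-assoc π (productᵍ πs) (productᵍ σs)))

record GFactors (m : ℕ) : Set where
  field
    πs : List 𝔾
    all : All QPrime πs
    prod : fromℤ (+ m) ≡ productᵍ πs

∈⇒∥product : ∀ {π πs} → π ∈ πs → π ∥ productᵍ πs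
∈⇒∥product {πs = π ∷ πs} (here refl) = ∥-*ʳ (productᵍ πs) ∥-refl
∈⇒∥product {πs = σ ∷ πs} (there e)   = ∥-*ˡ σ (∈⇒∥product e)

∥1⇒unit : ∀ {π} → π ∥ 1ᵍ → Unitᵍ π
∥1⇒unit {π} (dividesᵍ k e) = unit (0≤N π) (∣ᵤ⇒∣ (ℕ.divides ∣ Nᵍ k ∣
    (trans (cong ∣_∣ (trans (cong Nᵍ e) (Nᵍ-* π k))) (trans (ℤ.abs-* (Nᵍ π) (Nᵍ k)) (ℕ.*-comm ∣ Nᵍ π ∣ ∣ Nᵍ k ∣)))))
  where unit : ∀ {x} → 0ℤ ≤ x → x ∣ᶻ 1ℤ → x ≡ 1ℤ
        unit {+ n} _ d = cong +_ (ℕ.∣1⇒≡1 (∣⇒∣ᵤ d))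

common-divisor-unit : ∀ {π β n} → Bz (Nᵍ β) n → π ∥ β → π ∥ fromℤ n → Unitᵍ π
common-divisor-unit {π} {β} {n} (s , t , e) dβ dn = ∥1⇒unit (subst (π ∥_) eq
    (∥-+ (∥-*ˡ (fromℤ s) (subst (π ∥_) (conj-norm β) (∥-*ʳ (conj β) dβ))) (∥-*ˡ (fromℤ t) dn)))
  where
  eq : fromℤ s *ᵍ fromℤ (Nᵍ β) +ᵍ fromℤ t *ᵍ fromℤ n ≡ 1ᵍ
  eq = trans (cong₂ _+ᵍ_ (sym (fromℤ-* s (Nᵍ β))) (sym (fromℤ-* t n))) (cong fromℤ e)

Bz⇒Coprimeᵍ : ∀ {β n} → Bz (Nᵍ β) n → Coprimeᵍ β (fromℤ n)
Bz⇒Coprimeᵍ {β} {n} bz g d d' = common-divisor-unit {g} {β} {n} bz (∣ᵍ⇒∥ d) (∣ᵍ⇒∥ d')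

-- Quartic analogue of `kronSquare`: every Gaussian prime of m is listed four times, and the fourth
-- power of its unknown symbol is 1.
quarticFourth : ∀ {β m} ws {v} → All (λ π → GPrime π × Oddᵍ π) ws → QuarticList β ws v →
  GFactors m → Bz (Nᵍ β) (+ m) → QuarticIs β (productᵍ ws *ᵍ fromℤ (+ (m ℕ.^ 4))) v
quarticFourth {β} {m} ws {v} pws kw F bz = go (quarticList πs all (All.tabulate not∣))
  where
  open GFactors F
  not∣ : ∀ {π} → π ∈ πs → ¬ (π ∥ β)
  not∣ {π} e d = proj₁ (proj₂ (QPrime.gprime (All.lookup all e)))
    (common-divisor-unit {π} {β} {+ m} bz d (subst (π ∥_) (sym prod) (∈⇒∥product e)))
  qs = πs ++ πs ++ πs ++ πs
  pqs : All (λ π → GPrime π × Oddᵍ π) πs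
  pqs = All.map (λ q → QPrime.gprime q , QPrime.odd q) all
  prod⁴ : productᵍ qs ≡ fromℤ (+ (m ℕ.^ 4))
  prod⁴ = begin
    productᵍ qs                                              ≡⟨ productᵍ-++ πs _ ⟩
    P *ᵍ productᵍ (πs ++ πs ++ πs)                           ≡⟨ cong (P *ᵍ_)
      (trans (productᵍ-++ πs _) (cong (P *ᵍ_) (productᵍ-++ πs πs))) ⟩
    P *ᵍ (P *ᵍ (P *ᵍ P))                                     ≡⟨ cong (λ z → z *ᵍ (z *ᵍ (z *ᵍ z))) prod ⟨
    fm *ᵍ (fm *ᵍ (fm *ᵍ fm))                                 ≡⟨ cong (λ z → fm *ᵍ (fm *ᵍ z)) (fm* m) ⟩
    fm *ᵍ (fm *ᵍ fromℤ (+ (m ℕ.* m)))                        ≡⟨ cong (fm *ᵍ_) (fm* (m ℕ.* m)) ⟩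
    fm *ᵍ fromℤ (+ (m ℕ.* (m ℕ.* m)))                        ≡⟨ fm* (m ℕ.* (m ℕ.* m)) ⟩
    fromℤ (+ (m ℕ.* (m ℕ.* (m ℕ.* m))))                      ≡⟨ cong (λ z → fromℤ (+ (m ℕ.* (m ℕ.* (m ℕ.* z)))))
      (ℕ.*-identityʳ m) ⟨
    fromℤ (+ (m ℕ.^ 4))                                      ∎
    where
    open ≡-Reasoning
    P = productᵍ πs
    fm = fromℤ (+ m)
    fm* : ∀ k → fm *ᵍ fromℤ (+ k) ≡ fromℤ (+ (m ℕ.* k))
    fm* k = trans (sym (fromℤ-* (+ m) (+ k))) (cong fromℤ (sym (ℤ.pos-* m k)))
  go : ∃[ w ] (QuarticList β πs w × Fourth w) → QuarticIs β (productᵍ ws *ᵍ fromℤ (+ (m ℕ.^ 4))) v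
  go (w , kq , f) = 1ᵍ , ws ++ qs , refl , All.++⁺ pws (All.++⁺ pqs (All.++⁺ pqs (All.++⁺ pqs pqs))) ,
    trans (cong (productᵍ ws *ᵍ_) (sym prod⁴)) (trans (sym (productᵍ-++ ws qs))
      (sym (𝔾R.*-identityˡ (productᵍ (ws ++ qs))))) ,
    subst (QuarticList β (ws ++ qs)) (trans (cong (v *ᵍ_) (trans (id w) f)) (𝔾R.*-identityʳ v))
      (quarticList-++ ws qs kw (quarticList-++ πs _ kq (quarticList-++ πs _ kq (quarticList-++ πs πs kq kq))))
    where id : ∀ w → w *ᵍ (w *ᵍ (w *ᵍ w)) ≡ w *ᵍ w *ᵍ (w *ᵍ w)
          id = 𝔾S.solve-∀ 𝔾-ring

-- Gaussian factorisation of odd integers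

-- Bounded by p, so that a finite search decides whether p splits. Success provides the factor a +
-- bi; failure is what makes p irreducible in `inertPrime`.
TwoSquares : ℕ → Set
TwoSquares p = ∃[ a ] ∃[ b ] (toℕ {suc p} a ℕ.* toℕ a ℕ.+ toℕ {suc p} b ℕ.* toℕ b ≡ p)

twoSquares? : ∀ p → Dec (TwoSquares p)
twoSquares? p = Fin.any? λ a → Fin.any? λ b → _ ℕ.≟ p

norm≡⇒twoSquares : ∀ {p} x → Nᵍ x ≡ + p → TwoSquares p
norm≡⇒twoSquares {p} (a +i b) e = fromℕ< a< , fromℕ< b< ,
    trans (cong₂ (λ x y → x ℕ.* x ℕ.+ y ℕ.* y) (Fin.toℕ-fromℕ< a<) (Fin.toℕ-fromℕ< b<)) e'
  where
  sq : ∀ a → a * a ≡ + (∣ a ∣ ℕ.* ∣ a ∣)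
  sq a = trans (sym (ℤ.0≤i⇒+∣i∣≡i (0≤sq a))) (cong +_ (ℤ.abs-* a a))
  e' : ∣ a ∣ ℕ.* ∣ a ∣ ℕ.+ ∣ b ∣ ℕ.* ∣ b ∣ ≡ p
  e' = ℤ.+-injective (trans (sym (cong₂ _+_ (sq a) (sq b))) e)
  m≤m² : ∀ m → m ℕ.≤ m ℕ.* m
  m≤m² zero    = ℕ.z≤n
  m≤m² (suc m) = ℕ.m≤m*n (suc m) (suc m)
  a< : ∣ a ∣ ℕ.< suc p
  a< = ℕ.s≤s (ℕ.≤-trans (m≤m² ∣ a ∣) (ℕ.≤-trans (ℕ.m≤m+n _ _) (ℕ.≤-reflexive e')))
  b< : ∣ b ∣ ℕ.< suc p
  b< = ℕ.s≤s (ℕ.≤-trans (m≤m² ∣ b ∣) (ℕ.≤-trans (ℕ.m≤n+m _ _) (ℕ.≤-reflexive e')))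

oddPrime%4 : ∀ {p} → ¬ (2 ℕ.∣ p) → p ℕ.% 4 ≡ 1 ⊎ p ℕ.% 4 ≡ 3
oddPrime%4 {p} ¬2 = go (p ℕ.% 4) refl (ℕ.m%n<n p 4)
  where
  even : ∀ r → p ℕ.% 4 ≡ r → 2 ℕ.∣ r → ⊥
  even r e d = ¬2
    (subst (2 ℕ.∣_) (sym (ℕ.m≡m%n+[m/n]*n p 4)) (ℕ.∣m∣n⇒∣m+n (subst (2 ℕ.∣_) (sym e) d)
    (ℕ.∣n⇒∣m*n (p ℕ./ 4) (ℕ.divides 2 refl))))
  go : ∀ r → p ℕ.% 4 ≡ r → r ℕ.< 4 → p ℕ.% 4 ≡ 1 ⊎ p ℕ.% 4 ≡ 3
  go 0 e _ = ⊥-elim (even 0 e (ℕ.divides 0 refl))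
  go 1 e _ = inj₁ e
  go 2 e _ = ⊥-elim (even 2 e (ℕ.divides 1 refl))
  go 3 e _ = inj₂ e
  go (suc (suc (suc (suc r)))) _ (ℕ.s≤s (ℕ.s≤s (ℕ.s≤s (ℕ.s≤s ()))))

norm-abs : ∀ x → Nᵍ x ≡ + ∣ Nᵍ x ∣
norm-abs x = sym (ℤ.0≤i⇒+∣i∣≡i (0≤N x))

abs-norm-* : ∀ x y → ∣ Nᵍ (x *ᵍ y) ∣ ≡ ∣ Nᵍ x ∣ ℕ.* ∣ Nᵍ y ∣
abs-norm-* x y = trans (cong ∣_∣ (Nᵍ-* x y)) (ℤ.abs-* (Nᵍ x) (Nᵍ y))

odd-% : ∀ {p} → p ℕ.% 4 ≡ 1 ⊎ p ℕ.% 4 ≡ 3 → p ℕ.% 2 ≡ 1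
odd-% {p} h = trans (sym (ℕ.m∣n⇒o%n%m≡o%m 2 4 p (ℕ.divides 2 refl))) ([ cong (ℕ._% 2) , cong (ℕ._% 2) ]′ h)

squares%4≢3 : ∀ (r s : Fin 4) → (+ toℕ r * + toℕ r + + toℕ s * + toℕ s) %ℕ 4 ≢ 3
squares%4≢3 = from-yes (Fin.all? {4} λ r → Fin.all? {4} λ s → ¬? ((+ toℕ r * + toℕ r + + toℕ s * + toℕ s) %ℕ 4 ℕ.≟ 3))

-- Irreducibility is inherited from the prime norm. A sum of two squares is never 3 modulo 4, so p ≡
-- 1 and `frobenius₁` applies; its congruence modulo p descends to the divisor π.
splitPrime : ∀ {p} π → Prime p → ¬ (2 ℕ.∣ p) → Nᵍ π ≡ + p → π *ᵍ conj π ≡ fromℤ (+ p) → QPrime π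
splitPrime {p} π pp ¬2 Nπ ππ̄ = record
  { gprime = (λ { refl → Primality.¬prime[0] (subst Prime (sym (ℤ.+-injective Nπ)) pp) })
           , (λ u → Primality.¬prime[1] (subst Prime (sym (ℤ.+-injective (trans (sym u) Nπ))) pp))
           , irr
  ; odd = trans (cong (_%ℕ 2) Nπ) (odd-% {p} (oddPrime%4 ¬2))
  ; norm%4 = trans (cong (ℕ._% 4) absN) p%4
  ; fermat = λ α → subst (λ N → α ^ᵍ N ≈ α ⟨ π ⟩) (sym absN) (≈-coarsen (dividesᵍ (conj π) (sym ππ̄))
    (frobenius₁ pp p%4 α)) }
  where
  absN : ∣ Nᵍ π ∣ ≡ p
  absN = cong ∣_∣ Nπ
  irr : ∀ x y → π ≡ x *ᵍ y → Unitᵍ x ⊎ Unitᵍ y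
  irr x y e = [ (λ d → inj₁ (trans (norm-abs x) (cong +_ d))) , (λ d → inj₂ (other d)) ]′
      (prime⇒irreducible pp (ℕ.divides ∣ Nᵍ y ∣ (trans p≡ (ℕ.*-comm ∣ Nᵍ x ∣ ∣ Nᵍ y ∣))))
    where
    p≡ : p ≡ ∣ Nᵍ x ∣ ℕ.* ∣ Nᵍ y ∣
    p≡ = trans (sym absN) (trans (cong (∣_∣ ∘ Nᵍ) e) (abs-norm-* x y))
    other : ∣ Nᵍ x ∣ ≡ p → Unitᵍ y
    other d = trans (norm-abs y) (cong +_ (ℕ.*-cancelˡ-≡ ∣ Nᵍ y ∣ 1 p {{prime⇒nonZero pp}}
      (trans (cong (ℕ._* ∣ Nᵍ y ∣) (sym d)) (trans (sym p≡) (sym (ℕ.*-identityʳ p))))))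
  p%4 : p ℕ.% 4 ≡ 1
  p%4 = [ (λ h → h) , (λ h → ⊥-elim (not3 h)) ]′ (oddPrime%4 ¬2)
    where
    not3 : p ℕ.% 4 ≢ 3
    not3 h = squares%4≢3 (red (re π)) (red (im π))
      (trans (mod⇒%ℕ≡ {_} {Nᵍ π} 4 (mod-sym (mod-+ (sq (re π)) (sq (im π))))) (trans (cong (_%ℕ 4) Nπ) h))
      where
      red : ℤ → Fin 4
      red a = fromℕ< (n%ℕd<d a 4)
      a≡ : ∀ a → a ≡ + toℕ (red a) [mod + 4 ]
      a≡ a = subst (λ r → a ≡ + r [mod + 4 ]) (sym (Fin.toℕ-fromℕ< (n%ℕd<d a 4))) (≡%ℕ a 4)
      sq : ∀ a → a * a ≡ + toℕ (red a) * + toℕ (red a) [mod + 4 ]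
      sq a = mod-* (a≡ a) (a≡ a)

p*p-factor : ∀ {p} → Prime p → ∀ a b → a ℕ.* b ≡ p ℕ.* p → a ≡ 1 ⊎ b ≡ 1 ⊎ a ≡ p
p*p-factor {p} pp a b e = [ left , right ]′ (euclidsLemma a b pp (subst (p ℕ.∣_) (sym e) (ℕ.m∣m*n p)))
  where
  instance
    nz : NonZero p
    nz = prime⇒nonZero pp
  left : p ℕ.∣ a → a ≡ 1 ⊎ b ≡ 1 ⊎ a ≡ p
  left (ℕ.divides c refl) = [ (λ c≡1 → inj₂ (inj₂ (trans (cong (ℕ._* p) c≡1) (ℕ.*-identityˡ p)))) ,
    (λ c≡p → inj₂ (inj₁ (b≡1 c≡p))) ]′
      (prime⇒irreducible pp (ℕ.divides b (trans (sym cb≡p) (ℕ.*-comm c b))))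
    where
    cb≡p : c ℕ.* b ≡ p
    cb≡p = ℕ.*-cancelˡ-≡ (c ℕ.* b) p p (trans (trans (sym (ℕ.*-assoc p c b)) (cong (ℕ._* b) (ℕ.*-comm p c))) e)
    b≡1 : c ≡ p → b ≡ 1
    b≡1 refl = ℕ.*-cancelˡ-≡ b 1 p (trans cb≡p (sym (ℕ.*-identityʳ p)))
  right : p ℕ.∣ b → a ≡ 1 ⊎ b ≡ 1 ⊎ a ≡ p
  right (ℕ.divides c refl) = [ inj₁ , inj₂ ∘ inj₂ ]′ (prime⇒irreducible pp
    (ℕ.divides c (trans (sym ac≡p) (ℕ.*-comm a c))))
    where
    ac≡p : a ℕ.* c ≡ p
    ac≡p = ℕ.*-cancelʳ-≡ (a ℕ.* c) p p (trans (ℕ.*-assoc a c p) e)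

-- A factorisation into nonunits would contain a factor of norm p, exhibiting p as a sum of two
-- squares. The Fermat congruence for the norm p² is `frobenius²`.
inertPrime : ∀ {p} → Prime p → ¬ (2 ℕ.∣ p) → ¬ TwoSquares p → QPrime (fromℤ (+ p))
inertPrime {p} pp ¬2 ¬sq = record
  { gprime = (λ e → Primality.¬prime[0] (subst Prime (ℤ.+-injective (cong re e)) pp))
           , (λ u → Primality.¬prime[1] (subst Prime (ℕ.m*n≡1⇒m≡1 p p (trans (sym absN) (cong ∣_∣ u))) pp))
           , irr
  ; odd = trans (cong (_%ℕ 2) N≡) (trans (ℕ.%-distribˡ-* p p 2) (cong (λ z → (z ℕ.* z) ℕ.% 2) (odd-% {p} p%4)))
  ; norm%4 = trans (cong (ℕ._% 4) absN) (trans (ℕ.%-distribˡ-* p p 4)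
    ([ cong (λ z → (z ℕ.* z) ℕ.% 4) , cong (λ z → (z ℕ.* z) ℕ.% 4) ]′ p%4))
  ; fermat = λ α → subst (λ N → α ^ᵍ N ≈ α ⟨ fromℤ (+ p) ⟩) (sym absN) (frobenius² pp p%4 α) }
  where
  p%4 = oddPrime%4 {p} ¬2
  N≡ : Nᵍ (fromℤ (+ p)) ≡ + (p ℕ.* p)
  N≡ = trans (Nᵍ-fromℤ (+ p)) (sym (ℤ.pos-* p p))
  absN : ∣ Nᵍ (fromℤ (+ p)) ∣ ≡ p ℕ.* p
  absN = cong ∣_∣ N≡
  irr : ∀ x y → fromℤ (+ p) ≡ x *ᵍ y → Unitᵍ x ⊎ Unitᵍ y
  irr x y e = cases
    (p*p-factor pp ∣ Nᵍ x ∣ ∣ Nᵍ y ∣ (trans (sym (abs-norm-* x y)) (trans (cong (∣_∣ ∘ Nᵍ) (sym e)) absN)))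
    where
    cases : ∣ Nᵍ x ∣ ≡ 1 ⊎ ∣ Nᵍ y ∣ ≡ 1 ⊎ ∣ Nᵍ x ∣ ≡ p → Unitᵍ x ⊎ Unitᵍ y
    cases (inj₁ d)        = inj₁ (trans (norm-abs x) (cong +_ d))
    cases (inj₂ (inj₁ d)) = inj₂ (trans (norm-abs y) (cong +_ d))
    cases (inj₂ (inj₂ d)) = ⊥-elim (¬sq (norm≡⇒twoSquares x (trans (norm-abs x) (cong +_ d))))

primeFactors : ∀ {p} → Prime p → ¬ (2 ℕ.∣ p) → GFactors p
primeFactors {p} pp ¬2 = go (twoSquares? p)
  where
  go : Dec (TwoSquares p) → GFactors p
  go (no ¬sq) = record { πs = fromℤ (+ p) ∷ [] ; all = inertPrime pp ¬2 ¬sq ∷ [] ; prod = sym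
    (𝔾R.*-identityʳ (fromℤ (+ p))) }
  go (yes (a , b , e)) = record { πs = π ∷ conj π ∷ []
      ; all = splitPrime π pp ¬2 Nπ ππ̄ ∷ splitPrime (conj π) pp ¬2 (trans (Nᵍ-conj π) Nπ)
        (trans (conj-norm (conj π)) (cong fromℤ (trans (Nᵍ-conj π) Nπ))) ∷ []
      ; prod = trans (sym ππ̄) (cong (π *ᵍ_) (sym (𝔾R.*-identityʳ (conj π)))) }
    where
    π = (+ toℕ a) +i (+ toℕ b)
    Nπ : Nᵍ π ≡ + p
    Nπ = trans (cong₂ _+_ (sym (ℤ.pos-* (toℕ a) (toℕ a))) (sym (ℤ.pos-* (toℕ b) (toℕ b)))) (cong +_ e)
    ππ̄ : π *ᵍ conj π ≡ fromℤ (+ p)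
    ππ̄ = trans (conj-norm π) (cong fromℤ Nπ)

gFactors : ∀ m → ¬ (2 ℕ.∣ m) → GFactors m
gFactors zero    ¬2 = ⊥-elim (¬2 (ℕ.divides 0 refl))
gFactors (suc m) ¬2 = go (factorise (suc m))
  where
  fromList : ∀ ps → All Prime ps → All (λ p → ¬ (2 ℕ.∣ p)) ps → GFactors (product ps)
  fromList []       _          _          = record { πs = [] ; all = [] ; prod = refl }
  fromList (p ∷ ps) (pp ∷ pps) (np ∷ nps) = record
      { πs = GFactors.πs F ++ GFactors.πs G ; all = All.++⁺ (GFactors.all F) (GFactors.all G)
      ; prod = trans (trans (cong fromℤ (ℤ.pos-* p (product ps))) (fromℤ-* (+ p) (+ product ps)))
          (trans (cong₂ _*ᵍ_ (GFactors.prod F) (GFactors.prod G)) (sym (productᵍ-++ (GFactors.πs F) (GFactors.πs G))))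
            }
    where F = primeFactors pp np
          G = fromList ps pps nps
  go : PrimeFactorisation (suc m) → GFactors (suc m)
  go record { factors = ps ; isFactorisation = e ; factorsPrime = pps } = subst GFactors (sym e)
    (fromList ps pps (All.tabulate (λ p∈ d → ¬2 (subst (2 ℕ.∣_) (sym e) (ℕ.∣-trans d (∈⇒∣product p∈))))))

-- The lattice of a circle

module Pullback (a₁ a₂ b₁ b₂ c₁ c₂ d₁ d₂ : ℤ) where

  -- The Hermitian form b|ξ|² − Re(w̄ ξ η̄) + e|η|² of the circle (4e, b, w),
  -- evaluated at the columns (α, β), (γ, δ), and its polarisation K₁ + i K₂.
  P Q K₁ K₂ : ℤ → ℤ → ℤ → ℤ → ℤ
  P b e w₁ w₂ = b * (a₁ * a₁ + a₂ * a₂) + e * (b₁ * b₁ + b₂ * b₂) -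
    (w₁ * (a₁ * b₁ + a₂ * b₂) + w₂ * (a₂ * b₁ - a₁ * b₂))
  Q b e w₁ w₂ = b * (c₁ * c₁ + c₂ * c₂) + e * (d₁ * d₁ + d₂ * d₂) -
    (w₁ * (c₁ * d₁ + c₂ * d₂) + w₂ * (c₂ * d₁ - c₁ * d₂))
  K₁ b e w₁ w₂ = + 2 * b * (a₁ * c₁ + a₂ * c₂) + + 2 * e * (b₁ * d₁ + b₂ * d₂)
    - (w₁ * (a₁ * d₁ + a₂ * d₂) + w₂ * (a₂ * d₁ - a₁ * d₂) + w₁ * (c₁ * b₁ + c₂ * b₂) + w₂ * (c₂ * b₁ - c₁ * b₂))
  K₂ b e w₁ w₂ = + 2 * b * (a₂ * c₁ - a₁ * c₂) + + 2 * e * (b₂ * d₁ - b₁ * d₂)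
    - (w₁ * (a₂ * d₁ - a₁ * d₂) - w₂ * (a₁ * d₁ + a₂ * d₂) - w₁ * (c₂ * b₁ - c₁ * b₂) + w₂ * (c₁ * b₁ + c₂ * b₂))

  det₁ det₂ : ℤ
  det₁ = a₁ * d₁ - a₂ * d₂ - (c₁ * b₁ - c₂ * b₂)
  det₂ = a₁ * d₂ + a₂ * d₁ - (c₁ * b₂ + c₂ * b₁)

-- These identities spell out P, Q, K₁, K₂, since the solver treats defined
-- names as atoms.
curvature-identity : ∀ a₁ a₂ b₁ b₂ c₁ c₂ d₁ d₂ b e w₁ w₂ →
  let p = b * (a₁ * a₁ + a₂ * a₂) + e * (b₁ * b₁ + b₂ * b₂) - (w₁ * (a₁ * b₁ + a₂ * b₂) + w₂ * (a₂ * b₁ - a₁ * b₂))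
      q = b * (c₁ * c₁ + c₂ * c₂) + e * (d₁ * d₁ + d₂ * d₂) - (w₁ * (c₁ * d₁ + c₂ * d₂) + w₂ * (c₂ * d₁ - c₁ * d₂))
      k₁ = + 2 * b * (a₁ * c₁ + a₂ * c₂) + + 2 * e * (b₁ * d₁ + b₂ * d₂)
        - (w₁ * (a₁ * d₁ + a₂ * d₂) + w₂ * (a₂ * d₁ - a₁ * d₂) + w₁ * (c₁ * b₁ + c₂ * b₂) + w₂ * (c₂ * b₁ - c₁ * b₂))
      k₂ = + 2 * b * (a₂ * c₁ - a₁ * c₂) + + 2 * e * (b₂ * d₁ - b₁ * d₂)
        - (w₁ * (a₂ * d₁ - a₁ * d₂) - w₂ * (a₁ * d₁ + a₂ * d₂) - w₁ * (c₂ * b₁ - c₁ * b₂) + w₂ * (c₁ * b₁ + c₂ * b₂))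
      r = a₁ * d₁ - a₂ * d₂ - (c₁ * b₁ - c₂ * b₂)
      s = a₁ * d₂ + a₂ * d₁ - (c₁ * b₂ + c₂ * b₁)
  in b * (r * r + s * s) ≡ p * (d₁ * d₁ + d₂ * d₂) + q * (b₁ * b₁ + b₂ * b₂)
     - ((d₁ * b₁ + d₂ * b₂) * k₁ - (d₂ * b₁ - d₁ * b₂) * k₂)
curvature-identity = solve-∀

-- The determinant of a Hermitian form is multiplied by |det M|² under pullback; this is the
-- polarised version. For co-curvatures 4e and 4e' the last factor is half of `form2`.
polar-identity : ∀ a₁ a₂ b₁ b₂ c₁ c₂ d₁ d₂ b e w₁ w₂ b' e' w₁' w₂' →
  let p = b * (a₁ * a₁ + a₂ * a₂) + e * (b₁ * b₁ + b₂ * b₂) - (w₁ * (a₁ * b₁ + a₂ * b₂) + w₂ * (a₂ * b₁ - a₁ * b₂))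
      q = b * (c₁ * c₁ + c₂ * c₂) + e * (d₁ * d₁ + d₂ * d₂) - (w₁ * (c₁ * d₁ + c₂ * d₂) + w₂ * (c₂ * d₁ - c₁ * d₂))
      k₁ = + 2 * b * (a₁ * c₁ + a₂ * c₂) + + 2 * e * (b₁ * d₁ + b₂ * d₂)
        - (w₁ * (a₁ * d₁ + a₂ * d₂) + w₂ * (a₂ * d₁ - a₁ * d₂) + w₁ * (c₁ * b₁ + c₂ * b₂) + w₂ * (c₂ * b₁ - c₁ * b₂))
      k₂ = + 2 * b * (a₂ * c₁ - a₁ * c₂) + + 2 * e * (b₂ * d₁ - b₁ * d₂)
        - (w₁ * (a₂ * d₁ - a₁ * d₂) - w₂ * (a₁ * d₁ + a₂ * d₂) - w₁ * (c₂ * b₁ - c₁ * b₂) + w₂ * (c₁ * b₁ + c₂ * b₂))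
      p' = b' * (a₁ * a₁ + a₂ * a₂) + e' * (b₁ * b₁ + b₂ * b₂) - (w₁' * (a₁ * b₁ + a₂ * b₂) + w₂' *
        (a₂ * b₁ - a₁ * b₂))
      q' = b' * (c₁ * c₁ + c₂ * c₂) + e' * (d₁ * d₁ + d₂ * d₂) - (w₁' * (c₁ * d₁ + c₂ * d₂) + w₂' *
        (c₂ * d₁ - c₁ * d₂))
      k₁' = + 2 * b' * (a₁ * c₁ + a₂ * c₂) + + 2 * e' * (b₁ * d₁ + b₂ * d₂)
        - (w₁' * (a₁ * d₁ + a₂ * d₂) + w₂' * (a₂ * d₁ - a₁ * d₂) + w₁' * (c₁ * b₁ + c₂ * b₂) + w₂' *
          (c₂ * b₁ - c₁ * b₂))
      k₂' = + 2 * b' * (a₂ * c₁ - a₁ * c₂) + + 2 * e' * (b₂ * d₁ - b₁ * d₂)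
        - (w₁' * (a₂ * d₁ - a₁ * d₂) - w₂' * (a₁ * d₁ + a₂ * d₂) - w₁' * (c₂ * b₁ - c₁ * b₂) + w₂' *
          (c₁ * b₁ + c₂ * b₂))
      r = a₁ * d₁ - a₂ * d₂ - (c₁ * b₁ - c₂ * b₂)
      s = a₁ * d₂ + a₂ * d₁ - (c₁ * b₂ + c₂ * b₁)
  in k₁ * k₁' + k₂ * k₂' - + 2 * (p * q' + q * p') ≡ (r * r + s * s) * (w₁ * w₁' + w₂ * w₂' - + 2 * (b * e' + e * b'))
polar-identity = solve-∀

-- C_M pulls back to the real line, and pairing a Hermitian form with the real line sees only the
-- imaginary part of its off-diagonal entry, K₂.
tangency-identity : ∀ a₁ a₂ b₁ b₂ c₁ c₂ d₁ d₂ b e w₁ w₂ →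
  let k₂ = + 2 * b * (a₂ * c₁ - a₁ * c₂) + + 2 * e * (b₂ * d₁ - b₁ * d₂)
           - (w₁ * (a₂ * d₁ - a₁ * d₂) - w₂ * (a₁ * d₁ + a₂ * d₂) - w₁ * (c₂ * b₁ - c₁ * b₂) + w₂ *
             (c₁ * b₁ + c₂ * b₂))
      z₁ = (c₁ * b₁ - c₂ * - b₂) + - (a₁ * d₁ - a₂ * - d₂)
      z₂ = (c₁ * - b₂ + c₂ * b₁) + - (a₁ * - d₂ + a₂ * d₁)
  in - ((+ 4 * (a₁ * - c₂ + a₂ * c₁)) * b + (b₁ * - d₂ + b₂ * d₁) * (+ 4 * e))
     + (+ 2) * ((0ℤ * z₁ - 1ℤ * z₂) * w₁ + (0ℤ * z₂ + 1ℤ * z₁) * w₂) ≡ - (+ 2 * k₂)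
tangency-identity = solve-∀

-- Makes the norm form of Λ primitive relative to n: a prime dividing its three coefficients and n
-- would divide |det M|² = 1.
unimodular-identity : ∀ a₁ a₂ b₁ b₂ c₁ c₂ d₁ d₂ →
  let r = a₁ * d₁ - a₂ * d₂ - (c₁ * b₁ - c₂ * b₂)
      s = a₁ * d₂ + a₂ * d₁ - (c₁ * b₂ + c₂ * b₁)
  in (a₁ * a₁ + a₂ * a₂) * (d₁ * d₁ + d₂ * d₂) + (c₁ * c₁ + c₂ * c₂) * (b₁ * b₁ + b₂ * b₂)
     - (a₁ * c₁ + a₂ * c₂) * (+ 2 * (d₁ * b₁ + d₂ * b₂)) - + 2 * (a₂ * c₁ - a₁ * c₂) * (b₁ * - d₂ + b₂ * d₁)
       ≡ r * r + s * s
unimodular-identity = solve-∀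

-- Supplies the integer e of the Hermitian form; the 4 stems from the factor 2 in z ↦
-- 2(αz+γ)/(βz+δ).
cobar-div4 : ∀ {M v} → Represents M v → ∃[ e ] cobar v ≡ + 4 * e
cobar-div4 {M} {v} (inj₁ refl) = im (α M *ᵍ conj (γ M)) , refl
cobar-div4 {M} {v} (inj₂ eq) = - im (α M *ᵍ conj (γ M)) ,
  trans (id (cobar v)) (trans (cong -_ (sym (cong cobar eq))) (ℤ.neg-distribʳ-* (+ 4) (im (α M *ᵍ conj (γ M)))))
  where id : ∀ z → z ≡ - (- 1ℤ * z)
        id = solve-∀

square-even : ∀ z → + 2 ∣ᶻ z * z → + 2 ∣ᶻ z
square-even z d = reduce (euclidℤ Primality.prime[2] z z d)

nonneg-factor : ∀ {a b} → 0ℤ < b → 0ℤ ≤ a * b → 0ℤ ≤ a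
nonneg-factor {a} {b} b>0 h = ℤ.*-cancelʳ-≤-pos 0ℤ a b {{ℤ.positive b>0}} (subst (_≤ a * b) (sym (ℤ.*-zeroˡ b)) h)

-- Let d = gcd(q, x). Since s p + t q = 1, q = s x² + t q² is divisible by d²; conversely d is a
-- combination of q and x, and q divides x², so q divides d². Nonnegativity settles the sign.
coprime-square : ∀ {p q x} → 0ℤ ≤ q → Bz p q → p * q ≡ x * x → ∃[ t ] q ≡ t * t
coprime-square {p} {q} {x} 0≤q (s , t , st) pq = go (Bézout.lemma ∣ q ∣ ∣ x ∣)
  where
  go : Bézout.Lemma ∣ q ∣ ∣ x ∣ → ∃[ t ] q ≡ t * t
  go (Bézout.result d gcd ident) = + d , eq 0≤q
    where
    comb = bézoutℤ ident
    u = proj₁ comb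
    v = proj₁ (proj₂ comb)
    uv : u * + ∣ q ∣ + v * + ∣ x ∣ ≡ + d
    uv = proj₂ (proj₂ comb)
    d∣q : + d ∣ᶻ q
    d∣q = ∣ᵤ⇒∣ (proj₁ (GCD.commonDivisor gcd))
    d∣x : + d ∣ᶻ x
    d∣x = ∣ᵤ⇒∣ (proj₂ (GCD.commonDivisor gcd))
    d²∣q : + d * + d ∣ᶻ q
    d²∣q = subst (+ d * + d ∣ᶻ_) (trans (cong (λ z → s * z + t * (q * q)) (sym pq))
      (trans (id s t p q) (trans (cong (_* q) st) (ℤ.*-identityˡ q))))
        (∣m∣n⇒∣m+n (∣n⇒∣m*n s (sq∣ d∣x)) (∣n⇒∣m*n t (sq∣ d∣q)))
      where
      id : ∀ s t p q → s * (p * q) + t * (q * q) ≡ (s * p + t * q) * q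
      id = solve-∀
      sq∣ : ∀ {a b} → a ∣ᶻ b → a * a ∣ᶻ b * b
      sq∣ {a} (divides k refl) = divides (k * k) (id' k a)
        where id' : ∀ k a → (k * a) * (k * a) ≡ (k * k) * (a * a)
              id' = solve-∀
    q∣d² : q ∣ᶻ + d * + d
    q∣d² = subst (λ z → q ∣ᶻ z * z) uv (subst (q ∣ᶻ_) (sym (id u v (+ ∣ q ∣) (+ ∣ x ∣)))
        (∣m∣n⇒∣m+n (∣m⇒∣m*n _ Signed.m∣∣m∣) (∣n⇒∣m*n (v * v) q∣x²)))
      where
      id : ∀ u v q x → (u * q + v * x) * (u * q + v * x) ≡ q * (u * u * q + + 2 * (u * v * x)) + v * v * (x * x)
      id = solve-∀
      abs² : ∀ x → + ∣ x ∣ * + ∣ x ∣ ≡ x * x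
      abs² x = trans (sym (ℤ.pos-* ∣ x ∣ ∣ x ∣)) (trans (cong +_ (sym (ℤ.abs-* x x))) (ℤ.0≤i⇒+∣i∣≡i (0≤sq x)))
      q∣x² : q ∣ᶻ + ∣ x ∣ * + ∣ x ∣
      q∣x² = subst (q ∣ᶻ_) (trans pq (sym (abs² x))) (∣n⇒∣m*n p ∣-refl)
    abs-eq : ∣ q ∣ ≡ ∣ + d * + d ∣
    abs-eq = ℕ.∣-antisym (∣⇒∣ᵤ q∣d²) (∣⇒∣ᵤ d²∣q)
    eq : 0ℤ ≤ q → q ≡ + d * + d
    eq 0≤q = trans (sym (ℤ.0≤i⇒+∣i∣≡i 0≤q)) (trans (cong +_ abs-eq) (ℤ.0≤i⇒+∣i∣≡i (0≤sq (+ d))))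

module Lattice (M : SL2) {v : Circle} (rep : Represents M v) where

  a₁ = re (α M)
  a₂ = im (α M)
  b₁ = re (β M)
  b₂ = im (β M)
  c₁ = re (γ M)
  c₂ = im (γ M)
  d₁ = re (δ M)
  d₂ = im (δ M)
  open Pullback a₁ a₂ b₁ b₂ c₁ c₂ d₁ d₂ public

  n I R Nβ Nδ : ℤ
  n = curv v
  I = b₁ * - d₂ + b₂ * d₁
  R = d₁ * b₁ + d₂ * b₂
  Nβ = b₁ * b₁ + b₂ * b₂
  Nδ = d₁ * d₁ + d₂ * d₂

  detN : det₁ * det₁ + det₂ * det₂ ≡ 1ℤ
  detN = cong₂ (λ x y → x * x + y * y) (cong re (det1 M)) (cong im (det1 M))

  -- `Represents` forgets the orientation; σ = ±1 records it and disappears again through σ² = 1.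
  orientation : ∃[ σ ] (σ * σ ≡ 1ℤ × I ≡ σ * n × (∀ v' → form2 (accOf M) v' ≡ σ * form2 v v'))
  orientation = go rep
    where
    go : Represents M v → _
    go (inj₁ e) = 1ℤ , refl , trans (cong curv e) (sym (ℤ.*-identityˡ n)) , λ v' → trans (cong (λ z → form2 z v') e)
      (sym (ℤ.*-identityˡ _))
    go (inj₂ e) = - 1ℤ , refl , cong curv e , λ v' → trans (cong (λ z → form2 z v') e) (form2-⊙ˡ (- 1ℤ) v v')

  σ = proj₁ orientation
  σσ : σ * σ ≡ 1ℤ
  σσ = proj₁ (proj₂ orientation)
  I≡σn : I ≡ σ * n
  I≡σn = proj₁ (proj₂ (proj₂ orientation))

  lam : ℤ → ℤ → 𝔾
  lam x y = fromℤ x *ᵍ β M +ᵍ fromℤ y *ᵍ δ M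

  lam-norm : ∀ x y → Nᵍ (lam x y) ≡ Nβ * (x * x) + (+ 2 * R) * (x * y) + Nδ * (y * y)
  lam-norm x y = id b₁ b₂ d₁ d₂ x y
    where
    id : ∀ b₁ b₂ d₁ d₂ x y →
      let r = (x * b₁ - 0ℤ * b₂) + (y * d₁ - 0ℤ * d₂)
          s = (x * b₂ + 0ℤ * b₁) + (y * d₂ + 0ℤ * d₁)
      in r * r + s * s ≡ (b₁ * b₁ + b₂ * b₂) * (x * x) + (+ 2 * (d₁ * b₁ + d₂ * b₂)) * (x * y) + (d₁ * d₁ + d₂ * d₂) *
        (y * y)
    id = solve-∀

  -- |λ μ̄|² = |λ|²|μ|², and the imaginary part of λ μ̄ is a multiple of n.
  lam-norms : ∀ x y z w → Nᵍ (lam x y) * Nᵍ (lam z w) ≡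
    (Nβ * (x * z) + R * (x * w + y * z) + Nδ * (y * w)) * (Nβ * (x * z) + R * (x * w + y * z) + Nδ * (y * w))
      + n * n * ((x * w - y * z) * (x * w - y * z))
  lam-norms x y z w = trans (cong₂ _*_ (lam-norm x y) (lam-norm z w)) (trans (id b₁ b₂ d₁ d₂ x y z w)
      (cong (λ k → A * A + k * (B * B)) (trans (cong₂ _*_ I≡σn I≡σn)
        (trans (id' σ n) (trans (cong (_* (n * n)) σσ) (ℤ.*-identityˡ (n * n)))))))
    where
    A = Nβ * (x * z) + R * (x * w + y * z) + Nδ * (y * w)
    B = x * w - y * z
    id : ∀ b₁ b₂ d₁ d₂ x y z w →
      let N = b₁ * b₁ + b₂ * b₂
          R = d₁ * b₁ + d₂ * b₂
          N' = d₁ * d₁ + d₂ * d₂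
          I = b₁ * - d₂ + b₂ * d₁
      in (N * (x * x) + (+ 2 * R) * (x * y) + N' * (y * y)) * (N * (z * z) + (+ 2 * R) * (z * w) + N' * (w * w))
         ≡ (N * (x * z) + R * (x * w + y * z) + N' * (y * w)) * (N * (x * z) + R * (x * w + y * z) + N' * (y * w))
           + I * I * ((x * w - y * z) * (x * w - y * z))
    id = solve-∀
    id' : ∀ σ n → (σ * n) * (σ * n) ≡ (σ * σ) * (n * n)
    id' = solve-∀

  no-common-prime : ∀ p → Prime p → + p ∣ᶻ Nβ → + p ∣ᶻ + 2 * R → + p ∣ᶻ Nδ → + p ∣ᶻ n → ⊥
  no-common-prime p pp dβ dR dδ dn = prime∤1 pp
    (subst (+ p ∣ᶻ_) (trans (unimodular-identity a₁ a₂ b₁ b₂ c₁ c₂ d₁ d₂) detN)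
    (∣m∣n⇒∣m-n (∣m∣n⇒∣m-n (∣m∣n⇒∣m+n (∣n⇒∣m*n (a₁ * a₁ + a₂ * a₂) dδ) (∣n⇒∣m*n (c₁ * c₁ + c₂ * c₂) dβ))
      (∣n⇒∣m*n (a₁ * c₁ + a₂ * c₂) dR)) (∣n⇒∣m*n (+ 2 * (a₂ * c₁ - a₁ * c₂))
        (subst (+ p ∣ᶻ_) (sym I≡σn) (∣n⇒∣m*n σ dn)))))

  coprimeNorm : n ≢ 0ℤ → ∃[ x ] ∃[ y ] Bz (Nᵍ (lam x y)) n
  coprimeNorm n≢0 = let x , y , _ , bz = coprimeValue Nβ (+ 2 * R) Nδ n no-common-prime n≢0 in
    x , y , subst (λ z → Bz z n) (sym (lam-norm x y)) bz

  -- The circle v' seen from M, where 𝒞 is the real line: tangency becomes k₂ = σ, and the real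
  -- quadratic form (p, k₁, q) has discriminant 0, its double root being the point of tangency.
  module Neighbour {v' : Circle} (c : IsCircle v') (tang : form2 v v' ≡ - (+ 2)) (e : ℤ)
    (cob : cobar v' ≡ + 4 * e) where
    b = curv v'
    p = P b e (wx v') (wy v')
    q = Q b e (wx v') (wy v')
    k₁ = K₁ b e (wx v') (wy v')
    k₂ = K₂ b e (wx v') (wy v')

    k₂≡σ : k₂ ≡ σ
    k₂≡σ = ℤ.i-j≡0⇒i≡j k₂ σ (*-cancel-0 (+ 2) (λ ()) (trans (id k₂ σ) (ℤ.i≡j⇒i-j≡0 (sym eq))))
      where
      eq : - (+ 2 * k₂) ≡ σ * - (+ 2)
      eq = trans (sym (tangency-identity a₁ a₂ b₁ b₂ c₁ c₂ d₁ d₂ b e (wx v') (wy v')))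
        (trans (cong (λ z → form2 (accOf M) (circ z b (wx v') (wy v'))) (sym cob))
          (trans (proj₂ (proj₂ (proj₂ orientation)) v') (cong (σ *_) tang)))
      id : ∀ k σ → + 2 * (k - σ) ≡ σ * - (+ 2) - - (+ 2 * k)
      id = solve-∀

    -- `polar-identity` of v' with itself: half of `form2` is 1 and k₂² = 1, so k₁² + 1 - 4pq = 1.
    k₁²≡4pq : k₁ * k₁ ≡ + 4 * (p * q)
    k₁²≡4pq = ℤ.i-j≡0⇒i≡j _ _ (trans (id k₁ k₂ p q) (trans (cong₂ _-_ polar (trans (cong₂ _*_ k₂≡σ k₂≡σ) σσ))
        (trans (cong (_- 1ℤ) (trans (cong (_* W) detN) (ℤ.*-identityˡ W)))
          (*-cancel-0 (+ 2) (λ ()) (trans (id' b e (wx v') (wy v')) (trans (cong (λ z →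
          (- (z * b + b * z) + + 2 * (wx v' * wx v' + wy v' * wy v')) - + 2) (sym cob)) (ℤ.i≡j⇒i-j≡0 c)))))))
      where
      W = wx v' * wx v' + wy v' * wy v' - + 2 * (b * e + e * b)
      polar = polar-identity a₁ a₂ b₁ b₂ c₁ c₂ d₁ d₂ b e (wx v') (wy v') b e (wx v') (wy v')
      id : ∀ k₁ k₂ p q → k₁ * k₁ - + 4 * (p * q) ≡ (k₁ * k₁ + k₂ * k₂ - + 2 * (p * q + q * p)) - k₂ * k₂
      id = solve-∀
      id' : ∀ b e x y → + 2 * (x * x + y * y - + 2 * (b * e + e * b) - 1ℤ) ≡
        (- ((+ 4 * e) * b + b * (+ 4 * e)) + + 2 * (x * x + y * y)) - + 2
      id' = solve-∀

    k₁-even : + 2 ∣ᶻ k₁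
    k₁-even = square-even k₁ (divides (+ 2 * (p * q)) (trans k₁²≡4pq (id (p * q))))
      where id : ∀ z → + 4 * z ≡ + 2 * z * + 2
            id = solve-∀

    x = Signed._∣_.quotient k₁-even
    k₁≡ : k₁ ≡ x * + 2
    k₁≡ = Signed._∣_.equality k₁-even

    pq≡x² : p * q ≡ x * x
    pq≡x² = ℤ.i-j≡0⇒i≡j _ _
      (*-cancel-0 (+ 4) (λ ()) (trans (id (p * q) x) (trans (cong (λ z → + 4 * (p * q) - z * z) (sym k₁≡))
      (ℤ.i≡j⇒i-j≡0 (sym k₁²≡4pq)))))
      where id : ∀ z x → + 4 * (z - x * x) ≡ + 4 * z - (x * + 2) * (x * + 2)
            id = solve-∀

    -- This is `curvature-identity` with k₁ = 2x. Its K₂ term is the product of -σn and σ, namely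
    -- -n, which explains why b + n appears; it is the coefficient f(1,0) of the form of the circle.
    value : b + n ≡ p * Nδ + q * Nβ - + 2 * (x * R)
    value = trans
      (cong (_+ n) (trans (sym (ℤ.*-identityʳ b)) (trans (cong (b *_) (sym detN))
      (curvature-identity a₁ a₂ b₁ b₂ c₁ c₂ d₁ d₂ b e (wx v') (wy v')))))
      (trans (cong₂ (λ y z → p * Nδ + q * Nβ - (R * y - (d₂ * b₁ - d₁ * b₂) * z) + n) k₁≡ k₂≡σ)
        (trans (id p q Nδ Nβ R x σ n (d₂ * b₁ - d₁ * b₂)) (trans (cong (λ z → p * Nδ + q * Nβ - + 2 * (x * R) + z) J)
          (ℤ.+-identityʳ _))))
      where
      id : ∀ p q N N' R x σ n j → p * N + q * N' - (R * (x * + 2) - j * σ) + n ≡ p * N + q * N' - + 2 * (x * R) +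
        (j * σ + n)
      id = solve-∀
      J : (d₂ * b₁ - d₁ * b₂) * σ + n ≡ 0ℤ
      J = trans (id' b₁ b₂ d₁ d₂ σ n) (trans (cong (λ z → n - z * σ) I≡σn)
        (trans (id″ σ n) (trans (cong (λ z → n - z * n) σσ) (id‴ n))))
        where
        id' : ∀ b₁ b₂ d₁ d₂ σ n → (d₂ * b₁ - d₁ * b₂) * σ + n ≡ n - (b₁ * - d₂ + b₂ * d₁) * σ
        id' = solve-∀
        id″ : ∀ σ n → n - (σ * n) * σ ≡ n - (σ * σ) * n
        id″ = solve-∀
        id‴ : ∀ n → n - 1ℤ * n ≡ 0ℤ
        id‴ = solve-∀

    -- Multiplying `value` by q and using pq = x² completes the norm of -qβ + xδ. The twin `p-norm`
    -- is there for the case in which q is divisible by the prime considered.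
    q-norm : q * (b + n) ≡ Nᵍ (lam (- q) x)
    q-norm = trans (cong (q *_) value)
      (trans (id p q Nδ Nβ x R) (trans (cong (λ z → z * Nδ + q * q * Nβ - + 2 * (q * (x * R))) pq≡x²)
        (trans (id' q Nδ Nβ x R) (sym (lam-norm (- q) x)))))
      where
      id : ∀ p q N N' x R → q * (p * N + q * N' - + 2 * (x * R)) ≡ (p * q) * N + q * q * N' - + 2 * (q * (x * R))
      id = solve-∀
      id' : ∀ q N N' x R → x * x * N + q * q * N' - + 2 * (q * (x * R)) ≡ N' * (- q * - q) + (+ 2 * R) *
        (- q * x) + N * (x * x)
      id' = solve-∀

    p-norm : p * (b + n) ≡ Nᵍ (lam (- x) p)
    p-norm = trans (cong (p *_) value)
      (trans (id p q Nδ Nβ x R) (trans (cong (λ z → p * p * Nδ + z * Nβ - + 2 * (p * (x * R))) pq≡x²)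
        (trans (id' p Nδ Nβ x R) (sym (lam-norm (- x) p)))))
      where
      id : ∀ p q N N' x R → p * (p * N + q * N' - + 2 * (x * R)) ≡ p * p * N + (p * q) * N' - + 2 * (p * (x * R))
      id = solve-∀
      id' : ∀ p N N' x R → p * p * N + x * x * N' - + 2 * (p * (x * R)) ≡ N' * (- x * - x) + (+ 2 * R) *
        (- x * p) + N * (p * p)
      id' = solve-∀

  module TwoNeighbours
    {v' : Circle} (c : IsCircle v') (tang : form2 v v' ≡ - (+ 2)) (e : ℤ) (cob : cobar v' ≡ + 4 * e)
    {v″ : Circle} (c″ : IsCircle v″) (tang″ : form2 v v″ ≡ - (+ 2)) (e″ : ℤ) (cob″ : cobar v″ ≡ + 4 * e″)
    (tang' : form2 v' v″ ≡ - (+ 2)) where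
    open Neighbour {v'} c tang e cob public
    private module Z = Neighbour {v″} c″ tang″ e″ cob″

    -- Tangency of the two neighbours with each other: `polar-identity` has right-hand side -1 and
    -- k₂ k₂″ = 1. This second neighbour is what forces p and q to be coprime.
    cross : p * Z.q + q * Z.p - + 2 * (x * Z.x) ≡ 1ℤ
    cross = ℤ.i-j≡0⇒i≡j _ _ (*-cancel-0 (+ 2) (λ ()) (trans (id p q x Z.p Z.q Z.x)
        (trans (cong₂ (λ y z → 1ℤ - (y * z - + 2 * (p * Z.q + q * Z.p)) - + 3) (sym k₁≡) (sym Z.k₁≡))
          (trans (cong (λ z → z - (k₁ * Z.k₁ - + 2 * (p * Z.q + q * Z.p)) - + 3)
            (sym (trans (cong₂ _*_ k₂≡σ Z.k₂≡σ) σσ)))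
            (trans (id₂ k₁ Z.k₁ k₂ Z.k₂ (p * Z.q + q * Z.p)) (trans
              (cong₂ (λ y z → + 2 * y - z - + 3) (trans (cong₂ _*_ k₂≡σ Z.k₂≡σ) σσ)
              (trans polar (trans (cong (_* W) detN) (ℤ.*-identityˡ W)))) W≡))))))
      where
      W = wx v' * wx v″ + wy v' * wy v″ - + 2 * (b * e″ + e * Z.b)
      polar = polar-identity a₁ a₂ b₁ b₂ c₁ c₂ d₁ d₂ b e (wx v') (wy v') Z.b e″ (wx v″) (wy v″)
      id : ∀ p q x p' q' x' → + 2 * (p * q' + q * p' - + 2 * (x * x') - 1ℤ) ≡ 1ℤ -
        ((x * + 2) * (x' * + 2) - + 2 * (p * q' + q * p')) - + 3
      id = solve-∀
      id₂ : ∀ k k' l l' z → l * l' - (k * k' - + 2 * z) - + 3 ≡ + 2 * (l * l') - (k * k' + l * l' - + 2 * z) - + 3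
      id₂ = solve-∀
      W≡ : + 2 * 1ℤ - W - + 3 ≡ 0ℤ
      W≡ = *-cancel-0 (+ 2) (λ ()) (trans (id₃ b e (wx v') (wy v') Z.b e″ (wx v″) (wy v″))
        (trans (cong₂ (λ y z → - (- (y * Z.b + b * z) + + 2 * (wx v' * wx v″ + wy v' * wy v″)) - + 2) (sym cob)
          (sym cob″)) (cong (λ z → - z - + 2) tang')))
        where id₃ : ∀ b e x y b' e' x' y' → + 2 * (+ 2 * 1ℤ - (x * x' + y * y' - + 2 * (b * e' + e * b')) - + 3)
                    ≡ - (- ((+ 4 * e) * b' + b * (+ 4 * e')) + + 2 * (x * x' + y * y')) - + 2
              id₃ = solve-∀

    -- Squaring p q″ + q p″ − 1 = 2 x x″ and using x² = p q.
    p⊥q : Bz p q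
    p⊥q = + 4 * (q * (Z.x * Z.x)) - T * Z.q + + 2 * Z.q , - T * Z.p + + 2 * Z.p ,
      trans (id p q Z.p Z.q Z.x) (trans (cong (λ z → + 4 * (z * (Z.x * Z.x)) - T * T + + 2 * T) pq≡x²)
        (trans (id' x Z.x T)
          (trans (cong (λ z → 1ℤ + (T - z - + 2 * (x * Z.x)) * (- (T - z) - + 2 * (x * Z.x))) (sym cross))
          (id″ T (+ 2 * (x * Z.x))))))
      where
      T = p * Z.q + q * Z.p
      id : ∀ p q p' q' x' → let T = p * q' + q * p' in
        (+ 4 * (q * (x' * x')) - T * q' + + 2 * q') * p + (- T * p' + + 2 * p') * q ≡ + 4 *
          ((p * q) * (x' * x')) - T * T + + 2 * T
      id = solve-∀
      id' : ∀ x x' T → + 4 * ((x * x) * (x' * x')) - T * T + + 2 * T ≡ 1ℤ + (T - 1ℤ - + 2 * (x * x')) *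
        (- (T - 1ℤ) - + 2 * (x * x'))
      id' = solve-∀
      id″ : ∀ T y → 1ℤ + (T - (T - y) - y) * (- (T - (T - y)) - y) ≡ 1ℤ
      id″ = solve-∀

    module _ (positive : 0ℤ < b + n) where

      private
        q-square : ∃[ t ] q ≡ t * t
        q-square = coprime-square {p} {q} {x} (nonneg-factor positive
          (subst (0ℤ ≤_) (sym q-norm) (0≤N (lam (- q) x)))) p⊥q pq≡x²

        p-square : ∃[ t ] p ≡ t * t
        p-square = coprime-square {q} {p} {x} (nonneg-factor positive
          (subst (0ℤ ≤_) (sym p-norm) (0≤N (lam (- x) p)))) (Bz-sym p⊥q) (trans (ℤ.*-comm q p) pq≡x²)

      -- Up to a square factor prime to ℓ, b + n is a norm from the lattice.
      norm-class : ∀ {ℓ m} (U : UnitsSquareToOne ℓ m) → m ∣ᶻ n → ¬ (+ ℓ ∣ᶻ b) →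
        ∀ y z → ¬ (+ ℓ ∣ᶻ Nᵍ (lam y z)) → Nᵍ (lam y z) ≡ b [mod m ]
      norm-class {ℓ} {m} U m∣n ¬b y z ¬N = cases (+ ℓ ∣? q)
        where
        open UnitsSquareToOne U
        ℓ∣n : + ℓ ∣ᶻ n
        ℓ∣n = ∣-trans q∣m m∣n
        ¬bn : ¬ (+ ℓ ∣ᶻ b + n)
        ¬bn d = ¬b (∣m+n∣n⇒∣m {m = b} {n} d ℓ∣n)
        b+n≡b : b + n ≡ b [mod m ]
        b+n≡b = by-∣ (subst (m ∣ᶻ_) (id b n) m∣n)
          where id : ∀ b n → n ≡ b + n - b
                id = solve-∀
        finish : ∀ {s u w} → ∃[ t ] s ≡ t * t → ¬ (+ ℓ ∣ᶻ s) → s * (b + n) ≡ Nᵍ (lam u w) → Nᵍ (lam y z) ≡ b [mod m ]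
        finish {s} {u} {w} (t , refl) ¬s eq = mod-trans
            (unit-class U {a = s * (b + n)} {f = Nᵍ (lam y z)} {z = A} {n = n} {t = B} m∣n
              (trans (cong (_* Nᵍ (lam y z)) eq) (lam-norms u w y z))
              (λ d → [ ¬s , ¬bn ]′ (euclidℤ prime s (b + n) d)) ¬N)
            (mod-trans (mod-* (square t (λ d → ¬s (∣m⇒∣m*n t d))) b+n≡b) (mod-reflexive (ℤ.*-identityˡ b)))
          where A = Nβ * (u * y) + R * (u * z + w * y) + Nδ * (w * z)
                B = (u * z - w * y) * (u * z - w * y)
        cases : Dec (+ ℓ ∣ᶻ q) → Nᵍ (lam y z) ≡ b [mod m ]
        cases (no ¬q) = finish { q} { - q} {x} q-square ¬q q-norm
        cases (yes d) = finish {p} { - x} {p} p-square (Bz⇒prime∤ p⊥q prime d) p-norm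

-- Evaluating χ₄ at a fourth power

-- If n + b ≤ 0, then (n+b)(n+c) = h² + n² > 0 forces n + c ≤ 0, and likewise n + d ≤ 0. The three
-- add up to the total plus 2n, which is positive.
neighbour-positive : ∀ {n b c d} → IsDesc n b c d → 0ℤ < n → 0ℤ < n + b + c + d → 0ℤ < b + n
neighbour-positive {n} {b} {c} {d} isD n>0 S>0 = subst (0ℤ <_) (ℤ.+-comm n b) (ℤ.≰⇒> λ le → absurd le)
  where
  other : ∀ {c d} → IsDesc n b c d → n + b ≤ 0ℤ → n + c ≤ 0ℤ
  other {c} isD le = ℤ.≮⇒≥ λ gt → ℤ.<⇒≱ prod>0 (neg gt)
    where
    open HalfForm (halfForm isD)
    prod>0 : 0ℤ < (n + b) * (n + c)
    prod>0 = subst (0ℤ <_) (sym disc) (ℤ.+-mono-≤-< {0ℤ} {h * h} {0ℤ} (0≤sq h) (0<sq n>0))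
    neg : 0ℤ < n + c → (n + b) * (n + c) ≤ 0ℤ
    neg gt = subst ((n + b) * (n + c) ≤_) (ℤ.*-zeroˡ (n + c)) (ℤ.*-monoʳ-≤-nonNeg
      (n + c) {{ℤ.nonNegative (ℤ.<⇒≤ gt)}} le)
  absurd : n + b ≤ 0ℤ → ⊥
  absurd le = ℤ.<⇒≱ (ℤ.+-mono-< {0ℤ} {_} {0ℤ} S>0 (ℤ.+-mono-< {0ℤ} {_} {0ℤ} n>0 n>0))
    (subst (_≤ 0ℤ) (id n b c d) (ℤ.+-mono-≤ (ℤ.+-mono-≤ le (other isD le)) (other (desc-swap₃ isD) le)))
    where id : ∀ n b c d → (n + b) + (n + c) + (n + d) ≡ (n + b + c + d) + (n + n)
          id = solve-∀

-- One of the four associates of an odd Gaussian integer is primary, and all four lie in Λ ∪ iΛ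
-- because Λ is closed under negation. The cases run over the residues of both coordinates modulo 4.
primaryAssociate : ∀ M x y → let b = fromℤ x *ᵍ β M +ᵍ fromℤ y *ᵍ δ M in
  Oddᵍ b → ∃[ b' ] (InLam M b' × Nᵍ b' ≡ Nᵍ b × Primary b')
primaryAssociate M x y odd = go (re b %ℕ 4) (im b %ℕ 4) refl refl (n%ℕd<d (re b) 4) (n%ℕd<d (im b) 4)
  where
  b = fromℤ x *ᵍ β M +ᵍ fromℤ y *ᵍ δ M
  Result = ∃[ b' ] (InLam M b' × Nᵍ b' ≡ Nᵍ b × Primary b')
  PrimaryRes : ℤ → ℤ → Set
  PrimaryRes a b = (a %ℕ 4 ≡ 1 × b %ℕ 4 ≡ 0) ⊎ (a %ℕ 4 ≡ 3 × b %ℕ 4 ≡ 2)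
  use : ∀ b' → InLam M b' → Nᵍ b' ≡ Nᵍ b → PrimaryRes (re b') (im b') → Result
  use b' l e h = b' , l , e , trans (cong (_%ℕ 2) e) odd , h
  minus : -ᵍ b ≡ fromℤ (- x) *ᵍ β M +ᵍ fromℤ (- y) *ᵍ δ M
  minus = cong₂ _+i_ (id₁ x y (re (β M)) (im (β M)) (re (δ M)) (im (δ M)))
    (id₂ x y (re (β M)) (im (β M)) (re (δ M)) (im (δ M)))
    where
    id₁ : ∀ x y b₁ b₂ d₁ d₂ → - ((x * b₁ - 0ℤ * b₂) + (y * d₁ - 0ℤ * d₂)) ≡ (- x * b₁ - 0ℤ * b₂) +
      (- y * d₁ - 0ℤ * d₂)
    id₁ = solve-∀
    id₂ : ∀ x y b₁ b₂ d₁ d₂ → - ((x * b₂ + 0ℤ * b₁) + (y * d₂ + 0ℤ * d₁)) ≡ (- x * b₂ + 0ℤ * b₁) +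
      (- y * d₂ + 0ℤ * d₁)
    id₂ = solve-∀
  N-neg : ∀ z → Nᵍ (-ᵍ z) ≡ Nᵍ z
  N-neg (a +i b) = id a b
    where id : ∀ a b → - a * - a + - b * - b ≡ a * a + b * b
          id = solve-∀
  N-i : ∀ z → Nᵍ (iᵍ *ᵍ z) ≡ Nᵍ z
  N-i z = trans (Nᵍ-* iᵍ z) (ℤ.*-identityˡ (Nᵍ z))
  re-i : ∀ z → re (iᵍ *ᵍ z) ≡ - im z
  re-i (a +i b) = id a b
    where id : ∀ a b → 0ℤ * a - 1ℤ * b ≡ - b
          id = solve-∀
  im-i : ∀ z → im (iᵍ *ᵍ z) ≡ re z
  im-i (a +i b) = id a b
    where id : ∀ a b → 0ℤ * b + 1ℤ * a ≡ a
          id = solve-∀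
  as-is : PrimaryRes (re b) (im b) → Result
  as-is = use b (x , y , inj₁ refl) refl
  negated : PrimaryRes (- re b) (- im b) → Result
  negated = use (-ᵍ b) (- x , - y , inj₁ minus) (N-neg b)
  turned : PrimaryRes (- im b) (re b) → Result
  turned h = use (iᵍ *ᵍ b) (x , y , inj₂ refl) (N-i b) (subst₂ PrimaryRes (sym (re-i b)) (sym (im-i b)) h)
  turned-back : PrimaryRes (- (- im b)) (- re b) → Result
  turned-back h = use (iᵍ *ᵍ (-ᵍ b)) (- x , - y , inj₂ (cong (iᵍ *ᵍ_) minus)) (trans (N-i (-ᵍ b)) (N-neg b))
    (subst₂ PrimaryRes (sym (re-i (-ᵍ b))) (sym (im-i (-ᵍ b))) h)
  neg% : ∀ {a r} → a %ℕ 4 ≡ r → (- a) %ℕ 4 ≡ (- (+ r)) %ℕ 4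
  neg% {a} {r} e = mod⇒%ℕ≡ { - a} { - (+ r)} 4 (mod-trans (mod-reflexive (neg a))
    (mod-trans (mod-* (mod-refl {a = - 1ℤ}) (%ℕ≡⇒mod {a} 4 e)) (mod-reflexive (sym (neg (+ r))))))
    where neg : ∀ a → - a ≡ - 1ℤ * a
          neg = solve-∀
  even-norm : ∀ {r s} → re b %ℕ 4 ≡ r → im b %ℕ 4 ≡ s → (+ r * + r + + s * + s) %ℕ 2 ≡ 0 → Result
  even-norm {r} {s} e f h = case trans (sym odd) (trans (mod⇒%ℕ≡ {Nᵍ b} {+ r * + r + + s * + s} 2 (mod-+ (mod-* e' e') (mod-* f' f'))) h) of λ ()
    where
    e' : re b ≡ + r [mod + 2 ]
    e' = mod-coarsen (divides (+ 2) refl) (%ℕ≡⇒mod {re b} 4 e)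
    f' : im b ≡ + s [mod + 2 ]
    f' = mod-coarsen (divides (+ 2) refl) (%ℕ≡⇒mod {im b} 4 f)
  go : ∀ r s → re b %ℕ 4 ≡ r → im b %ℕ 4 ≡ s → r ℕ.< 4 → s ℕ.< 4 → Result
  go 1 0 e f _ _ = as-is (inj₁ (e , f))
  go 3 2 e f _ _ = as-is (inj₂ (e , f))
  go 3 0 e f _ _ = negated (inj₁ (neg% {re b} e , neg% {im b} f))
  go 1 2 e f _ _ = negated (inj₂ (neg% {re b} e , neg% {im b} f))
  go 0 3 e f _ _ = turned (inj₁ (neg% {im b} f , e))
  go 2 1 e f _ _ = turned (inj₂ (neg% {im b} f , e))
  go 0 1 e f _ _ = turned-back (inj₁ (neg% { - im b} (neg% {im b} f) , neg% {re b} e))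
  go 2 3 e f _ _ = turned-back (inj₂ (neg% { - im b} (neg% {im b} f) , neg% {re b} e))
  go 0 0 e f _ _ = even-norm e f refl
  go 0 2 e f _ _ = even-norm e f refl
  go 2 0 e f _ _ = even-norm e f refl
  go 2 2 e f _ _ = even-norm e f refl
  go 1 1 e f _ _ = even-norm e f refl
  go 1 3 e f _ _ = even-norm e f refl
  go 3 1 e f _ _ = even-norm e f refl
  go 3 3 e f _ _ = even-norm e f refl
  go (suc (suc (suc (suc r)))) _ _ _ (ℕ.s≤s (ℕ.s≤s (ℕ.s≤s (ℕ.s≤s ())))) _
  go 0 (suc (suc (suc (suc s)))) _ _ _ (ℕ.s≤s (ℕ.s≤s (ℕ.s≤s (ℕ.s≤s ()))))
  go 1 (suc (suc (suc (suc s)))) _ _ _ (ℕ.s≤s (ℕ.s≤s (ℕ.s≤s (ℕ.s≤s ()))))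
  go 2 (suc (suc (suc (suc s)))) _ _ _ (ℕ.s≤s (ℕ.s≤s (ℕ.s≤s (ℕ.s≤s ()))))
  go 3 (suc (suc (suc (suc s)))) _ _ _ (ℕ.s≤s (ℕ.s≤s (ℕ.s≤s (ℕ.s≤s ()))))

-- The real part is odd with square 1 modulo 8, so 8 divides the square of the imaginary part. This
-- trivialises the power of i in χ₄ for 8 | n, where e is even.
primary-im : ∀ b → Primary b → Nᵍ b ≡ 1ℤ [mod + 8 ] → + 4 ∣ᶻ im b
primary-im (a +i b) (_ , h) N≡1 = double (square-even b (∣-trans (divides (+ 4) refl) 8∣b²))
  where
  a-odd : ¬ (+ 2 ∣ᶻ a)
  a-odd = odd⇒∤2 {a} (trans (sym (%ℕ-%ℕ a 2 4 (ℕ.divides 2 refl)))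
    ([ cong (ℕ._% 2) ∘ proj₁ , cong (ℕ._% 2) ∘ proj₁ ]′ h))
  8∣b² : + 8 ∣ᶻ b * b
  8∣b² = subst (+ 8 ∣ᶻ_) (id a b) (∣m∣n⇒∣m-n (diff N≡1) (diff (UnitsSquareToOne.square units8 a a-odd)))
    where id : ∀ a b → (a * a + b * b - 1ℤ) - (a * a - 1ℤ) ≡ b * b
          id = solve-∀
  double : + 2 ∣ᶻ b → + 4 ∣ᶻ b
  double (divides c refl) = (Signed.*-monoˡ-∣ (+ 2) (square-even c
    (Signed.*-cancelʳ-∣ (+ 4) (subst (+ 8 ∣ᶻ_) (id c) 8∣b²))))
    where id : ∀ c → (c * + 2) * (c * + 2) ≡ c * c * + 4
          id = solve-∀

oddPart : ∀ fuel m → m ≢ 0 → m ℕ.< fuel → ∃[ f ] ∃[ k ] (m ≡ 2 ℕ.^ f ℕ.* k × ¬ (2 ℕ.∣ k))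
oddPart (suc fuel) m m≢0 lt with 2 ℕ.∣? m
... | no ¬2 = 0 , m , sym (ℕ.*-identityˡ m) , ¬2
... | yes (ℕ.divides c refl) = go (oddPart fuel c c≢0 c<)
  where
  c≢0 : c ≢ 0
  c≢0 refl = m≢0 refl
  c< : c ℕ.< fuel
  c< = ℕ.<-≤-trans (ℕ.m<m*n c 2 {{ℕ.≢-nonZero c≢0}} (ℕ.s≤s (ℕ.s≤s ℕ.z≤n))) (ℕ.≤-pred lt)
  go : ∃[ f ] ∃[ k ] (c ≡ 2 ℕ.^ f ℕ.* k × ¬ (2 ℕ.∣ k)) → ∃[ f ] ∃[ k ] (c ℕ.* 2 ≡ 2 ℕ.^ f ℕ.* k × ¬ (2 ℕ.∣ k))
  go (f , k , e , ¬2) = suc f , k , trans (trans (cong (ℕ._* 2) e) (ℕ.*-comm (2 ℕ.^ f ℕ.* k) 2))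
    (sym (ℕ.*-assoc 2 (2 ℕ.^ f) k)) , ¬2

-- The symbol at 9

gauss-mod : ∀ {a b r s m} → a ≡ r [mod m ] → b ≡ s [mod m ] → (a +i b) ≈ (r +i s) ⟨ fromℤ m ⟩
gauss-mod {a} {b} {r} {s} {m} (by-∣ (divides k e)) (by-∣ (divides l f)) = by-∣ᵍ (dividesᵍ (k +i l)
  (cong₂ _+i_ (trans e (i₁ k l m)) (trans f (i₂ k l m))))
  where i₁ : ∀ k l m → k * m ≡ m * k - 0ℤ * l
        i₁ = solve-∀
        i₂ : ∀ k l m → l * m ≡ m * l + 0ℤ * k
        i₂ = solve-∀

three : 𝔾
three = fromℤ (+ 3)

qprime-3 : QPrime three
qprime-3 = inertPrime prime[3] (from-no (2 ℕ.∣? 3)) (from-no (twoSquares? 3))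

squareMod3 : ∀ β → ∃[ r ] ∃[ s ] (r ℕ.< 3 × s ℕ.< 3 × β ≈ (+ r) +i (+ s) ⟨ three ⟩ × Nᵍ β
  ≡ + r * + r + + s * + s [mod + 3 ])
squareMod3 β = re β %ℕ 3 , im β %ℕ 3 , n%ℕd<d (re β) 3 , n%ℕd<d (im β) 3 , gauss-mod (≡%ℕ (re β) 3) (≡%ℕ (im β) 3) ,
  mod-+ (mod-* (≡%ℕ (re β) 3) (≡%ℕ (re β) 3)) (mod-* (≡%ℕ (im β) 3) (≡%ℕ (im β) 3))

-- The symbol at 3 is β² modulo 3, as (9 - 1)/4 = 2, so the symbol at 9 is β⁴ = β β³ ≡ β β̄ = N(β).
-- This is checked on the residues of β; the argument of each `dividesᵍ` is ((r + r'i)² - v)/3.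
symbolAt9 : ∀ {β s} → s ≡ 1 ⊎ s ≡ 2 → Nᵍ β ≡ + s [mod + 3 ] → QuarticList β (three ∷ three ∷ []) (fromℤ (signOf s))
symbolAt9 {β} {s} hs N≡ = go hs (squareMod3 β)
  where
  ¬3 : ∀ {s} → s ≡ 1 ⊎ s ≡ 2 → Nᵍ β ≡ + s [mod + 3 ] → ¬ (three ∥ β)
  ¬3 {s} hs N≡ (dividesᵍ k e) = bad hs (∣⇒%ℕ≡0 {+ s} 3 (mod-∣ (mod-sym N≡)
      (divides (+ 3 * Nᵍ k) (trans (cong Nᵍ e) (trans (Nᵍ-* three k) (id (Nᵍ k)))))))
    where id : ∀ z → + 9 * z ≡ + 3 * z * + 3
          id = solve-∀
          bad : s ≡ 1 ⊎ s ≡ 2 → (+ s) %ℕ 3 ≡ 0 → ⊥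
          bad (inj₁ refl) ()
          bad (inj₂ refl) ()
  at : ∀ {t} v → Unitᵍ v → v *ᵍ (v *ᵍ 1ᵍ) ≡ t → β ^ᵍ 2 ≈ v ⟨ three ⟩ → QuarticList β (three ∷ three ∷ []) t
  at v u e c = v , v *ᵍ 1ᵍ , q , (v , 1ᵍ , q , refl , refl) , sym e
    where q : QuarticPrimeIs β three v
          q = ¬3 hs N≡ ∘ ∣ᵍ⇒∥ , u , ∥⇒∣ᵍ (diffᵍ c)
  by : ∀ {r s v} → β ≈ (+ r) +i (+ s) ⟨ three ⟩ → three ∥ (((+ r) +i (+ s)) ^ᵍ 2) -ᵍ v → β ^ᵍ 2 ≈ v ⟨ three ⟩
  by c d = ≈-trans (≈-^ 2 c) (by-∣ᵍ d)
  mismatch : ∀ r r' {t} → s ≡ t → Nᵍ β ≡ + r * + r + + r' * + r' [mod + 3 ] → (+ t) %ℕ 3 ≢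
    (+ r * + r + + r' * + r') %ℕ 3 → QuarticList β (three ∷ three ∷ []) (fromℤ (signOf s))
  mismatch r r' {t} refl N ne = ⊥-elim (ne (mod⇒%ℕ≡ {+ t} {+ r * + r + + r' * + r'} 3 (mod-trans (mod-sym N≡) N)))
  go : s ≡ 1 ⊎ s ≡ 2 → ∃[ r ] ∃[ r' ] (r ℕ.< 3 × r' ℕ.< 3 × β ≈ (+ r) +i (+ r') ⟨ three ⟩ × Nᵍ β
    ≡ + r * + r + + r' * + r' [mod + 3 ]) →
    QuarticList β (three ∷ three ∷ []) (fromℤ (signOf s))
  go (inj₁ e) (0 , 0 , _ , _ , c , N) = mismatch 0 0 e N (λ ())
  go (inj₂ e) (0 , 0 , _ , _ , c , N) = mismatch 0 0 e N (λ ())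
  go (inj₁ refl) (1 , 0 , _ , _ , c , N) = at 1ᵍ refl refl (by c (dividesᵍ 0ᵍ refl))
  go (inj₂ e) (1 , 0 , _ , _ , c , N) = mismatch 1 0 e N (λ ())
  go (inj₁ refl) (2 , 0 , _ , _ , c , N) = at 1ᵍ refl refl (by c (dividesᵍ 1ᵍ refl))
  go (inj₂ e) (2 , 0 , _ , _ , c , N) = mismatch 2 0 e N (λ ())
  go (inj₁ refl) (0 , 1 , _ , _ , c , N) = at (-ᵍ 1ᵍ) refl refl (by c (dividesᵍ 0ᵍ refl))
  go (inj₂ e) (0 , 1 , _ , _ , c , N) = mismatch 0 1 e N (λ ())
  go (inj₁ refl) (0 , 2 , _ , _ , c , N) = at (-ᵍ 1ᵍ) refl refl (by c (dividesᵍ (-ᵍ 1ᵍ) refl))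
  go (inj₂ e) (0 , 2 , _ , _ , c , N) = mismatch 0 2 e N (λ ())
  go (inj₁ e) (1 , 1 , _ , _ , c , N) = mismatch 1 1 e N (λ ())
  go (inj₂ refl) (1 , 1 , _ , _ , c , N) = at (-ᵍ iᵍ) refl refl (by c (dividesᵍ iᵍ refl))
  go (inj₁ e) (1 , 2 , _ , _ , c , N) = mismatch 1 2 e N (λ ())
  go (inj₂ refl) (1 , 2 , _ , _ , c , N) = at iᵍ refl refl (by c (dividesᵍ ((- 1ℤ) +i 1ℤ) refl))
  go (inj₁ e) (2 , 1 , _ , _ , c , N) = mismatch 2 1 e N (λ ())
  go (inj₂ refl) (2 , 1 , _ , _ , c , N) = at iᵍ refl refl (by c (dividesᵍ (1ℤ +i 1ℤ) refl))
  go (inj₁ e) (2 , 2 , _ , _ , c , N) = mismatch 2 2 e N (λ ())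
  go (inj₂ refl) (2 , 2 , _ , _ , c , N) = at (-ᵍ iᵍ) refl refl (by c (dividesᵍ (0ℤ +i (+ 3)) refl))
  go _ (suc (suc (suc _)) , _ , ℕ.s≤s (ℕ.s≤s (ℕ.s≤s ())) , _)
  go _ (_ , suc (suc (suc _)) , _ , ℕ.s≤s (ℕ.s≤s (ℕ.s≤s ())) , _)

-- χ₄ at circles of curvature u m⁴

module Quartic {root : Config} (isR : IsDescartes root) (primR : Primitive root) (placed : Placed root)
  {S : List ℕ} (ty : TypeIs root S) (cl₈ : Class 2 8 1 S) {s₃ : ℕ} (hs₃ : s₃ ≡ 1 ⊎ s₃ ≡ 2) (cl₃ : Class 3 3 s₃ S)
  {ε : 𝔾} (chi₄ : Chi4Is root ε) where

  module At {D : Config} (r : Reach root D) (i : Fin 4) (n>0 : 0ℤ < curv (D i)) where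

    private
      n = curv (D i)
      isD = reach-descartes {root} isR r
      inP : ∀ j → InPacking root (D j)
      inP j = D , r , j , refl
      M = proj₁ (placed (D i) (inP i))
      rep : Represents M (D i)
      rep = proj₂ (placed (D i) (inP i))
      n≢0 : n ≢ 0ℤ
      n≢0 e = ℤ.<-irrefl (sym e) n>0
      module L = Lattice M {D i} rep

      norm-class₂ : ∀ {ℓ m} → UnitsSquareToOne ℓ m → m ∣ᶻ n → ∀ j k → i ≢ j → i ≢ k → j ≢ k → 0ℤ < curv (D j) + n →
        ¬ (+ ℓ ∣ᶻ curv (D j)) → ∀ y z → ¬ (+ ℓ ∣ᶻ Nᵍ (L.lam y z)) → Nᵍ (L.lam y z) ≡ curv (D j) [mod m ]
      norm-class₂ U m∣n j k i≢j i≢k j≢k pos ¬d = T.norm-class pos U m∣n ¬d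
        where
        cob : ∀ j → ∃[ e ] cobar (D j) ≡ + 4 * e
        cob j = let M' , rep' = placed (D j) (inP j) in cobar-div4 {M'} {D j} rep'
        circ? = proj₁ isD
        tang = proj₁ (proj₂ isD)
        module T = L.TwoNeighbours {D j} (circ? j) (tang i j i≢j) (proj₁ (cob j)) (proj₂ (cob j))
          {D k} (circ? k) (tang i k i≢k) (proj₁ (cob k)) (proj₂ (cob k)) (tang j k j≢k)

      -- The prime ℓ divides n, so by primitivity some neighbour has curvature prime to ℓ, and
      -- `norm-class` carries the class of that curvature to the norms. A further neighbour serves
      -- as the auxiliary circle there.
      lam-class : ∀ {ℓ m s} → UnitsSquareToOne ℓ m → m ∣ᶻ n → (∀ j → ¬ (+ ℓ ∣ᶻ curv (D j)) → curv (D j) ≡ s [mod m ])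
        →
        ∀ y z → Bz (Nᵍ (L.lam y z)) n → Nᵍ (L.lam y z) ≡ s [mod m ]
      lam-class {ℓ} {m} {s} U m∣n cl y z bz = cases (+ ℓ ∣? b) (+ ℓ ∣? c) (+ ℓ ∣? d)
        where
        open UnitsSquareToOne U
        open Tuple (tuple {D} isD i)
        b = curv (D j)
        c = curv (D k)
        d = curv (D l)
        i≢j = proj₁ distinct
        i≢k = proj₁ (proj₂ distinct)
        i≢l = proj₁ (proj₂ (proj₂ distinct))
        j≢k = proj₁ (proj₂ (proj₂ (proj₂ distinct)))
        j≢l = proj₁ (proj₂ (proj₂ (proj₂ (proj₂ distinct))))
        S>0 : 0ℤ < n + b + c + d
        S>0 = subst (0ℤ <_) (sym sum) (proj₂ (proj₂ isD))
        ¬N : ¬ (+ ℓ ∣ᶻ Nᵍ (L.lam y z))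
        ¬N = Bz⇒prime∤ bz prime (∣-trans q∣m m∣n)
        cases : Dec (+ ℓ ∣ᶻ b) → Dec (+ ℓ ∣ᶻ c) → Dec (+ ℓ ∣ᶻ d) → Nᵍ (L.lam y z) ≡ s [mod m ]
        cases (no ¬b) _ _ = mod-trans (norm-class₂ U m∣n j k i≢j i≢k j≢k (neighbour-positive desc n>0 S>0) ¬b y z ¬N)
          (cl j ¬b)
        cases (yes _) (no ¬c) _ = mod-trans (norm-class₂ U m∣n k j i≢k i≢j (j≢k ∘ sym)
          (neighbour-positive (desc-swap₂ desc) n>0 (subst (0ℤ <_) (id n b c d) S>0)) ¬c y z ¬N) (cl k ¬c)
          where id : ∀ n b c d → n + b + c + d ≡ n + c + b + d
                id = solve-∀
        cases (yes _) (yes _) (no ¬d) = mod-trans (norm-class₂ U m∣n l j i≢l i≢j (j≢l ∘ sym)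
          (neighbour-positive (desc-swap₂ (desc-swap₃ desc)) n>0 (subst (0ℤ <_) (id n b c d) S>0)) ¬d y z ¬N)
            (cl l ¬d)
          where id : ∀ n b c d → n + b + c + d ≡ n + d + b + c
                id = solve-∀
        cases (yes db) (yes dc) (yes dd) = ⊥-elim
          (prime∤1 prime (reach-primitive primR r (allDiv (∣-trans q∣m m∣n) db dc dd)))

    -- Counterpart of `Rho` for χ₄: a lattice element, made primary when n is even, whose norm is
    -- known modulo 8 and 3 where these divide n.
    record Element : Set where
      field
        b' : 𝔾
        coprime : Bz (Nᵍ b') n
        norm₈ : + 8 ∣ᶻ n → Nᵍ b' ≡ + 1 [mod + 8 ]
        norm₃ : + 3 ∣ᶻ n → Nᵍ b' ≡ + s₃ [mod + 3 ]
        primary : n %ℕ 2 ≡ 0 → Primary b'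
        chi : ∀ v → Chi4At n b' v → v ≡ ε

    element : Element
    element = go (L.coprimeNorm n≢0)
      where
      Good : 𝔾 → Set
      Good b' = Bz (Nᵍ b') n × (+ 8 ∣ᶻ n → Nᵍ b' ≡ + 1 [mod + 8 ]) × (+ 3 ∣ᶻ n → Nᵍ b' ≡ + s₃ [mod + 3 ])
      mk : ∀ b' → InLam M b' → Good b' → (n %ℕ 2 ≡ 0 → Primary b') → Element
      mk b' l (bz , h₈ , h₃) pr = record { b' = b' ; coprime = bz ; norm₈ = h₈ ; norm₃ = h₃ ; primary = pr
        ; chi = chi₄ D r i n≢0 M rep b' l (Bz⇒Coprimeᵍ {b'} {n} bz) pr }
      go : ∃[ x ] ∃[ y ] Bz (Nᵍ (L.lam x y)) n → Element
      go (x , y , bz) = parity (+ 2 ∣? n)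
        where
        good : Good (L.lam x y)
        good = bz , (λ d → lam-class units8 d (class-mod ty (∣24 2) (∣24 8) cl₈ {D} r) x y bz)
                  , (λ d → lam-class units3 d (class-mod ty (∣24 3) (∣24 3) cl₃ {D} r) x y bz)
        parity : Dec (+ 2 ∣ᶻ n) → Element
        parity (no ¬2) = mk (L.lam x y) (x , y , inj₁ refl) good (λ e → ⊥-elim (¬2 (%ℕ≡0⇒∣ {n} 2 e)))
        parity (yes d) = assoc (primaryAssociate M x y (∤2⇒odd {Nᵍ (L.lam x y)} (Bz⇒prime∤ bz Primality.prime[2] d)))
          where
          assoc : ∃[ b' ] (InLam M b' × Nᵍ b' ≡ Nᵍ (L.lam x y) × Primary b') → Element
          assoc (b' , l , e , pr) = mk b' l
            (subst (λ N → Bz N n × (+ 8 ∣ᶻ n → N ≡ + 1 [mod + 8 ]) × (+ 3 ∣ᶻ n → N ≡ + s₃ [mod + 3 ])) (sym e) good)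
            (λ _ → pr)

  -- n = 2^{2h} n' with n' = w k⁴ and w an odd square; all the factors of χ₄
  -- other than the symbol [b'/w] are trivial.
  evaluate : ∀ {D} (r : Reach root D) i (n>0 : 0ℤ < curv (D i)) h w c ws {v} →
    w ≡ c ℕ.* c → fromℤ (+ w) ≡ productᵍ ws → All (λ π → GPrime π × Oddᵍ π) ws →
    QuarticList (At.Element.b' (At.element {D} r i n>0)) ws v →
    ∀ k → ¬ (2 ℕ.∣ w ℕ.* k ℕ.^ 4) → curv (D i) ≡ + (2 ℕ.^ (2 ℕ.* h) ℕ.* (w ℕ.* k ℕ.^ 4)) →
    (curv (D i) %ℕ 8 ≡ 0 ⊎ curv (D i) %ℕ 8 ≡ 1 ⊎ curv (D i) %ℕ 8 ≡ 4) → v ≡ ε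
  evaluate {D} r i n>0 h w c ws {v} w≡ prodw pws kw k odd n≡ n%8 = cases n%8
    where
    open At {D} r i n>0
    open Element element
    n = curv (D i)
    e = 2 ℕ.* h
    n' = w ℕ.* k ℕ.^ 4
    split : n ≡ (+ 2) ^ e * + n'
    split = trans n≡ (trans (ℤ.pos-* (2 ℕ.^ e) n') (cong (_* + n') (pos-^ e)))
      where pos-^ : ∀ e → + (2 ℕ.^ e) ≡ (+ 2) ^ e
            pos-^ zero    = refl
            pos-^ (suc e) = trans (ℤ.pos-* 2 (2 ℕ.^ e)) (cong (+ 2 *_) (pos-^ e))
    n'-odd : + n' %ℕ 2 ≡ 1
    n'-odd = ∤2⇒odd {+ n'} (odd ∘ ∣⇒∣ᵤ)
    n'∣n : + n' ∣ᶻ n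
    n'∣n = divides ((+ 2) ^ e) split
    k-odd : ¬ (2 ℕ.∣ k)
    k-odd d = odd (ℕ.∣n⇒∣m*n w (ℕ.∣m⇒∣m*n (k ℕ.^ 3) d))
    k∣n : + k ∣ᶻ n
    k∣n = ∣-trans (∣ᵤ⇒∣ (ℕ.∣n⇒∣m*n w (ℕ.m∣m*n (k ℕ.^ 3)))) n'∣n
    quartic : QuarticIs b' (fromℤ (+ n')) v
    quartic = subst (λ z → QuarticIs b' z v) (trans (cong (_*ᵍ fromℤ (+ (k ℕ.^ 4))) (sym prodw))
        (trans (sym (fromℤ-* (+ w) (+ (k ℕ.^ 4)))) (cong fromℤ (sym (ℤ.pos-* w (k ℕ.^ 4))))))
      (quarticFourth {b'} ws pws kw (gFactors k k-odd) (Bz-divʳ coprime k∣n))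
    even : ∀ {s} → n %ℕ 8 ≡ s → s ℕ.% 2 ≡ 0 → n %ℕ 2 ≡ 0
    even e f = trans (sym (%ℕ-%ℕ n 2 8 (ℕ.divides 4 refl))) (trans (cong (ℕ._% 2) e) f)
    cases : n %ℕ 8 ≡ 0 ⊎ n %ℕ 8 ≡ 1 ⊎ n %ℕ 8 ≡ 4 → v ≡ ε
    cases (inj₁ m8) = chi v
      (inj₁ (m8 , e , + n' , (split , n'-odd) , im b' * + h , v , twice , quartic , sym
      (trans (cong (_*ᵍ v) trivial) (𝔾R.*-identityˡ v))))
      where
      8∣n : + 8 ∣ᶻ n
      8∣n = %ℕ≡0⇒∣ {n} 8 m8
      twice : im b' * + e ≡ + 2 * (im b' * + h)
      twice = trans (cong (im b' *_) (ℤ.pos-* 2 h)) (id (im b') (+ h))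
        where id : ∀ x h → x * (+ 2 * h) ≡ + 2 * (x * h)
              id = solve-∀
      trivial : ipow (im b' * + h) ≡ 1ᵍ
      trivial = cong ipowℕ
        (∣⇒%ℕ≡0 {im b' * + h} 4 (∣m⇒∣m*n (+ h) (primary-im b' (primary (even m8 refl)) (norm₈ 8∣n))))
    cases (inj₂ (inj₁ m8)) = chi v (inj₂ (inj₁ (m8 , subst (λ z → QuarticIs b' (fromℤ z) v) (sym n≡n') quartic)))
      where
      h≡0 : h ≡ 0
      h≡0 = zero-h h split
        where
        zero-h : ∀ h → n ≡ (+ 2) ^ (2 ℕ.* h) * + n' → h ≡ 0
        zero-h zero    _ = refl
        zero-h (suc h) eq = ⊥-elim (odd⇒∤2 {n} (trans (sym (%ℕ-%ℕ n 2 8 (ℕ.divides 4 refl))) (cong (ℕ._% 2) m8))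
          (subst (+ 2 ∣ᶻ_) (sym eq) (∣m⇒∣m*n (+ n') (∣m⇒∣m*n ((+ 2) ^ (h ℕ.+ suc (h ℕ.+ 0))) ∣-refl))))
      n≡n' : n ≡ + n'
      n≡n' = trans split (trans (cong (λ z → (+ 2) ^ (2 ℕ.* z) * + n') h≡0) (ℤ.*-identityˡ (+ n')))
    cases (inj₂ (inj₂ m8)) = chi v
      (inj₂ (inj₂ (m8 , e , + n' , (split , n'-odd) , 1ℤ , v , kron , quartic , sym (𝔾R.*-identityˡ v))))
      where
      -- The odd part is n' = (c k²)², so the Kronecker symbol of -1 over it is 1.
      kron : KronIs (- 1ℤ) (+ n') 1ℤ
      kron = subst (λ z → KronIs (- 1ℤ) (+ z) 1ℤ) sq (kronSquare {t = 1ℤ} [] [] refl (c ℕ.* (k ℕ.* k)) nz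
        (- 1ℤ , 0ℤ , cong (λ z → 1ℤ + z) (ℤ.*-zeroˡ (+ (c ℕ.* (k ℕ.* k))))))
        where
        sq : 1 ℕ.* (c ℕ.* (k ℕ.* k)) ℕ.^ 2 ≡ n'
        sq = trans (idℕ c k) (cong (ℕ._* k ℕ.^ 4) (sym w≡))
          where idℕ : ∀ c k → 1 ℕ.* ((c ℕ.* (k ℕ.* k)) ℕ.* ((c ℕ.* (k ℕ.* k)) ℕ.* 1)) ≡ (c ℕ.* c) ℕ.*
                  (k ℕ.* (k ℕ.* (k ℕ.* (k ℕ.* 1))))
                idℕ = ℕSolver.solve-∀
        nz : c ℕ.* (k ℕ.* k) ≢ 0
        nz eq = odd (subst (2 ℕ.∣_) (trans (cong (λ z → 1 ℕ.* z ℕ.^ 2) (sym eq)) sq) (ℕ.divides 0 refl))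

  private
    positive : ∀ {n} u m .{{_ : NonZero u}} → m ≢ 0 → n ≡ + (u ℕ.* m ℕ.^ 4) → 0ℤ < n
    positive u m m≢0 refl = +<+ (ℕ.n≢0⇒n>0 λ e →
      [ ℕ.≢-nonZero⁻¹ u , (λ e' → m≢0 (ℕ.m^n≡0⇒m≡0 m 4 e')) ]′ (ℕ.m*n≡0⇒m≡0∨n≡0 u e))

    residue₈ : ∀ u → Residues u 4 S (λ r → r ℕ.% 8 ≡ 0 ⊎ r ℕ.% 8 ≡ 1 ⊎ r ℕ.% 8 ≡ 4) → ∀ {D} → Reach root D → ∀ i m →
      curv (D i) ≡ + (u ℕ.* m ℕ.^ 4) → curv (D i) %ℕ 8 ≡ 0 ⊎ curv (D i) %ℕ 8 ≡ 1 ⊎ curv (D i) %ℕ 8 ≡ 4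
    residue₈ u h {D} r i m e = [ inj₁ ∘ red , [ inj₂ ∘ inj₁ ∘ red , inj₂ ∘ inj₂ ∘ red ]′ ]′
        (subst (λ z → z ℕ.% 8 ≡ 0 ⊎ z ℕ.% 8 ≡ 1 ⊎ z ℕ.% 8 ≡ 4) (cong (_%ℕ 24) (sym e))
          (residues {u} {4} {S} h m (subst (λ z → z %ℕ 24 ∈ S) e (residue∈ ty {D} r i))))
      where red : ∀ {s} → (curv (D i) %ℕ 24) ℕ.% 8 ≡ s → curv (D i) %ℕ 8 ≡ s
            red = trans (sym (%ℕ-%ℕ (curv (D i)) 8 24 (∣24 8)))

    regroup : ∀ g w f k → 2 ℕ.^ (2 ℕ.* g) ℕ.* w ℕ.* (2 ℕ.^ f ℕ.* k) ℕ.^ 4 ≡ 2 ℕ.^ (2 ℕ.* (g ℕ.+ 2 ℕ.* f)) ℕ.*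
      (w ℕ.* k ℕ.^ 4)
    regroup g w f k = trans (id (2 ℕ.^ (2 ℕ.* g)) w (2 ℕ.^ f) k)
        (cong (ℕ._* (w ℕ.* k ℕ.^ 4))
          (sym (trans (cong (2 ℕ.^_) (exp g f)) (trans (ℕ.^-distribˡ-+-* 2 (2 ℕ.* g) (f ℕ.* 4))
          (cong (2 ℕ.^ (2 ℕ.* g) ℕ.*_) (sym (ℕ.^-*-assoc 2 f 4)))))))
      where
      id : ∀ a w b k → a ℕ.* w ℕ.* ((b ℕ.* k) ℕ.* ((b ℕ.* k) ℕ.* ((b ℕ.* k) ℕ.* ((b ℕ.* k) ℕ.* 1)))) ≡ a ℕ.*
        (b ℕ.* (b ℕ.* (b ℕ.* (b ℕ.* 1)))) ℕ.* (w ℕ.* (k ℕ.* (k ℕ.* (k ℕ.* (k ℕ.* 1)))))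
      id = ℕSolver.solve-∀
      exp : ∀ g f → 2 ℕ.* (g ℕ.+ 2 ℕ.* f) ≡ 2 ℕ.* g ℕ.+ f ℕ.* 4
      exp = ℕSolver.solve-∀

    odd^4 : ∀ {w k} → ¬ (2 ℕ.∣ w) → ¬ (2 ℕ.∣ k) → ¬ (2 ℕ.∣ w ℕ.* k ℕ.^ 4)
    odd^4 {w} {k} ¬w ¬k d = [ ¬w , pow 4 ]′ (euclidsLemma w (k ℕ.^ 4) Primality.prime[2] d)
      where
      pow : ∀ j → ¬ (2 ℕ.∣ k ℕ.^ j)
      pow zero    d = case ℕ.∣1⇒≡1 d of λ ()
      pow (suc j) d = [ ¬k , pow j ]′ (euclidsLemma k (k ℕ.^ j) Primality.prime[2] d)

    3∣ : ∀ {n} g k → n ≡ + (2 ℕ.^ (2 ℕ.* g) ℕ.* 9 ℕ.* k) → + 3 ∣ᶻ n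
    3∣ g k refl = ∣ᵤ⇒∣ (ℕ.∣m⇒∣m*n k (ℕ.∣n⇒∣m*n (2 ℕ.^ (2 ℕ.* g)) (ℕ.divides 3 refl)))

  -- The factor 2^(2g) treats u = 1 and u = 4 together, as it does 9 and 36 in `fourth₉`. Once the
  -- powers of 2 are removed from m, what is left over besides k⁴ is w = 1, with empty symbol 1.
  fourth₁ : ∀ g → Residues (2 ℕ.^ (2 ℕ.* g) ℕ.* 1) 4 S (λ r → r ℕ.% 8 ≡ 0 ⊎ r ℕ.% 8 ≡ 1 ⊎ r ℕ.% 8 ≡ 4) →
    ∀ m → m ≢ 0 → IsCurv root (+ (2 ℕ.^ (2 ℕ.* g) ℕ.* 1 ℕ.* m ℕ.^ 4)) → 1ᵍ ≡ ε
  fourth₁ g h m m≢0 (_ , (D , r , i , refl) , e) = go (oddPart (suc m) m m≢0 ℕ.≤-refl)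
    where
    u = 2 ℕ.^ (2 ℕ.* g) ℕ.* 1
    instance
      u≢0 : NonZero u
      u≢0 = ℕ.m*n≢0 (2 ℕ.^ (2 ℕ.* g)) 1 {{ℕ.m^n≢0 2 (2 ℕ.* g)}}
    go : ∃[ f ] ∃[ k ] (m ≡ 2 ℕ.^ f ℕ.* k × ¬ (2 ℕ.∣ k)) → 1ᵍ ≡ ε
    go (f , k , m≡ , ¬2) = evaluate {D} r i (positive {curv (D i)} u m m≢0 e)
      (g ℕ.+ 2 ℕ.* f) 1 1 [] refl refl [] refl k
      (odd^4 {1} (from-no (2 ℕ.∣? 1)) ¬2)
        (trans e (cong +_ (trans (cong (λ z → u ℕ.* z ℕ.^ 4) m≡) (regroup g 1 f k)))) (residue₈ u h {D} r i m e)

  fourth₉ : ∀ g → Residues (2 ℕ.^ (2 ℕ.* g) ℕ.* 9) 4 S (λ r → r ℕ.% 8 ≡ 0 ⊎ r ℕ.% 8 ≡ 1 ⊎ r ℕ.% 8 ≡ 4) →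
    ∀ m → m ≢ 0 → IsCurv root (+ (2 ℕ.^ (2 ℕ.* g) ℕ.* 9 ℕ.* m ℕ.^ 4)) → fromℤ (signOf s₃) ≡ ε
  fourth₉ g h m m≢0 (_ , (D , r , i , refl) , e) = go (oddPart (suc m) m m≢0 ℕ.≤-refl)
    where
    u = 2 ℕ.^ (2 ℕ.* g) ℕ.* 9
    instance
      u≢0 : NonZero u
      u≢0 = ℕ.m*n≢0 (2 ℕ.^ (2 ℕ.* g)) 9 {{ℕ.m^n≢0 2 (2 ℕ.* g)}}
    n>0 = positive {curv (D i)} u m m≢0 e
    E = At.element {D} r i n>0
    q3 : GPrime three × Oddᵍ three
    q3 = QPrime.gprime qprime-3 , QPrime.odd qprime-3
    go : ∃[ f ] ∃[ k ] (m ≡ 2 ℕ.^ f ℕ.* k × ¬ (2 ℕ.∣ k)) → fromℤ (signOf s₃) ≡ ε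
    go (f , k , m≡ , ¬2) = evaluate {D} r i n>0 (g ℕ.+ 2 ℕ.* f) 9 3 (three ∷ three ∷ []) refl refl (q3 ∷ q3 ∷ [])
      (symbolAt9 {At.Element.b' E} hs₃ (At.Element.norm₃ E (3∣ {curv (D i)} g (m ℕ.^ 4) e))) k
      (odd^4 {9} (from-no (2 ℕ.∣? 9)) ¬2)
        (trans e (cong +_ (trans (cong (λ z → u ℕ.* z ℕ.^ 4) m≡) (regroup g 9 f k)))) (residue₈ u h {D} r i m e)

-- The table

private
  0∨1? : ∀ r → Dec (r ℕ.% 4 ≡ 0 ⊎ r ℕ.% 4 ≡ 1)
  0∨1? r = (r ℕ.% 4 ℕ.≟ 0) ⊎-dec (r ℕ.% 4 ℕ.≟ 1)

  0∨1∨4? : ∀ r → Dec (r ℕ.% 8 ≡ 0 ⊎ r ℕ.% 8 ≡ 1 ⊎ r ℕ.% 8 ≡ 4)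
  0∨1∨4? r = (r ℕ.% 8 ℕ.≟ 0) ⊎-dec ((r ℕ.% 8 ℕ.≟ 1) ⊎-dec (r ℕ.% 8 ℕ.≟ 4))

  ≡8? : ∀ r → Dec (r ℕ.% 8 ≡ 0)
  ≡8? r = r ℕ.% 8 ℕ.≟ 0

  ≡4? : ∀ s r → Dec (r ℕ.% 4 ≡ s)
  ≡4? s r = r ℕ.% 4 ℕ.≟ s

private
  1≢-1 : 1ℤ ≢ - 1ℤ
  1≢-1 ()

  -1≢1 : - 1ℤ ≢ 1ℤ
  -1≢1 ()

  1ᵍ≢-1ᵍ : 1ᵍ ≢ -ᵍ 1ᵍ
  1ᵍ≢-1ᵍ ()

  -1ᵍ≢1ᵍ : fromℤ (- 1ℤ) ≢ 1ᵍ
  -1ᵍ≢1ᵍ ()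

module Conclude {root : Config} (isR : IsDescartes root) (primR : Primitive root) {S : List ℕ} (ty : TypeIs root S)
  (no1 : ¬ IsCurv root 1ℤ) where

  obs₂ : ∀ u r₀ .{{_ : NonZero u}} {_ : True ((u ℕ.* r₀ ℕ.^ 2) ℕ.% 24 ∈? S)} → Missing root 2 u → Obstruction root 2 u
  obs₂ u r₀ {t} = obstruction {root} ty u 2 r₀ nonNeg2 (toWitness t) isR primR no1

  obs₄ : ∀ u r₀ .{{_ : NonZero u}} {_ : True ((u ℕ.* r₀ ℕ.^ 4) ℕ.% 24 ∈? S)} → Missing root 4 u → Obstruction root 4 u
  obs₄ u r₀ {t} = obstruction {root} ty u 4 r₀ nonNeg4 (toWitness t) isR primR no1

  exc : ∀ u d r₀ {r} .{{_ : NonZero u}} .{{_ : NonZero d}} {_ : True ((u ℕ.* r₀ ℕ.^ d) ℕ.% 24 ℕ.≟ r)}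
    {_ : True (r ∈? S)} →
    Missing root d u → Exceptional root r
  exc u d r₀ {r} {t} {t'} = exceptional {root} ty u d r₀ (toWitness t) (toWitness t')

-- The second argument of each obs₂, obs₄ and the third of each exc is a base
-- r₀ for which u r₀^d lies in the required class modulo 24.
module _ {root : Config} (isR : IsDescartes root) (primR : Primitive root) (placed : Placed root) where

  type6-1⁻ : TypeIs root type6-1 → Chi2Is root (- 1ℤ) →
    Conclusion root ((2 , 1) ∷ (2 , 2) ∷ (2 , 3) ∷ (2 , 6) ∷ []) (0 ∷ 1 ∷ 4 ∷ 9 ∷ 12 ∷ 16 ∷ [])
  type6-1⁻ ty chi₂ =
      (obs₂ 1 1 m₁ ∷ obs₂ 2 0 m₂ ∷ obs₂ 3 2 m₃ ∷ obs₂ 6 2 m₆ ∷ [])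
    , (exc 1 2 0 m₁ ∷ exc 1 2 1 m₁ ∷ exc 1 2 2 m₁ ∷ exc 1 2 3 m₁ ∷ exc 1 2 6 m₁ ∷ exc 1 2 4 m₁ ∷ [])
    where
    open Quadratic {root} isR primR ty chi₂
    cl₈ = from-yes (class? 2 8 1 type6-1)
    cl₃ = from-yes (class? 3 3 1 type6-1)
    m₁ : Missing root 2 1
    m₁ m m≢0 = 1≢-1 ∘ square₁ (from-yes (residues? 1 2 type6-1 0∨1?)) m m≢0
    -- The residue 1 is admissible for this type, so curvature 1 is excluded by the missing value 1
    -- · 1². For the types other than (6,1) the residue list already excludes it.
    open Conclude {root} isR primR ty (m₁ 1 λ ())
    m₂ : Missing root 2 2
    m₂ m m≢0 = 1≢-1 ∘ square₂ (inj₁ refl) cl₈ (from-yes (residues? 2 2 type6-1 ≡8?)) m m≢0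
    m₃ : Missing root 2 3
    m₃ m m≢0 = 1≢-1 ∘ square₃ (inj₁ refl) cl₃ (from-yes (residues? 3 2 type6-1 0∨1?)) m m≢0
    m₆ : Missing root 2 6
    m₆ m m≢0 = 1≢-1 ∘ square₆ (inj₁ refl) (inj₁ refl) cl₈ cl₃ (from-yes (residues? 6 2 type6-1 ≡8?)) m m≢0

  type6-1⁺⁻ : TypeIs root type6-1 → Chi4Is root (-ᵍ 1ᵍ) →
    Conclusion root ((4 , 1) ∷ (4 , 4) ∷ (4 , 9) ∷ (4 , 36) ∷ []) (0 ∷ 1 ∷ 4 ∷ 9 ∷ 12 ∷ 16 ∷ [])
  type6-1⁺⁻ ty chi₄ =
      (obs₄ 1 1 m₁ ∷ obs₄ 4 1 m₄ ∷ obs₄ 9 1 m₉ ∷ obs₄ 36 1 m₃₆ ∷ [])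
    , (exc 1 4 0 m₁ ∷ exc 1 4 1 m₁ ∷ exc 4 4 1 m₄ ∷ exc 9 4 1 m₉ ∷ exc 36 4 1 m₃₆ ∷ exc 1 4 2 m₁ ∷ [])
    where
    open Quartic {root} isR primR placed ty (from-yes (class? 2 8 1 type6-1)) (inj₁ refl)
      (from-yes (class? 3 3 1 type6-1)) chi₄
    m₁ : Missing root 4 1
    m₁ m m≢0 = 1ᵍ≢-1ᵍ ∘ fourth₁ 0 (from-yes (residues? 1 4 type6-1 0∨1∨4?)) m m≢0
    open Conclude {root} isR primR ty (m₁ 1 λ ())
    m₄ : Missing root 4 4
    m₄ m m≢0 = 1ᵍ≢-1ᵍ ∘ fourth₁ 1 (from-yes (residues? 4 4 type6-1 0∨1∨4?)) m m≢0
    m₉ : Missing root 4 9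
    m₉ m m≢0 = 1ᵍ≢-1ᵍ ∘ fourth₉ 0 (from-yes (residues? 9 4 type6-1 0∨1∨4?)) m m≢0
    m₃₆ : Missing root 4 36
    m₃₆ m m≢0 = 1ᵍ≢-1ᵍ ∘ fourth₉ 1 (from-yes (residues? 36 4 type6-1 0∨1∨4?)) m m≢0

  type6-5⁺ : TypeIs root type6-5 → Chi2Is root 1ℤ → Conclusion root ((2 , 2) ∷ (2 , 3) ∷ []) (0 ∷ 8 ∷ 12 ∷ [])
  type6-5⁺ ty chi₂ = (obs₂ 2 2 m₂ ∷ obs₂ 3 2 m₃ ∷ []) , (exc 2 2 0 m₂ ∷ exc 2 2 2 m₂ ∷ exc 3 2 2 m₃ ∷ [])
    where
    open Quadratic {root} isR primR ty chi₂
    open Conclude {root} isR primR ty (from-no (1 ∈? type6-5) ∘ curv-residue {root} ty)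
    m₂ : Missing root 2 2
    m₂ m m≢0 = -1≢1 ∘ square₂ (inj₂ refl) (from-yes (class? 2 8 5 type6-5))
      (from-yes (residues? 2 2 type6-5 ≡8?)) m m≢0
    m₃ : Missing root 2 3
    m₃ m m≢0 = -1≢1 ∘ square₃ (inj₂ refl) (from-yes (class? 3 3 2 type6-5))
      (from-yes (residues? 3 2 type6-5 0∨1?)) m m≢0

  type6-5⁻ : TypeIs root type6-5 → Chi2Is root (- 1ℤ) → Conclusion root ((2 , 1) ∷ (2 , 6) ∷ []) (0 ∷ 12 ∷ [])
  type6-5⁻ ty chi₂ = (obs₂ 1 0 m₁ ∷ obs₂ 6 2 m₆ ∷ []) , (exc 1 2 0 m₁ ∷ exc 1 2 6 m₁ ∷ [])
    where
    open Quadratic {root} isR primR ty chi₂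
    open Conclude {root} isR primR ty (from-no (1 ∈? type6-5) ∘ curv-residue {root} ty)
    m₁ : Missing root 2 1
    m₁ m m≢0 = 1≢-1 ∘ square₁ (from-yes (residues? 1 2 type6-5 0∨1?)) m m≢0
    m₆ : Missing root 2 6
    m₆ m m≢0 = 1≢-1 ∘ square₆ (inj₂ refl) (inj₂ refl) (from-yes (class? 2 8 5 type6-5))
      (from-yes (class? 3 3 2 type6-5)) (from-yes (residues? 6 2 type6-5 ≡8?)) m m≢0

  type6-13⁺ : TypeIs root type6-13 → Chi2Is root 1ℤ → Conclusion root ((2 , 2) ∷ (2 , 6) ∷ []) (0 ∷ [])
  type6-13⁺ ty chi₂ = (obs₂ 2 0 m₂ ∷ obs₂ 6 2 m₆ ∷ []) , (exc 2 2 0 m₂ ∷ [])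
    where
    open Quadratic {root} isR primR ty chi₂
    open Conclude {root} isR primR ty (from-no (1 ∈? type6-13) ∘ curv-residue {root} ty)
    m₂ : Missing root 2 2
    m₂ m m≢0 = -1≢1 ∘ square₂ (inj₂ refl) (from-yes (class? 2 8 5 type6-13))
      (from-yes (residues? 2 2 type6-13 ≡8?)) m m≢0
    m₆ : Missing root 2 6
    m₆ m m≢0 = -1≢1 ∘ square₆ (inj₂ refl) (inj₁ refl) (from-yes (class? 2 8 5 type6-13))
      (from-yes (class? 3 3 1 type6-13)) (from-yes (residues? 6 2 type6-13 ≡8?)) m m≢0

  type6-13⁻ : TypeIs root type6-13 → Chi2Is root (- 1ℤ) → Conclusion root ((2 , 1) ∷ (2 , 3) ∷ [])
    (0 ∷ 4 ∷ 12 ∷ 16 ∷ [])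
  type6-13⁻ ty chi₂ = (obs₂ 1 2 m₁ ∷ obs₂ 3 2 m₃ ∷ []) ,
    (exc 1 2 0 m₁ ∷ exc 1 2 2 m₁ ∷ exc 3 2 2 m₃ ∷ exc 1 2 4 m₁ ∷ [])
    where
    open Quadratic {root} isR primR ty chi₂
    open Conclude {root} isR primR ty (from-no (1 ∈? type6-13) ∘ curv-residue {root} ty)
    m₁ : Missing root 2 1
    m₁ m m≢0 = 1≢-1 ∘ square₁ (from-yes (residues? 1 2 type6-13 0∨1?)) m m≢0
    m₃ : Missing root 2 3
    m₃ m m≢0 = 1≢-1 ∘ square₃ (inj₁ refl) (from-yes (class? 3 3 1 type6-13))
      (from-yes (residues? 3 2 type6-13 0∨1?)) m m≢0

  module _ (ty : TypeIs root type6-17) where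

    private
      cl₈ = from-yes (class? 2 8 1 type6-17)
      cl₃ = from-yes (class? 3 3 2 type6-17)
    open Conclude {root} isR primR ty (from-no (1 ∈? type6-17) ∘ curv-residue {root} ty)

    module _ (chi₂ : Chi2Is root 1ℤ) where

      private
        open Quadratic {root} isR primR ty chi₂
        m₃ : Missing root 2 3
        m₃ m m≢0 = -1≢1 ∘ square₃ (inj₂ refl) cl₃ (from-yes (residues? 3 2 type6-17 0∨1?)) m m≢0
        m₆ : Missing root 2 6
        m₆ m m≢0 = -1≢1 ∘ square₆ (inj₁ refl) (inj₂ refl) cl₈ cl₃ (from-yes (residues? 6 2 type6-17 ≡8?)) m m≢0

      type6-17⁺⁺ : Chi4Is root 1ᵍ → Conclusion root ((2 , 3) ∷ (2 , 6) ∷ (4 , 9) ∷ (4 , 36) ∷ []) (0 ∷ 9 ∷ 12 ∷ [])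
      type6-17⁺⁺ chi₄ = (obs₂ 3 2 m₃ ∷ obs₂ 6 2 m₆ ∷ obs₄ 9 1 m₉ ∷ obs₄ 36 1 m₃₆ ∷ []) ,
        (exc 3 2 0 m₃ ∷ exc 9 4 1 m₉ ∷ exc 3 2 2 m₃ ∷ [])
        where
        open Quartic {root} isR primR placed ty cl₈ (inj₂ refl) cl₃ chi₄
        m₉ : Missing root 4 9
        m₉ m m≢0 = -1ᵍ≢1ᵍ ∘ fourth₉ 0 (from-yes (residues? 9 4 type6-17 0∨1∨4?)) m m≢0
        m₃₆ : Missing root 4 36
        m₃₆ m m≢0 = -1ᵍ≢1ᵍ ∘ fourth₉ 1 (from-yes (residues? 36 4 type6-17 0∨1∨4?)) m m≢0

      type6-17⁺⁻ : Chi4Is root (-ᵍ 1ᵍ) → Conclusion root ((2 , 3) ∷ (2 , 6) ∷ (4 , 1) ∷ (4 , 4) ∷ [])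
        (0 ∷ 9 ∷ 12 ∷ [])
      type6-17⁺⁻ chi₄ = (obs₂ 3 2 m₃ ∷ obs₂ 6 2 m₆ ∷ obs₄ 1 3 m₁ ∷ obs₄ 4 3 m₄ ∷ []) ,
        (exc 3 2 0 m₃ ∷ exc 1 4 3 m₁ ∷ exc 3 2 2 m₃ ∷ [])
        where
        open Quartic {root} isR primR placed ty cl₈ (inj₂ refl) cl₃ chi₄
        m₁ : Missing root 4 1
        m₁ m m≢0 = 1ᵍ≢-1ᵍ ∘ fourth₁ 0 (from-yes (residues? 1 4 type6-17 0∨1∨4?)) m m≢0
        m₄ : Missing root 4 4
        m₄ m m≢0 = 1ᵍ≢-1ᵍ ∘ fourth₁ 1 (from-yes (residues? 4 4 type6-17 0∨1∨4?)) m m≢0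

    type6-17⁻ : Chi2Is root (- 1ℤ) → Conclusion root ((2 , 1) ∷ (2 , 2) ∷ []) (0 ∷ 8 ∷ 9 ∷ 12 ∷ [])
    type6-17⁻ chi₂ = (obs₂ 1 3 m₁ ∷ obs₂ 2 2 m₂ ∷ []) ,
      (exc 1 2 0 m₁ ∷ exc 2 2 2 m₂ ∷ exc 1 2 3 m₁ ∷ exc 1 2 6 m₁ ∷ [])
      where
      open Quadratic {root} isR primR ty chi₂
      m₁ : Missing root 2 1
      m₁ m m≢0 = 1≢-1 ∘ square₁ (from-yes (residues? 1 2 type6-17 0∨1?)) m m≢0
      m₂ : Missing root 2 2
      m₂ m m≢0 = 1≢-1 ∘ square₂ (inj₁ refl) cl₈ (from-yes (residues? 2 2 type6-17 ≡8?)) m m≢0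

  type8-7⁺ : TypeIs root type8-7 → Chi2Is root 1ℤ → Conclusion root ((2 , 3) ∷ (2 , 6) ∷ []) (3 ∷ 6 ∷ [])
  type8-7⁺ ty chi₂ = (obs₂ 3 1 m₃ ∷ obs₂ 6 1 m₆ ∷ []) , (exc 3 2 1 m₃ ∷ exc 6 2 1 m₆ ∷ [])
    where
    open Quadratic {root} isR primR ty chi₂
    open Conclude {root} isR primR ty (from-no (1 ∈? type8-7) ∘ curv-residue {root} ty)
    cl₃ = from-yes (class? 3 3 1 type8-7)
    m₃ : Missing root 2 3
    m₃ m m≢0 = -1≢1 ∘ square₃′ (inj₁ (refl , refl)) cl₃ (from-yes (residues? 3 2 type8-7 (≡4? 3))) m m≢0
    m₆ : Missing root 2 6
    m₆ m m≢0 = -1≢1 ∘ square₆′ (inj₁ (refl , refl)) cl₃ (from-yes (residues? 6 2 type8-7 (≡4? 2))) m m≢0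

  type8-7⁻ : TypeIs root type8-7 → Chi2Is root (- 1ℤ) → Conclusion root ((2 , 2) ∷ []) (18 ∷ [])
  type8-7⁻ ty chi₂ = (obs₂ 2 3 m₂ ∷ []) , (exc 2 2 3 m₂ ∷ [])
    where
    open Quadratic {root} isR primR ty chi₂
    open Conclude {root} isR primR ty (from-no (1 ∈? type8-7) ∘ curv-residue {root} ty)
    m₂ : Missing root 2 2
    m₂ m m≢0 = 1≢-1 ∘ square₂′ (from-yes (residues? 2 2 type8-7 (≡4? 2))) m m≢0

  type8-11⁻ : TypeIs root type8-11 → Chi2Is root (- 1ℤ) →
    Conclusion root ((2 , 2) ∷ (2 , 3) ∷ (2 , 6) ∷ []) (2 ∷ 3 ∷ 6 ∷ 18 ∷ [])
  type8-11⁻ ty chi₂ = (obs₂ 2 1 m₂ ∷ obs₂ 3 1 m₃ ∷ obs₂ 6 1 m₆ ∷ []) ,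
    (exc 2 2 1 m₂ ∷ exc 3 2 1 m₃ ∷ exc 6 2 1 m₆ ∷ exc 2 2 3 m₂ ∷ [])
    where
    open Quadratic {root} isR primR ty chi₂
    open Conclude {root} isR primR ty (from-no (1 ∈? type8-11) ∘ curv-residue {root} ty)
    cl₃ = from-yes (class? 3 3 2 type8-11)
    m₂ : Missing root 2 2
    m₂ m m≢0 = 1≢-1 ∘ square₂′ (from-yes (residues? 2 2 type8-11 (≡4? 2))) m m≢0
    m₃ : Missing root 2 3
    m₃ m m≢0 = 1≢-1 ∘ square₃′ (inj₂ (refl , refl)) cl₃ (from-yes (residues? 3 2 type8-11 (≡4? 3))) m m≢0
    m₆ : Missing root 2 6
    m₆ m m≢0 = 1≢-1 ∘ square₆′ (inj₂ (refl , refl)) cl₃ (from-yes (residues? 6 2 type8-11 (≡4? 2))) m m≢0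

theorem2p4 : ∀ (root : Config) → IsDescartes root → Primitive root → Placed root →
    (TypeIs root type6-1 → Chi2Is root 1ℤ → Chi4Is root 1ᵍ →
    Conclusion root [] [])
    × (TypeIs root type6-1 → Chi2Is root 1ℤ → Chi4Is root (-ᵍ 1ᵍ) →
    Conclusion root ((4 , 1) ∷ (4 , 4) ∷ (4 , 9) ∷ (4 , 36) ∷ [])
    (0 ∷ 1 ∷ 4 ∷ 9 ∷ 12 ∷ 16 ∷ []))
    × (TypeIs root type6-1 → Chi2Is root (- 1ℤ) →
    Conclusion root ((2 , 1) ∷ (2 , 2) ∷ (2 , 3) ∷ (2 , 6) ∷ [])
    (0 ∷ 1 ∷ 4 ∷ 9 ∷ 12 ∷ 16 ∷ []))
    × (TypeIs root type6-5 → Chi2Is root 1ℤ →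
    Conclusion root ((2 , 2) ∷ (2 , 3) ∷ []) (0 ∷ 8 ∷ 12 ∷ []))
    × (TypeIs root type6-5 → Chi2Is root (- 1ℤ) →
    Conclusion root ((2 , 1) ∷ (2 , 6) ∷ []) (0 ∷ 12 ∷ []))
    × (TypeIs root type6-13 → Chi2Is root 1ℤ →
    Conclusion root ((2 , 2) ∷ (2 , 6) ∷ []) (0 ∷ []))
    × (TypeIs root type6-13 → Chi2Is root (- 1ℤ) →
    Conclusion root ((2 , 1) ∷ (2 , 3) ∷ []) (0 ∷ 4 ∷ 12 ∷ 16 ∷ []))
    × (TypeIs root type6-17 → Chi2Is root 1ℤ → Chi4Is root 1ᵍ →
    Conclusion root ((2 , 3) ∷ (2 , 6) ∷ (4 , 9) ∷ (4 , 36) ∷ []) (0 ∷ 9 ∷ 12 ∷ []))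
    × (TypeIs root type6-17 → Chi2Is root 1ℤ → Chi4Is root (-ᵍ 1ᵍ) →
    Conclusion root ((2 , 3) ∷ (2 , 6) ∷ (4 , 1) ∷ (4 , 4) ∷ []) (0 ∷ 9 ∷ 12 ∷ []))
    × (TypeIs root type6-17 → Chi2Is root (- 1ℤ) →
    Conclusion root ((2 , 1) ∷ (2 , 2) ∷ []) (0 ∷ 8 ∷ 9 ∷ 12 ∷ []))
    × (TypeIs root type8-7 → Chi2Is root 1ℤ →
    Conclusion root ((2 , 3) ∷ (2 , 6) ∷ []) (3 ∷ 6 ∷ []))
    × (TypeIs root type8-7 → Chi2Is root (- 1ℤ) →
    Conclusion root ((2 , 2) ∷ []) (18 ∷ []))
    × (TypeIs root type8-11 → Chi2Is root 1ℤ →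
    Conclusion root [] [])
    × (TypeIs root type8-11 → Chi2Is root (- 1ℤ) →
    Conclusion root ((2 , 2) ∷ (2 , 3) ∷ (2 , 6) ∷ []) (2 ∷ 3 ∷ 6 ∷ 18 ∷ []))
theorem2p4 root isR primR placed =
    (λ _ _ _ → [] , [])
  , (λ ty _ chi₄ → type6-1⁺⁻ {root} isR primR placed ty chi₄)
  , type6-1⁻ {root} isR primR placed
  , type6-5⁺ {root} isR primR placed
  , type6-5⁻ {root} isR primR placed
  , type6-13⁺ {root} isR primR placed
  , type6-13⁻ {root} isR primR placed
  , type6-17⁺⁺ {root} isR primR placed
  , type6-17⁺⁻ {root} isR primR placed
  , type6-17⁻ {root} isR primR placed
  , type8-7⁺ {root} isR primR placed
  , type8-7⁻ {root} isR primR placed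
  , (λ _ _ → [] , [])
  , type8-11⁻ {root} isR primR placed
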